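{- Let $P$ be a cutting scheme of $\mathcal E$ of maximum density $\tau(\mathcal E)$ (such a scheme exists). There is a cutting scheme $\overline P$ of $\overline{\mathcal E}$ that has maximum density $\tau(\mathcal E)$ with respect to $\overline{\mathcal E}$. Thus $\tau(\overline{\mathcal E})=\tau(\mathcal E)$.
   Context: Let $k\ge 3$ and $\Delta=\{x\in\mathbb{R}^k : x\ge 0,\ \sum_i x_i=1\}$; the vertices of $\Delta$ (standard basis vectors) are called terminals. The length $|e|$ of an edge $e$ is half the $L_1$ distance between its endpoints. $\overline{\mathcal E}$ is the set of all edges (unordered pairs of distinct points) in $\Delta$; $\mathcal E$ is the set of those edges in $\overline{\mathcal E}$ whose endpoints are rational. For $E\subseteq\overline{\mathcal E}$, a $k$-way cut of $E$ is a subset $C\subseteq E$ such that $E\setminus C$ contains no path between two distinct terminals. For finite $E$, a cutting scheme of $E$ is a probability distribution on the $k$-way cuts of $E$. For arbitrary $F\subseteq\overline{\mathcal E}$, a cutting scheme of $F$ is a probability measure on subsets $C$ of $F$, with the $\sigma$-algebra generated by the events $\{e\in C\}$, $e\in F$, whose restriction ($C\mapsto C\cap E$) to every finite $E\subseteq F$ is a cutting scheme of $E$. The maximum density of a cutting scheme $P$ of $F$ (with respect to $F$) is $\sup_{e\in F}\Pr[P\text{ cuts }e]/|e|$, where "$P$ cuts $e$" means $e\in C$; and $\tau(F)$ is the infimum of the maximum density over all cutting schemes of $F$. -}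

module Defs where

open import Algebra.Bundles using (CommutativeRing)
import Algebra.Construct.NaturalChoice.Max as Max
import Algebra.Definitions.RawMonoid as RawMonoidDefs
open import Algebra.Structures using (IsCommutativeRing)
open import Axiom.ExcludedMiddle using (ExcludedMiddle)
open import Data.Bool.Base using (if_then_else_)
open import Data.Empty using (⊥-elim)
open import Data.Fin.Base using (Fin; toℕ)
import Data.Fin.Properties as Fin
open import Data.Integer.Base using (ℤ; +_; -[1+_])
open import Data.List.Base using (List)
open import Data.List.Relation.Unary.Any using (Any)
open import Data.Nat.Base as ℕ using (ℕ; suc)
open import Data.Product using (Σ-syntax; ∃; ∃-syntax; _×_; _,_; proj₁; proj₂)
open import Data.Rational.Base using (ℚ; ↥_; ↧_)
open import Data.Sum.Base using (_⊎_; inj₁; inj₂)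
open import Data.Vec.Base using (Vec; lookup; tabulate)
open import Data.Vec.Relation.Unary.All using (All)
open import Level using (Level; 0ℓ; Lift; lift; lower) renaming (suc to lsuc)
open import Relation.Binary.Bundles using (TotalOrder)
open import Relation.Binary.Construct.Closure.ReflexiveTransitive using (Star)
import Relation.Binary.Construct.Add.Extrema.NonStrict as Extrema
import Relation.Binary.Construct.Add.Supremum.NonStrict as Supremum
import Relation.Binary.Construct.NonStrictToStrict as Strict
open import Relation.Binary.Core using (Rel)
open import Relation.Binary.Definitions using (_Respects_)
open import Relation.Binary.PropositionalEquality using (_≡_; _≢_; refl)
open import Relation.Binary.Structures using (IsTotalOrder)
open import Relation.Nullary.Construct.Add.Extrema using (_±; ⊥±; ⊤±; [_])
open import Relation.Nullary.Decidable using (Dec; yes; no; does; True; toWitness; fromWitness; map′)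
open import Relation.Nullary.Negation using (¬_)
open import Relation.Unary using (Pred; _∈_; _⊆_; _≐_; _∩_; _∖_; _⊢_; _⊥_; ∁; ⋃; U; Satisfiable)

private
  variable
    ℓ ℓ₁ : Level
    A : Set ℓ₁

lower-em : ExcludedMiddle ℓ → ExcludedMiddle 0ℓ
lower-em {ℓ} em {P} = map′ lower lift (em {Lift ℓ P})

UpperBound : Rel A 0ℓ → Pred A ℓ → Pred A _
UpperBound _≤_ S b = ∀ {x} → x ∈ S → x ≤ b

LowerBound : Rel A 0ℓ → Pred A ℓ → Pred A _
LowerBound _≤_ S b = ∀ {x} → x ∈ S → b ≤ x

IsSup : Rel A 0ℓ → Pred A ℓ → Pred A _
IsSup _≤_ S s = UpperBound _≤_ S s × LowerBound _≤_ (UpperBound _≤_ S) s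

IsInf : Rel A 0ℓ → Pred A ℓ → Pred A _
IsInf _≤_ S s = LowerBound _≤_ S s × UpperBound _≤_ (LowerBound _≤_ S) s

-- The real numbers, characterised (uniquely up to isomorphism) as a
-- Dedekind-complete totally ordered field. The value of 0# ⁻¹ is unspecified.

record CompleteOrderedField : Set₁ where
  infix  8 _⁻¹ -_
  infixl 7 _*_
  infixl 6 _+_
  infix  4 _≤_
  field
    ℝ                 : Set
    _≤_               : Rel ℝ 0ℓ
    _+_ _*_           : ℝ → ℝ → ℝ
    -_ _⁻¹            : ℝ → ℝ
    0# 1#             : ℝ
    isCommutativeRing : IsCommutativeRing _≡_ _+_ _*_ -_ 0# 1#
    0≢1               : 0# ≢ 1#
    *-inverseʳ        : ∀ x → x ≢ 0# → x * x ⁻¹ ≡ 1#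
    isTotalOrder      : IsTotalOrder _≡_ _≤_
    +-monoʳ-≤         : ∀ x {y z} → y ≤ z → x + y ≤ x + z
    *-nonNegative     : ∀ {x y} → 0# ≤ x → 0# ≤ y → 0# ≤ x * y
    complete          : (S : Pred ℝ 0ℓ) → Satisfiable S →
                        Satisfiable (UpperBound _≤_ S) → Satisfiable (IsSup _≤_ S)

module RealAnalysis (R : CompleteOrderedField) where
  open CompleteOrderedField R public

  commutativeRing : CommutativeRing 0ℓ 0ℓ
  commutativeRing = record { isCommutativeRing = isCommutativeRing }

  totalOrder : TotalOrder 0ℓ 0ℓ 0ℓ
  totalOrder = record { isTotalOrder = isTotalOrder }

  open Strict _≡_ _≤_ public using (_<_)
  open RawMonoidDefs (CommutativeRing.+-rawMonoid commutativeRing) public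
    using (sum) renaming (_×_ to _·_)
  open Max totalOrder public using (_⊔_)

  infixl 6 _-_
  _-_ : ℝ → ℝ → ℝ
  x - y = x + - y

  ∣_∣ : ℝ → ℝ
  ∣ x ∣ = x ⊔ - x

  ½ : ℝ
  ½ = (1# + 1#) ⁻¹

  fromℤ : ℤ → ℝ
  fromℤ (+ n)    = n · 1#
  fromℤ -[1+ n ] = - (suc n · 1#)

  fromℚ : ℚ → ℝ
  fromℚ q = fromℤ (↥ q) * fromℤ (↧ q) ⁻¹

  IsRational : Pred ℝ 0ℓ
  IsRational x = ∃[ q ] x ≡ fromℚ q

  _ConvergesTo_ : (ℕ → ℝ) → ℝ → Set
  a ConvergesTo l = ∀ ε → 0# < ε → ∃[ N ] ∀ n → N ℕ.≤ n → ∣ a n - l ∣ ≤ ε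

  partialSum : (ℕ → ℝ) → ℕ → ℝ
  partialSum a n = sum {n} (λ i → a (toℕ i))

  _SumsTo_ : (ℕ → ℝ) → ℝ → Set
  a SumsTo s = partialSum a ConvergesTo s

  -- The extended reals [-∞, +∞], with ⊥± = -∞ and ⊤± = +∞.

  ℝ± : Set
  ℝ± = ℝ ±

  open Extrema _≤_ public using (_≤±_)

  module _ (em : ExcludedMiddle ℓ) where
    private
      module E = Extrema _≤_

      [x]≰⊥ : ∀ {x} → ¬ [ x ] ≤± ⊥±
      [x]≰⊥ Supremum.[ () ]

    sup-exists : (S : Pred ℝ± ℓ) → ∃ (IsSup _≤±_ S)
    sup-exists S with em {⊤± ∈ S}
    ... | yes ⊤∈S = ⊤± , (λ {x} _ → x E.≤⊤±) , λ ub → ub ⊤∈S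
    ... | no  ⊤∉S = helper (lower-em em) (lower-em em)
      where
      S′ : Pred ℝ 0ℓ
      S′ x = True (em {[ x ] ∈ S})

      helper : Dec (∃ S′) → Dec (∃ (UpperBound _≤_ S′)) → ∃ (IsSup _≤±_ S)
      helper (no empty) _ = ⊥± , upper , λ {b} _ → E.⊥±≤ b
        where
        upper : UpperBound _≤±_ S ⊥±
        upper {⊥±}    _   = E.⊥±≤⊥±
        upper {[ x ]} x∈S = ⊥-elim (empty (x , fromWitness x∈S))
        upper {⊤±}    ⊤∈S = ⊥-elim (⊤∉S ⊤∈S)
      helper (yes (a , a∈S′)) (no unbounded) = ⊤± , (λ {x} _ → x E.≤⊤±) , least
        where
        least : LowerBound _≤±_ (UpperBound _≤±_ S) ⊤±
        least {⊤±}    _  = E.⊤±≤⊤±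
        least {[ b ]} ub = ⊥-elim (unbounded (b , λ x∈S′ → E.[≤]-injective (ub (toWitness x∈S′))))
        least {⊥±}    ub = ⊥-elim ([x]≰⊥ (ub (toWitness a∈S′)))
      helper (yes (a , a∈S′)) (yes bounded)
        with s , s-upper , s-least ← complete S′ (a , a∈S′) bounded
        = [ s ] , upper , least
        where
        upper : UpperBound _≤±_ S [ s ]
        upper {⊥±}    _   = E.⊥±≤ [ s ]
        upper {[ x ]} x∈S = E.[ s-upper (fromWitness x∈S) ]
        upper {⊤±}    ⊤∈S = ⊥-elim (⊤∉S ⊤∈S)
        least : LowerBound _≤±_ (UpperBound _≤±_ S) [ s ]
        least {⊤±}    _  = E.[ s ]≤⊤±
        least {[ b ]} ub = E.[ s-least (λ x∈S′ → E.[≤]-injective (ub (toWitness x∈S′))) ]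
        least {⊥±}    ub = ⊥-elim ([x]≰⊥ (ub (toWitness a∈S′)))

    inf-exists : (S : Pred ℝ± ℓ) → ∃ (IsInf _≤±_ S)
    inf-exists S with s , s-upper , s-least ← sup-exists (LowerBound _≤±_ S)
      = s , (λ x∈S → s-least (λ lb → lb x∈S)) , s-upper

    sup inf : Pred ℝ± ℓ → ℝ±
    sup S = proj₁ (sup-exists S)
    inf S = proj₁ (inf-exists S)

module CuttingSchemes
  (em : ExcludedMiddle (lsuc 0ℓ)) (R : CompleteOrderedField) (k : ℕ) where
  open RealAnalysis R public

  Δ : Pred (Vec ℝ k) 0ℓ
  Δ x = All (0# ≤_) x × sum (lookup x) ≡ 1#

  terminal : Fin k → Vec ℝ k
  terminal i = tabulate λ j → if does (i Fin.≟ j) then 1# else 0#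

  -- An edge is an unordered pair: _≈_ identifies the two orientations, and
  -- every set of edges below respects it.

  record Edge : Set where
    field
      end₁ end₂ : Vec ℝ k
      end₁∈Δ    : end₁ ∈ Δ
      end₂∈Δ    : end₂ ∈ Δ
      distinct  : end₁ ≢ end₂
  open Edge public

  infix 4 _≈_
  _≈_ : Rel Edge 0ℓ
  e ≈ f = (end₁ e ≡ end₁ f × end₂ e ≡ end₂ f) ⊎ (end₁ e ≡ end₂ f × end₂ e ≡ end₁ f)

  length : Edge → ℝ
  length e = ½ * sum λ i → ∣ lookup (end₁ e) i - lookup (end₂ e) i ∣

  record EdgeSet : Set₁ where
    field
      member   : Pred Edge 0ℓ
      respects : member Respects _≈_
  open EdgeSet public

  Finite : EdgeSet → Set
  Finite E = Σ[ es ∈ List Edge ] ∀ {e} → e ∈ member E → Any (e ≈_) es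

  allEdges : EdgeSet
  allEdges = record { member = U ; respects = λ _ _ → _ }

  RationalPoint : Pred (Vec ℝ k) 0ℓ
  RationalPoint = All IsRational

  rationalEdges : EdgeSet
  rationalEdges = record
    { member   = λ e → RationalPoint (end₁ e) × RationalPoint (end₂ e)
    ; respects = λ { (inj₁ (refl , refl)) (p , q) → p , q
                   ; (inj₂ (refl , refl)) (p , q) → q , p }
    }

  record SubsetOf (F : EdgeSet) : Set₁ where
    field
      set    : EdgeSet
      subset : member set ⊆ member F

    elements : Pred Edge 0ℓ
    elements = member set
  open SubsetOf public using (elements)

  restrictSet : ∀ {E F} → SubsetOf F → SubsetOf E
  restrictSet {E} C = record
    { set    = record
      { member   = elements C ∩ member E
      ; respects = λ e≈f (p , q) → respects (SubsetOf.set C) e≈f p , respects E e≈f q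
      }
    ; subset = proj₂
    }

  -- Star gives finite walks in the graph whose edge set is G.

  Adjacent : Pred Edge 0ℓ → Rel (Vec ℝ k) 0ℓ
  Adjacent G x y = Σ[ e ∈ Edge ] e ∈ G ×
    ((end₁ e ≡ x × end₂ e ≡ y) ⊎ (end₁ e ≡ y × end₂ e ≡ x))

  Path : Pred Edge 0ℓ → Rel (Vec ℝ k) 0ℓ
  Path G = Star (Adjacent G)

  IsKWayCut : (E : EdgeSet) → Pred (SubsetOf E) 0ℓ
  IsKWayCut E C = ∀ i j → i ≢ j → ¬ Path (member E ∖ elements C) (terminal i) (terminal j)

  Event : EdgeSet → Set₁
  Event F = Pred (SubsetOf F) 0ℓ

  Cuts : ∀ {F} → Edge → Event F
  Cuts e C = e ∈ elements C

  -- The σ-algebra generated by the events {e ∈ C}, e ∈ F. The constructor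
  -- `extensional` compensates for the absence of predicate extensionality.

  data Measurable {F : EdgeSet} : Event F → Set₁ where
    generator   : ∀ {e} → e ∈ member F → Measurable (Cuts e)
    whole       : Measurable U
    complement  : ∀ {A} → Measurable A → Measurable (∁ A)
    union       : ∀ {A : ℕ → Event F} → (∀ n → Measurable (A n)) → Measurable (⋃ ℕ A)
    extensional : ∀ {A B} → A ≐ B → Measurable A → Measurable B

  record ProbabilityMeasure (F : EdgeSet) : Set₁ where
    field
      Pr            : (A : Event F) → Measurable A → ℝ
      Pr-cong       : ∀ {A B} (a : Measurable A) (b : Measurable B) → A ≐ B → Pr A a ≡ Pr B b
      nonNegative   : ∀ {A} (a : Measurable A) → 0# ≤ Pr A a
      total         : Pr U whole ≡ 1#
      countably-additive :
        ∀ {A : ℕ → Event F} (a : ∀ n → Measurable (A n)) → (∀ m n → m ≢ n → A m ⊥ A n) →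
        (λ n → Pr (A n) (a n)) SumsTo Pr (⋃ ℕ A) (union a)

  restrict-measurable : ∀ {E F} → member E ⊆ member F →
    {A : Event E} → Measurable A → Measurable {F} (restrictSet ⊢ A)
  restrict-measurable E⊆F (generator e∈E)           =
    extensional ((λ e∈C → e∈C , e∈E) , proj₁) (generator (E⊆F e∈E))
  restrict-measurable E⊆F whole                     = whole
  restrict-measurable E⊆F (complement a)            = complement (restrict-measurable E⊆F a)
  restrict-measurable E⊆F (union a)                 = union λ n → restrict-measurable E⊆F (a n)
  restrict-measurable E⊆F (extensional (A⊆B , B⊆A) a) =
    extensional ((λ {C} → A⊆B {restrictSet C}) , (λ {C} → B⊆A {restrictSet C}))
                (restrict-measurable E⊆F a)

  -- The distribution of C ∩ E, for C distributed according to P.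

  restrict : ∀ {E F} → member E ⊆ member F → ProbabilityMeasure F → ProbabilityMeasure E
  restrict E⊆F P = record
    { Pr                 = λ A a → Pr (restrictSet ⊢ A) (restrict-measurable E⊆F a)
    ; Pr-cong            = λ a b (A⊆B , B⊆A) → Pr-cong _ _
        ((λ {C} → A⊆B {restrictSet C}) , (λ {C} → B⊆A {restrictSet C}))
    ; nonNegative        = λ a → nonNegative (restrict-measurable E⊆F a)
    ; total              = total
    ; countably-additive = λ a disjoint → countably-additive
        (λ n → restrict-measurable E⊆F (a n))
        (λ m n m≢n {C} → disjoint m n m≢n {restrictSet C})
    }
    where open ProbabilityMeasure P

  -- For finite E every extensional event on subsets of E is measurable (by excluded
  -- middle), so this says that P is a probability distribution on the k-way cuts
  -- of E.

  SupportedOnKWayCuts : (E : EdgeSet) → ProbabilityMeasure E → Set₁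
  SupportedOnKWayCuts E P =
    Σ[ a ∈ Measurable (IsKWayCut E) ] ProbabilityMeasure.Pr P (IsKWayCut E) a ≡ 1#

  record CuttingScheme (F : EdgeSet) : Set₁ where
    field
      measure        : ProbabilityMeasure F
      finite-schemes : (E : EdgeSet) (E⊆F : member E ⊆ member F) → Finite E →
                       SupportedOnKWayCuts E (restrict E⊆F measure)

    cutProbability : (e : Edge) → e ∈ member F → ℝ
    cutProbability e e∈F = ProbabilityMeasure.Pr measure (Cuts e) (generator e∈F)

    density : (e : Edge) → e ∈ member F → ℝ
    density e e∈F = cutProbability e e∈F * length e ⁻¹

  maxDensity : ∀ {F} → CuttingScheme F → ℝ±
  maxDensity {F} P = sup (lower-em em) λ d → ∃[ e ] Σ[ e∈F ∈ e ∈ member F ] d ≡ [ CuttingScheme.density P e e∈F ]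

  τ : EdgeSet → ℝ±
  τ F = inf em λ d → ∃[ P ] d ≡ maxDensity {F} P

{-# OPTIONS --safe #-}
module Submission where

-- The optimal scheme on the rational edges is a weak limit of near-optimal ones.
-- Along a suitable subsequence the probability of every Boolean combination of the
-- countably many cutting events converges; since the space of subsets of the rational
-- edges is compact, the limiting finitely additive function generates an outer measure
-- that does not lower its values, and Carathéodory's construction yields the scheme.
--
-- To extend a scheme P from rational edges to all edges, fix rational approximations
-- x₀, x₁, … of every point x of the simplex with |x xₙ| ≤ 2⁻ⁿ (constant for rational x).
-- Given a random cut C of the rational edges, let an edge xy survive when for some N the
-- edges x_N y_N and xₙ xₙ₊₁, yₙ yₙ₊₁ (n ≥ N) all avoid C. If the surviving edges joined
-- two terminals, then so would finitely many rational edges avoiding C. By the union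
-- bound, xy is cut with probability at most T (|xy| + O(2⁻ᴺ)) for every N, where T
-- bounds the density of P. Restricting schemes back to the rational edges gives the
-- opposite inequalities.

open import Defs
open import Algebra.Bundles using (CommutativeRing)
import Algebra.Construct.NaturalChoice.Max as Max
import Algebra.Properties.AbelianGroup as AbelianGroupProperties
import Algebra.Properties.CommutativeMonoid.Sum as SumProperties
import Algebra.Properties.Monoid.Mult as MultProperties
import Algebra.Properties.Ring as RingProperties
import Algebra.Properties.Semiring.Mult.TCOptimised as Multiples
import Algebra.Solver.Ring as RingSolver
open import Algebra.Solver.Ring.AlmostCommutativeRing using (fromCommutativeRing; _-Raw-AlmostCommutative⟶_)
open import Axiom.ExcludedMiddle using (ExcludedMiddle)
open import Data.Bool.Base as Bool using (if_then_else_)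
open import Data.Empty using (⊥-elim)
open import Data.Fin.Base as Fin using (Fin)
import Data.Fin.Properties as Fin
open import Data.Integer.Base as ℤ using (ℤ; -[1+_]; _⊖_)
import Data.Integer.GCD as ℤ
import Data.Integer.Properties as ℤ
open import Data.List.Base using (List; []; _∷_; _++_; map; cartesianProductWith; concatMap; upTo)
open import Data.List.Membership.Propositional using (find; lose) renaming (_∈_ to _∈ˡ_)
open import Data.List.Membership.Propositional.Properties
  using (∈-++⁺ˡ; ∈-++⁺ʳ; ∈-map⁺; ∈-cartesianProductWith⁺; ∈-concatMap⁺; ∈-upTo⁺)
open import Data.List.Relation.Unary.All as All using (All; []; _∷_)
open import Data.List.Relation.Unary.Any using (Any; here; there)
open import Data.Maybe.Base as Maybe using (Maybe)
open import Data.Nat.Base as ℕ using (ℕ; zero; suc; z≤n; s≤s)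
import Data.Nat.Properties as ℕ
open import Data.Product using (Σ-syntax; ∃; ∃-syntax; _×_; _,_; proj₁; proj₂)
open import Data.Rational.Base as ℚ using (mkℚ; ↥_; ↧_)
import Data.Rational.Properties as ℚ
open import Data.Sum.Base using (_⊎_; inj₁; inj₂)
open import Data.Vec.Base using (Vec; []; _∷_; lookup)
open import Data.Vec.Properties using (lookup∘tabulate)
open import Data.Vec.Relation.Binary.Pointwise.Extensional using (ext; Pointwise-≡⇒≡)
open import Data.Vec.Relation.Unary.All as Allᵛ using ([]; _∷_)
import Data.Vec.Relation.Unary.All.Properties as Allᵛ
open import Function.Base using (_∘_; id)
open import Level using (0ℓ) renaming (suc to lsuc)
import Relation.Binary.Construct.Add.Extrema.NonStrict as Extrema
import Relation.Binary.Construct.Add.Supremum.NonStrict as Supremum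
open import Relation.Binary.Construct.Closure.ReflexiveTransitive as Star using (_◅_; _◅◅_)
open import Relation.Binary.Definitions using (tri<; tri≈; tri>)
open import Relation.Binary.PropositionalEquality
  using (_≡_; _≢_; refl; sym; trans; cong; cong₂; subst; subst₂; module ≡-Reasoning)
open import Relation.Binary.Structures using (IsTotalOrder)
open import Relation.Nullary.Construct.Add.Extrema using (⊥±; ⊤±; [_])
open import Relation.Nullary.Decidable
  using (Dec; yes; no; does; True; toWitness; fromWitness; decidable-stable; dec⇒maybe)
open import Relation.Nullary.Negation using (¬_; contradiction)
open import Relation.Unary using (Pred; Satisfiable; _∈_; _∉_; _⊆_; _≐_; _∩_; _∪_; _⊢_; _⊥_; ∁; ⋃; ⋂; U; ∅)

-- A diagonal subsequence controls countably many events, so the weak limit is taken on rational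
-- edges only. The edges of the whole simplex are uncountable; their scheme is instead the image of
-- `P` under one map `Φ` of cuts, which inherits countable additivity. What remains is that `Φ`
-- almost surely yields `k`-way cuts. Terminals are rational, hence fixed by the approximation. A
-- path of surviving edges has finitely many thresholds `N`; at their maximum `n` each edge `xy`
-- becomes a walk from `xₙ` to `yₙ`, back along one tail and out along the other. All rational edges
-- used lie in one finite graph `K n`, and since `n` depends on the cut, the events that `K n` is
-- cut are intersected over all `n`. The tails cost a geometric series that vanishes as `N` grows,
-- so the density does not increase at all. `τ` is an extended real: a single edge between terminals
-- excludes `⊥±`, and at `⊤±` every scheme is optimal.

-- A ring solver for the reals with integer coefficients.

module FieldSolver (R : CompleteOrderedField) where
  open RealAnalysis R
  private
    module ℛ = CommutativeRing commutativeRing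
    ring = fromCommutativeRing commutativeRing
    open Multiples ℛ.semiring using (×-homo-+; ×1-homo-*; 1+×; ×ᵤ≈×) renaming (_×_ to _×′_)
    open RingProperties ℛ.ring using (-‿distribˡ-*; -‿distribʳ-*; -0#≈0#)
    open AbelianGroupProperties ℛ.+-abelianGroup using (⁻¹-∙-comm; ⁻¹-involutive)

    -- The solver needs coefficients with an equality that computes, hence `ℤ`. With the optimised
    -- multiples, 1 and 2 evaluate to `1#` and `1# + 1#` by computation, so `:1` and `:2` match the
    -- terms that occur in goals.
    ⟦_⟧ : ℤ → ℝ
    ⟦ ℤ.+ n ⟧      = n ×′ 1#
    ⟦ -[1+ n ] ⟧ = - (suc n ×′ 1#)

    cancel : ∀ a b → (1# + a) + - (1# + b) ≡ a + - b
    cancel a b = begin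
      (1# + a) + - (1# + b)      ≡⟨ cong₂ _+_ (ℛ.+-comm 1# a) (sym (⁻¹-∙-comm 1# b)) ⟩
      (a + 1#) + (- 1# + - b)    ≡⟨ ℛ.+-assoc a 1# _ ⟩
      a + (1# + (- 1# + - b))    ≡⟨ cong (a +_) (sym (ℛ.+-assoc 1# (- 1#) (- b))) ⟩
      a + ((1# + - 1#) + - b)    ≡⟨ cong (λ z → a + (z + - b)) (ℛ.-‿inverseʳ 1#) ⟩
      a + (0# + - b)             ≡⟨ cong (a +_) (ℛ.+-identityˡ (- b)) ⟩
      a + - b                    ∎
      where open ≡-Reasoning

    ⟦⊖⟧ : ∀ m n → ⟦ m ⊖ n ⟧ ≡ (m ×′ 1#) + - (n ×′ 1#)
    ⟦⊖⟧ zero    zero    = sym (trans (cong (0# +_) -0#≈0#) (ℛ.+-identityˡ 0#))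
    ⟦⊖⟧ zero    (suc n) = sym (ℛ.+-identityˡ _)
    ⟦⊖⟧ (suc m) zero    = sym (trans (cong (suc m ×′ 1# +_) -0#≈0#) (ℛ.+-identityʳ _))
    ⟦⊖⟧ (suc m) (suc n) = begin
      ⟦ suc m ⊖ suc n ⟧                      ≡⟨ cong ⟦_⟧ (ℤ.[1+m]⊖[1+n]≡m⊖n m n) ⟩
      ⟦ m ⊖ n ⟧                              ≡⟨ ⟦⊖⟧ m n ⟩
      m ×′ 1# + - (n ×′ 1#)                  ≡⟨ sym (cancel _ _) ⟩
      (1# + m ×′ 1#) + - (1# + n ×′ 1#)      ≡⟨ cong₂ (λ a b → a + - b) (sym (1+× m 1#)) (sym (1+× n 1#)) ⟩
      suc m ×′ 1# + - (suc n ×′ 1#)          ∎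
      where open ≡-Reasoning

    +-homo : ∀ i j → ⟦ i ℤ.+ j ⟧ ≡ ⟦ i ⟧ + ⟦ j ⟧
    +-homo (ℤ.+ m)    (ℤ.+ n)    = ×-homo-+ 1# m n
    +-homo (ℤ.+ m)    -[1+ n ] = ⟦⊖⟧ m (suc n)
    +-homo -[1+ m ] (ℤ.+ n)    = trans (⟦⊖⟧ n (suc m)) (ℛ.+-comm _ _)
    +-homo -[1+ m ] -[1+ n ] = begin
      - (suc (suc (m ℕ.+ n)) ×′ 1#)          ≡⟨ cong (λ z → - (suc z ×′ 1#)) (sym (ℕ.+-suc m n)) ⟩
      - ((suc m ℕ.+ suc n) ×′ 1#)            ≡⟨ cong -_ (×-homo-+ 1# (suc m) (suc n)) ⟩
      - (suc m ×′ 1# + suc n ×′ 1#)          ≡⟨ sym (⁻¹-∙-comm _ _) ⟩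
      - (suc m ×′ 1#) + - (suc n ×′ 1#)      ∎
      where open ≡-Reasoning

    -‿homo : ∀ i → ⟦ ℤ.- i ⟧ ≡ - ⟦ i ⟧
    -‿homo (ℤ.+ zero)  = sym -0#≈0#
    -‿homo (ℤ.+ suc n) = refl
    -‿homo -[1+ n ]  = sym (⁻¹-involutive _)

    *-homo⁺ : ∀ m j → ⟦ ℤ.+ m ℤ.* j ⟧ ≡ (m ×′ 1#) * ⟦ j ⟧
    *-homo⁺ m (ℤ.+ n)    = trans (cong ⟦_⟧ (sym (ℤ.pos-* m n))) (×1-homo-* m n)
    *-homo⁺ m -[1+ n ] = begin
      ⟦ ℤ.+ m ℤ.* (ℤ.- (ℤ.+ suc n)) ⟧      ≡⟨ cong ⟦_⟧ (sym (ℤ.neg-distribʳ-* (ℤ.+ m) (ℤ.+ suc n))) ⟩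
      ⟦ ℤ.- (ℤ.+ m ℤ.* ℤ.+ suc n) ⟧        ≡⟨ -‿homo (ℤ.+ m ℤ.* ℤ.+ suc n) ⟩
      - ⟦ ℤ.+ m ℤ.* ℤ.+ suc n ⟧            ≡⟨ cong -_ (*-homo⁺ m (ℤ.+ suc n)) ⟩
      - ((m ×′ 1#) * (suc n ×′ 1#))      ≡⟨ -‿distribʳ-* _ _ ⟩
      (m ×′ 1#) * - (suc n ×′ 1#)        ∎
      where open ≡-Reasoning

    *-homo : ∀ i j → ⟦ i ℤ.* j ⟧ ≡ ⟦ i ⟧ * ⟦ j ⟧
    *-homo (ℤ.+ m)    j = *-homo⁺ m j
    *-homo -[1+ m ] j = begin
      ⟦ (ℤ.- (ℤ.+ suc m)) ℤ.* j ⟧   ≡⟨ cong ⟦_⟧ (sym (ℤ.neg-distribˡ-* (ℤ.+ suc m) j)) ⟩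
      ⟦ ℤ.- (ℤ.+ suc m ℤ.* j) ⟧     ≡⟨ -‿homo (ℤ.+ suc m ℤ.* j) ⟩
      - ⟦ ℤ.+ suc m ℤ.* j ⟧         ≡⟨ cong -_ (*-homo⁺ (suc m) j) ⟩
      - ((suc m ×′ 1#) * ⟦ j ⟧)     ≡⟨ -‿distribˡ-* _ _ ⟩
      - (suc m ×′ 1#) * ⟦ j ⟧       ∎
      where open ≡-Reasoning

    morphism : ℤ.+-*-rawRing -Raw-AlmostCommutative⟶ ring
    morphism = record
      { ⟦_⟧ = ⟦_⟧ ; +-homo = +-homo ; *-homo = *-homo ; -‿homo = -‿homo ; 0-homo = refl ; 1-homo = refl }

    coeff≟ : ∀ i j → Maybe (⟦ i ⟧ ≡ ⟦ j ⟧)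
    coeff≟ i j = Maybe.map (cong ⟦_⟧) (dec⇒maybe (i ℤ.≟ j))

    fromℤ≡⟦⟧ : ∀ i → fromℤ i ≡ ⟦ i ⟧
    fromℤ≡⟦⟧ (ℤ.+ n)    = ×ᵤ≈× n 1#
    fromℤ≡⟦⟧ -[1+ n ] = cong -_ (×ᵤ≈× (suc n) 1#)

  fromℤ-* : ∀ i j → fromℤ (i ℤ.* j) ≡ fromℤ i * fromℤ j
  fromℤ-* i j = trans (fromℤ≡⟦⟧ (i ℤ.* j))
    (trans (*-homo i j) (sym (cong₂ _*_ (fromℤ≡⟦⟧ i) (fromℤ≡⟦⟧ j))))

  open RingSolver ℤ.+-*-rawRing ring morphism coeff≟ public
    using (Polynomial; solve; _:=_; _:+_; _:*_; _:-_; :-_; con)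

  :0 :1 :2 : ∀ {n} → Polynomial n
  :0 = con (ℤ.+ 0)
  :1 = con (ℤ.+ 1)
  :2 = con (ℤ.+ 2)

-- Ordered-field arithmetic, limits, and series with nonnegative terms.

module Reals (em : ExcludedMiddle (lsuc 0ℓ)) (R : CompleteOrderedField) where
  open RealAnalysis R
  open FieldSolver R public
  open IsTotalOrder isTotalOrder public
    using () renaming (refl to ≤-refl; trans to ≤-trans; antisym to ≤-antisym; total to ≤-total; reflexive to ≤-reflexive;
      ≤-respˡ-≈ to ≤-respˡ; ≤-respʳ-≈ to ≤-respʳ)
  open Max totalOrder using (x≤x⊔y; x≤y⊔x; ⊔-lub)
  module ℛ = CommutativeRing commutativeRing

  em₀ : ExcludedMiddle 0ℓ
  em₀ = lower-em em

  stable : {A : Set} → ¬ ¬ A → A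
  stable = decidable-stable em₀

  stable₁ : {A : Set₁} → ¬ ¬ A → A
  stable₁ = decidable-stable em

  0≤-⇒≤ : ∀ {x y} → 0# ≤ y - x → x ≤ y
  0≤-⇒≤ {x} {y} p = subst₂ _≤_ (ℛ.+-identityʳ x)
    (solve 2 (λ x y → x :+ (y :- x) := y) refl x y) (+-monoʳ-≤ x p)

  ≤⇒0≤- : ∀ {x y} → x ≤ y → 0# ≤ y - x
  ≤⇒0≤- {x} {y} p = subst₂ _≤_ (ℛ.-‿inverseˡ x) (ℛ.+-comm (- x) y) (+-monoʳ-≤ (- x) p)

  -- An inequality follows from others once the difference of its sides is the
  -- sum of their differences; the equation is left to the ring solver.

  linear₁ : ∀ {x y a b} → a ≤ b → y + a ≡ x + b → x ≤ y
  linear₁ {x} {y} {a} {b} p eq = 0≤-⇒≤ (subst (0# ≤_) eq′ (≤⇒0≤- p))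
    where
    open ≡-Reasoning
    eq′ : b - a ≡ y - x
    eq′ = begin
      b - a               ≡⟨ solve 3 (λ x a b → b :- a := (x :+ b) :- (x :+ a)) refl x a b ⟩
      (x + b) - (x + a)   ≡⟨ cong (_- (x + a)) (sym eq) ⟩
      (y + a) - (x + a)   ≡⟨ solve 3 (λ x a y → (y :+ a) :- (x :+ a) := y :- x) refl x a y ⟩
      y - x               ∎

  +-mono-≤ : ∀ {a b c d} → a ≤ b → c ≤ d → a + c ≤ b + d
  +-mono-≤ {a} {b} {c} {d} p q =
    ≤-trans (+-monoʳ-≤ a q) (linear₁ p (solve 3 (λ a b d → b :+ d :+ a := a :+ d :+ b) refl a b d))

  linear₂ : ∀ {x y a b c d} → a ≤ b → c ≤ d → y + (a + c) ≡ x + (b + d) → x ≤ y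
  linear₂ p q = linear₁ (+-mono-≤ p q)

  linear₃ : ∀ {x y a b c d e f} → a ≤ b → c ≤ d → e ≤ f →
            y + (a + (c + e)) ≡ x + (b + (d + f)) → x ≤ y
  linear₃ p q r = linear₁ (+-mono-≤ p (+-mono-≤ q r))

  *-monoʳ-≤ : ∀ {c a b} → 0# ≤ c → a ≤ b → c * a ≤ c * b
  *-monoʳ-≤ {c} {a} {b} 0≤c p = linear₁ (*-nonNegative 0≤c (≤⇒0≤- p))
    (solve 3 (λ a b c → c :* b :+ :0 := c :* a :+ c :* (b :- a)) refl a b c)

  *-monoˡ-≤ : ∀ {c a b} → 0# ≤ c → a ≤ b → a * c ≤ b * c
  *-monoˡ-≤ {c} {a} {b} 0≤c p = subst₂ _≤_ (ℛ.*-comm c a) (ℛ.*-comm c b) (*-monoʳ-≤ 0≤c p)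

  0≤1 : 0# ≤ 1#
  0≤1 with ≤-total 0# 1#
  ... | inj₁ p = p
  ... | inj₂ p = subst (0# ≤_) (solve 0 ((:0 :- :1) :* (:0 :- :1) := :1) refl)
                   (*-nonNegative (≤⇒0≤- p) (≤⇒0≤- p))

  1≰0 : ¬ 1# ≤ 0#
  1≰0 p = 0≢1 (≤-antisym 0≤1 p)

  ≰⇒≥ : ∀ {x y} → ¬ x ≤ y → y ≤ x
  ≰⇒≥ {x} {y} x≰y with ≤-total x y
  ... | inj₁ p = contradiction p x≰y
  ... | inj₂ p = p

  <⇒≱ : ∀ {x y} → x < y → ¬ y ≤ x
  <⇒≱ (p , x≢y) q = x≢y (≤-antisym p q)

  ≰⇒> : ∀ {x y} → ¬ x ≤ y → y < x
  ≰⇒> x≰y = ≰⇒≥ x≰y , λ { refl → x≰y ≤-refl }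

  +-pos : ∀ {x y} → 0# ≤ x → 0# < y → 0# < x + y
  +-pos {x} {y} 0≤x 0<y = ≰⇒> λ p → <⇒≱ 0<y
    (linear₂ p 0≤x (solve 2 (λ x y → :0 :+ (x :+ y :+ :0) := y :+ (:0 :+ x)) refl x y))

  0<1 : 0# < 1#
  0<1 = 0≤1 , 0≢1

  0<2 : 0# < 1# + 1#
  0<2 = +-pos 0≤1 0<1

  inverseʳ : ∀ {x} → 0# < x → x * x ⁻¹ ≡ 1#
  inverseʳ {x} (_ , 0≢x) = *-inverseʳ x (0≢x ∘ sym)

  ⁻¹-pos : ∀ {x} → 0# < x → 0# < x ⁻¹
  ⁻¹-pos {x} 0<x = ≰⇒> λ p → 1≰0 (subst₂ _≤_ (inverseʳ 0<x) (ℛ.zeroʳ x) (*-monoʳ-≤ (proj₁ 0<x) p))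

  *-pos : ∀ {x y} → 0# < x → 0# < y → 0# < x * y
  *-pos {x} {y} 0<x 0<y = *-nonNegative (proj₁ 0<x) (proj₁ 0<y) , λ 0≡xy → proj₂ 0<x (begin
    0#                 ≡⟨ sym (ℛ.zeroˡ (y ⁻¹)) ⟩
    0# * y ⁻¹          ≡⟨ cong (_* y ⁻¹) 0≡xy ⟩
    x * y * y ⁻¹       ≡⟨ ℛ.*-assoc x y _ ⟩
    x * (y * y ⁻¹)     ≡⟨ cong (x *_) (inverseʳ 0<y) ⟩
    x * 1#             ≡⟨ ℛ.*-identityʳ x ⟩
    x                  ∎)
    where open ≡-Reasoning

  0<½ : 0# < ½
  0<½ = ⁻¹-pos 0<2

  ½+½ : ∀ x → ½ * x + ½ * x ≡ x
  ½+½ x = begin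
    ½ * x + ½ * x       ≡⟨ solve 2 (λ h x → h :* x :+ h :* x := (:2 :* h) :* x) refl ½ x ⟩
    (1# + 1#) * ½ * x   ≡⟨ cong (_* x) (inverseʳ 0<2) ⟩
    1# * x              ≡⟨ ℛ.*-identityˡ x ⟩
    x                   ∎
    where open ≡-Reasoning

  ≤+ε⇒≤ : ∀ {x y} → (∀ ε → 0# < ε → x ≤ y + ε) → x ≤ y
  ≤+ε⇒≤ {x} {y} h = stable λ x≰y → case x≰y
    where
    case : ¬ ¬ x ≤ y
    case x≰y = <⇒≱ 0<ε (linear₁ (h ε 0<ε) (begin
        0# + x            ≡⟨ solve 2 (λ x y → :0 :+ x := (x :- y) :+ y) refl x y ⟩
        (x - y) + y       ≡⟨ cong (_+ y) (sym (½+½ (x - y))) ⟩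
        (ε + ε) + y       ≡⟨ solve 2 (λ e y → (e :+ e) :+ y := e :+ (y :+ e)) refl ε y ⟩
        ε + (y + ε)       ∎))
      where
      open ≡-Reasoning
      -- Half the gap: the hypothesis then says 2ε ≤ ε.
      ε = ½ * (x - y)
      d>0 : 0# < x - y
      d>0 = ≤⇒0≤- (≰⇒≥ x≰y) , λ eq → x≰y (0≤-⇒≤ (≤-reflexive (trans (solve 0 (:0 := :- :0) refl)
              (trans (cong -_ eq) (solve 2 (λ x y → :- (x :- y) := y :- x) refl x y)))))
      0<ε = *-pos 0<½ d>0

  nat : ℕ → ℝ
  nat n = n · 1#

  0≤nat : ∀ n → 0# ≤ nat n
  0≤nat zero    = ≤-refl
  0≤nat (suc n) = subst (_≤ nat (suc n)) (ℛ.+-identityˡ 0#) (+-mono-≤ 0≤1 (0≤nat n))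

  0<nat : ∀ n → 0# < nat (suc n)
  0<nat n = subst (0# <_) (ℛ.+-comm _ _) (+-pos (0≤nat n) 0<1)

  abstract
    -- If the naturals were bounded, their supremum `s` would have the smaller upper bound `s - 1#`,
    -- because `suc n` is a natural as well.
    archimedean : ∀ x → ∃[ n ] x ≤ nat n
    archimedean x = stable λ none →
      let below : ∀ n → nat n ≤ x
          below n = ≰⇒≥ λ p → none (n , p)
          s , upper , least = complete (λ y → ∃[ n ] y ≡ nat n) (0# , 0 , refl) (x , λ { (n , refl) → below n })
          s≤s-1 : s ≤ s - 1#
          s≤s-1 = least λ { (n , refl) → linear₁ (upper (suc n , refl))
            (solve 2 (λ s m → (s :- :1) :+ (:1 :+ m) := m :+ s) refl s (nat n)) }
      in 1≰0 (linear₁ s≤s-1 (solve 1 (λ s → :0 :+ s := :1 :+ (s :- :1)) refl s))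

  -- The powers 2⁻ⁿ. They are the common scale of tolerances: for oscillations, covers, rational
  -- approximations and near-optimal schemes.
  δ : ℕ → ℝ
  δ zero    = 1#
  δ (suc n) = ½ * δ n

  0<δ : ∀ n → 0# < δ n
  0<δ zero    = 0<1
  0<δ (suc n) = *-pos 0<½ (0<δ n)

  δ-halves : ∀ n → δ (suc n) + δ (suc n) ≡ δ n
  δ-halves n = ½+½ (δ n)

  δ-suc-≤ : ∀ n → δ (suc n) ≤ δ n
  δ-suc-≤ n = linear₁ (proj₁ (0<δ (suc n)))
    (trans (ℛ.+-identityʳ _) (sym (δ-halves n)))

  δ-anti : ∀ {m n} → m ℕ.≤ n → δ n ≤ δ m
  δ-anti {m} m≤n = go (ℕ.≤⇒≤′ m≤n)
    where
    go : ∀ {n} → m ℕ.≤′ n → δ n ≤ δ m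
    go (ℕ.≤′-reflexive refl) = ≤-refl
    go (ℕ.≤′-step {n} q) = ≤-trans (δ-suc-≤ n) (go q)

  -- Bernoulli's inequality n + 1 ≤ 2ⁿ. In the inductive step, (n + 1) 2⁻ⁿ exceeds (n + 2) 2⁻ⁿ⁻¹ by
  -- n 2⁻ⁿ⁻¹.
  nat*δ≤1 : ∀ n → nat (suc n) * δ n ≤ 1#
  nat*δ≤1 zero    = ≤-reflexive (solve 0 ((:1 :+ :0) :* :1 := :1) refl)
  nat*δ≤1 (suc n) = linear₂ (nat*δ≤1 n) (*-nonNegative (0≤nat n) (proj₁ (0<δ (suc n)))) (begin
    1# + (nat (suc n) * δ n + 0#)
      ≡⟨ cong (λ z → 1# + (nat (suc n) * z + 0#)) (sym (δ-halves n)) ⟩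
    1# + (nat (suc n) * (δ (suc n) + δ (suc n)) + 0#)
      ≡⟨ solve 2 (λ m d → :1 :+ ((:1 :+ m) :* (d :+ d) :+ :0) :=
                  (:1 :+ (:1 :+ m)) :* d :+ (:1 :+ m :* d)) refl (nat n) (δ (suc n)) ⟩
    nat (suc (suc n)) * δ (suc n) + (1# + nat n * δ (suc n)) ∎)
    where open ≡-Reasoning

  abstract
    δ-small : ∀ ε → 0# < ε → ∃[ N ] δ N ≤ ε
    δ-small ε 0<ε with n , p ← archimedean (ε ⁻¹) = n , linear₂
        (*-monoˡ-≤ (*-nonNegative (proj₁ 0<ε) (proj₁ (0<δ n))) p)
        (*-monoʳ-≤ (proj₁ 0<ε) (≤-trans (linear₁ (proj₁ (0<δ n))
           (solve 2 (λ m d → (:1 :+ m) :* d :+ :0 := m :* d :+ d) refl (nat n) (δ n))) (nat*δ≤1 n)))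
        (begin
          ε + (ε ⁻¹ * (ε * δ n) + ε * (nat n * δ n))
            ≡⟨ solve 4 (λ e i d m → e :+ (i :* (e :* d) :+ e :* (m :* d)) := (e :* i) :* d :+
                (m :* (e :* d) :+ e :* :1))
                 refl ε (ε ⁻¹) (δ n) (nat n) ⟩
          ε * ε ⁻¹ * δ n + (nat n * (ε * δ n) + ε * 1#)
            ≡⟨ cong (λ z → z * δ n + (nat n * (ε * δ n) + ε * 1#)) (inverseʳ 0<ε) ⟩
          1# * δ n + (nat n * (ε * δ n) + ε * 1#)
            ≡⟨ cong (_+ (nat n * (ε * δ n) + ε * 1#)) (ℛ.*-identityˡ (δ n)) ⟩
          δ n + (nat n * (ε * δ n) + ε * 1#) ∎)
      where open ≡-Reasoning

  ≤+cδ⇒≤ : ∀ {x y} c → 0# ≤ c → (∀ n → x ≤ y + c * δ n) → x ≤ y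
  ≤+cδ⇒≤ {x} {y} c 0≤c h = ≤+ε⇒≤ λ ε 0<ε →
    let 0<1+c = subst (0# <_) (ℛ.+-comm c 1#) (+-pos 0≤c 0<1)
        -- Division by 1 + c rather than by `c`, which may vanish; `c * η` is still at most `ε`.
        η     = ε * (1# + c) ⁻¹
        0<η   = *-pos 0<ε (⁻¹-pos 0<1+c)
        n , q = δ-small η 0<η
        [1+c]η≡ε : (1# + c) * η ≡ ε
        [1+c]η≡ε = trans (solve 3 (λ c e i → c :* (e :* i) := e :* (c :* i)) refl (1# + c) ε ((1# + c) ⁻¹))
                    (trans (cong (ε *_) (inverseʳ 0<1+c)) (ℛ.*-identityʳ ε))
    in linear₃ (h n) (*-monoʳ-≤ 0≤c q) (proj₁ 0<η)
         (trans (cong (λ z → (y + z) + (x + (c * δ n + 0#))) (sym [1+c]η≡ε))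
           (solve 5 (λ x y c e d → y :+ (:1 :+ c) :* e :+ (x :+ (c :* d :+ :0)) :=
              x :+ ((y :+ c :* d) :+ (c :* e :+ e))) refl x y c η (δ n)))

  -- The supremum of the lower bounds. The sets of interest, such as `Cover A`, live one universe
  -- above what `complete` accepts; `True (em ...)` replaces the large predicate by an equivalent
  -- small one.
  infimum : (S : Pred ℝ (lsuc 0ℓ)) → Satisfiable S → Satisfiable (LowerBound _≤_ S) → ∃ (IsInf _≤_ S)
  infimum S (a , a∈S) (b , b≤S)
    with s , upper , least ← complete (λ x → True (em {LowerBound _≤_ S x})) (b , fromWitness (λ {x} → b≤S {x}))
           (a , λ x≤S → toWitness x≤S a∈S)
    = s , (λ x∈S → least λ y≤S → toWitness y≤S x∈S) , λ {x} x≤S → upper (fromWitness (λ {y} → x≤S {y}))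

  ∣x∣≤⇒x≤ : ∀ {x ε} → ∣ x ∣ ≤ ε → x ≤ ε
  ∣x∣≤⇒x≤ {x} = ≤-trans (x≤x⊔y x (- x))

  ∣x∣≤⇒-x≤ : ∀ {x ε} → ∣ x ∣ ≤ ε → - x ≤ ε
  ∣x∣≤⇒-x≤ {x} = ≤-trans (x≤y⊔x x (- x))

  ∣∣-least : ∀ {x ε} → x ≤ ε → - x ≤ ε → ∣ x ∣ ≤ ε
  ∣∣-least = ⊔-lub

  ConvergesTo⇒≤ : ∀ {a l c} N → a ConvergesTo l → (∀ n → N ℕ.≤ n → a n ≤ c) → l ≤ c
  ConvergesTo⇒≤ {a} {l} {c} N a→l a≤c = ≤+ε⇒≤ λ ε 0<ε →
    let M , close = a→l ε 0<ε
        n = M ℕ.⊔ N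
    in linear₂ (∣x∣≤⇒-x≤ (close n (ℕ.m≤m⊔n M N))) (a≤c n (ℕ.m≤n⊔m M N))
         (solve 4 (λ a l c e → (c :+ e) :+ (:- (a :- l) :+ a) := l :+ (e :+ c)) refl (a n) l c ε)

  ConvergesTo⇒≥ : ∀ {a l c} N → a ConvergesTo l → (∀ n → N ℕ.≤ n → c ≤ a n) → c ≤ l
  ConvergesTo⇒≥ {a} {l} {c} N a→l c≤a = ≤+ε⇒≤ λ ε 0<ε →
    let M , close = a→l ε 0<ε
        n = M ℕ.⊔ N
    in linear₂ (∣x∣≤⇒x≤ (close n (ℕ.m≤m⊔n M N))) (c≤a n (ℕ.m≤n⊔m M N))
         (solve 4 (λ a l c e → (l :+ e) :+ ((a :- l) :+ c) := c :+ (e :+ a)) refl (a n) l c ε)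

  ConvergesTo-unique : ∀ {a l m} → a ConvergesTo l → a ConvergesTo m → l ≡ m
  ConvergesTo-unique {a} {l} {m} a→l a→m = ≤-antisym (below a→l a→m) (below a→m a→l)
    where
    below : ∀ {l m} → a ConvergesTo l → a ConvergesTo m → l ≤ m
    below {l} {m} a→l a→m = ≤+ε⇒≤ λ ε 0<ε →
      let M , close = a→m ε 0<ε
      in ConvergesTo⇒≤ M a→l λ n M≤n → linear₁ (∣x∣≤⇒x≤ (close n M≤n))
           (solve 3 (λ a m e → (m :+ e) :+ (a :- m) := a :+ e) refl (a n) m ε)

  ConvergesTo-+ : ∀ {a b l m} → a ConvergesTo l → b ConvergesTo m → (λ n → a n + b n) ConvergesTo (l + m)
  ConvergesTo-+ {a} {b} {l} {m} a→l b→m ε 0<ε =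
    let M , closeₐ = a→l (½ * ε) (*-pos 0<½ 0<ε)
        N , closeᵦ = b→m (½ * ε) (*-pos 0<½ 0<ε)
        bound : ∀ {x y} → x ≤ ½ * ε → y ≤ ½ * ε → x + y ≤ ε
        bound p q = ≤-respʳ (½+½ ε) (+-mono-≤ p q)
    in M ℕ.⊔ N , λ n M⊔N≤n →
       let p = closeₐ n (ℕ.m⊔n≤o⇒m≤o M N M⊔N≤n)
           q = closeᵦ n (ℕ.m⊔n≤o⇒n≤o M N M⊔N≤n)
       in ∣∣-least
            (subst (_≤ ε) (solve 4 (λ a b l m → (a :- l) :+ (b :- m) := (a :+ b) :- (l :+ m)) refl (a n) (b n) l m)
              (bound (∣x∣≤⇒x≤ p) (∣x∣≤⇒x≤ q)))
            (subst (_≤ ε) (solve 4 (λ a b l m → :- (a :- l) :+ :- (b :- m) := :- ((a :+ b) :- (l :+ m))) refl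
                (a n) (b n) l m)
              (bound (∣x∣≤⇒-x≤ p) (∣x∣≤⇒-x≤ q)))

  ConvergesTo-cong : ∀ {a b l} → (∀ n → a n ≡ b n) → a ConvergesTo l → b ConvergesTo l
  ConvergesTo-cong {l = l} a≗b a→l ε 0<ε with N , close ← a→l ε 0<ε =
    N , λ n N≤n → subst (λ z → ∣ z - l ∣ ≤ ε) (a≗b n) (close n N≤n)

  Cauchy : (ℕ → ℝ) → Set
  Cauchy a = ∀ ε → 0# < ε → ∃[ N ] ∀ m n → N ℕ.≤ m → N ℕ.≤ n → a m ≤ a n + ε

  -- The limit is found as the limit inferior, the supremum of all eventual lower bounds of the
  -- sequence.
  Cauchy⇒ConvergesTo : ∀ {a} → Cauchy a → ∃ (a ConvergesTo_)
  Cauchy⇒ConvergesTo {a} cauchy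
    with M , near ← cauchy 1# 0<1
    with l , upper , least ← complete (λ x → ∃[ N ] ∀ n → N ℕ.≤ n → x ≤ a n)
      (a M - 1# , M , λ n M≤n → linear₁ (near M n ℕ.≤-refl M≤n)
         (solve 2 (λ x y → y :+ x := (x :- :1) :+ (y :+ :1)) refl (a M) (a n)))
      (a M + 1# , λ { (N , x≤a) → ≤-trans (x≤a (M ℕ.⊔ N) (ℕ.m≤n⊔m M N)) (near _ M (ℕ.m≤m⊔n M N) ℕ.≤-refl) })
    = l , λ ε 0<ε → let K , close = cauchy ε 0<ε in K , λ n K≤n → ∣∣-least
        (linear₁ (upper (K , λ m K≤m → linear₁ (close n m K≤n K≤m)
            (solve 3 (λ x y e → y :+ x := (x :- e) :+ (y :+ e)) refl (a n) (a m) ε)))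
          (solve 3 (λ x l e → e :+ (x :- e) := (x :- l) :+ l) refl (a n) l ε))
        (linear₁ (least λ { (N , x≤a) → ≤-trans (x≤a (K ℕ.⊔ N) (ℕ.m≤n⊔m K N)) (close _ n (ℕ.m≤m⊔n K N) K≤n) })
          (solve 3 (λ x l e → e :+ l := :- (x :- l) :+ (x :+ e)) refl (a n) l ε))

  partialSum-last : ∀ a n → partialSum a (suc n) ≡ partialSum a n + a n
  partialSum-last a zero    = ℛ.+-comm (a 0) 0#
  partialSum-last a (suc n) = trans (cong (a 0 +_) (partialSum-last (a ∘ suc) n)) (sym (ℛ.+-assoc _ _ _))

  partialSum-mono : ∀ {a b} → (∀ n → a n ≤ b n) → ∀ n → partialSum a n ≤ partialSum b n
  partialSum-mono a≤b zero    = ≤-refl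
  partialSum-mono a≤b (suc n) = +-mono-≤ (a≤b 0) (partialSum-mono (a≤b ∘ suc) n)

  partialSum-cong : ∀ {a b} → (∀ n → a n ≡ b n) → ∀ n → partialSum a n ≡ partialSum b n
  partialSum-cong a≗b zero    = refl
  partialSum-cong a≗b (suc n) = cong₂ _+_ (a≗b 0) (partialSum-cong (a≗b ∘ suc) n)

  partialSum-zero : ∀ n → partialSum (λ _ → 0#) n ≡ 0#
  partialSum-zero zero    = refl
  partialSum-zero (suc n) = trans (ℛ.+-identityˡ _) (partialSum-zero n)

  partialSum-+ : ∀ a b n → partialSum (λ i → a i + b i) n ≡ partialSum a n + partialSum b n
  partialSum-+ a b zero    = sym (ℛ.+-identityˡ 0#)
  partialSum-+ a b (suc n) = trans (cong (a 0 + b 0 +_) (partialSum-+ (a ∘ suc) (b ∘ suc) n))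
    (solve 4 (λ p q r s → (p :+ q) :+ (r :+ s) := (p :+ r) :+ (q :+ s)) refl (a 0) (b 0) _ _)

  partialSum-incr : ∀ {a} → (∀ n → 0# ≤ a n) → ∀ {m n} → m ℕ.≤ n → partialSum a m ≤ partialSum a n
  partialSum-incr {a} 0≤a {n = n} z≤n = subst (_≤ partialSum a n) (partialSum-zero n) (partialSum-mono 0≤a n)
  partialSum-incr {a} 0≤a (s≤s p) = +-monoʳ-≤ (a 0) (partialSum-incr (0≤a ∘ suc) p)

  partialSum-δ : ∀ c → 0# ≤ c → ∀ n → partialSum (λ i → c * δ (suc i)) n ≤ c
  partialSum-δ c 0≤c n = linear₁ (*-nonNegative 0≤c (proj₁ (0<δ n)))
      (trans (ℛ.+-identityʳ c) (sym (telescope n)))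
    where
    telescope : ∀ n → partialSum (λ i → c * δ (suc i)) n + c * δ n ≡ c
    telescope zero    = solve 1 (λ c → :0 :+ c :* :1 := c) refl c
    telescope (suc n) = begin
      partialSum f (suc n) + c * δ (suc n)               ≡⟨ cong (_+ c * δ (suc n)) (partialSum-last f n) ⟩
      partialSum f n + c * δ (suc n) + c * δ (suc n)     ≡⟨ solve 3
          (λ s c d → s :+ c :* d :+ c :* d := s :+ c :* (d :+ d)) refl (partialSum f n) c (δ (suc n)) ⟩
      partialSum f n + c * (δ (suc n) + δ (suc n))       ≡⟨ cong (λ z → partialSum f n + c * z) (δ-halves n) ⟩
      partialSum f n + c * δ n                           ≡⟨ telescope n ⟩
      c                                                  ∎
      where
      open ≡-Reasoning
      f = λ i → c * δ (suc i)

  module _ {a : ℕ → ℝ} (0≤a : ∀ n → 0# ≤ a n) {s : ℝ} where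

    SumsTo⇒partialSum≤ : a SumsTo s → ∀ n → partialSum a n ≤ s
    SumsTo⇒partialSum≤ Σa n = ConvergesTo⇒≥ n Σa λ m n≤m → partialSum-incr 0≤a n≤m

    SumsTo⇒least : a SumsTo s → ∀ {b} → (∀ n → partialSum a n ≤ b) → s ≤ b
    SumsTo⇒least Σa bound = ConvergesTo⇒≤ 0 Σa λ n _ → bound n

    supremum⇒SumsTo : (∀ n → partialSum a n ≤ s) → (∀ b → (∀ n → partialSum a n ≤ b) → s ≤ b) → a SumsTo s
    supremum⇒SumsTo upper least ε 0<ε = N , λ n N≤n → ∣∣-least
        (linear₂ (upper n) (proj₁ 0<ε)
            (solve 3 (λ p s e → e :+ (p :+ :0) := (p :- s) :+ (s :+ e)) refl (partialSum a n) s ε))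
        (linear₂ (≰⇒≥ N-large) (partialSum-incr 0≤a N≤n)
          (solve 4 (λ p q s e → e :+ ((s :- e) :+ q) := :- (p :- s) :+ (q :+ p)) refl (partialSum a n)
              (partialSum a N) s ε))
      where
      large : ∃[ N ] ¬ partialSum a N ≤ s - ε
      large = stable λ none → <⇒≱ 0<ε (linear₁ (least (s - ε) (λ n → stable λ p → none (n , p)))
        (solve 2 (λ s e → :0 :+ s := e :+ (s :- e)) refl s ε))
      N       = proj₁ large
      N-large = proj₂ large

-- Replacing a sequence of events by disjoint ones with the same union.

module Disjointification (em₀ : ExcludedMiddle 0ℓ) {Ω : Set₁} (A : ℕ → Pred Ω 0ℓ) where

  prefix : ℕ → Pred Ω 0ℓ
  prefix zero    = ∅
  prefix (suc n) = prefix n ∪ A n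

  fresh : ℕ → Pred Ω 0ℓ
  fresh n = A n ∩ ∁ (prefix n)

  prefix⊆⋃fresh : ∀ n → prefix n ⊆ ⋃ ℕ fresh
  prefix⊆⋃fresh (suc n) (inj₁ p) = prefix⊆⋃fresh n p
  prefix⊆⋃fresh (suc n) {x} (inj₂ a) with em₀ {prefix n x}
  ... | yes p = prefix⊆⋃fresh n p
  ... | no ¬p = n , a , ¬p

  ⋃⊆⋃fresh : ⋃ ℕ A ⊆ ⋃ ℕ fresh
  ⋃⊆⋃fresh (n , a) = prefix⊆⋃fresh (suc n) (inj₂ a)

  prefix⊆⋃ : ∀ n → prefix n ⊆ ⋃ ℕ A
  prefix⊆⋃ (suc n) (inj₁ p) = prefix⊆⋃ n p
  prefix⊆⋃ (suc n) (inj₂ a) = n , a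

  prefix-least : ∀ n {B : Pred Ω 0ℓ} → (∀ m → m ℕ.< n → A m ⊆ B) → prefix n ⊆ B
  prefix-least (suc n) A⊆B (inj₁ p) = prefix-least n (λ m m<n → A⊆B m (ℕ.m≤n⇒m≤1+n m<n)) p
  prefix-least (suc n) A⊆B (inj₂ a) = A⊆B n ℕ.≤-refl a

  A⊆prefix : ∀ {m n} → m ℕ.< n → A m ⊆ prefix n
  A⊆prefix {m} {suc n} (s≤s m≤n) a with ℕ.m≤n⇒m<n∨m≡n m≤n
  ... | inj₁ m<n  = inj₁ (A⊆prefix m<n a)
  ... | inj₂ refl = inj₂ a

  fresh-disjoint : ∀ m n → m ≢ n → fresh m ⊥ fresh n
  fresh-disjoint m n m≢n ((am , ¬pm) , (an , ¬pn)) with ℕ.<-cmp m n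
  ... | tri< m<n _ _ = ¬pn (A⊆prefix m<n am)
  ... | tri≈ _ m≡n _ = m≢n m≡n
  ... | tri> _ _ n<m = ¬pm (A⊆prefix n<m an)

-- Elementary probability and outer measures.

module Measures (em : ExcludedMiddle (lsuc 0ℓ)) (R : CompleteOrderedField) (k : ℕ) where
  open CuttingSchemes em R k
  open Reals em R

  -- Padding with empty events turns a binary union into a countable one, the only kind for which
  -- measurability and additivity are postulated.
  pair : ∀ {F} → Event F → Event F → ℕ → Event F
  pair A B zero          = A
  pair A B (suc zero)    = B
  pair A B (suc (suc n)) = ∅

  module _ {F : EdgeSet} where
    ∅-measurable : Measurable {F} ∅
    ∅-measurable = extensional ((λ ¬U → ¬U _) , λ ()) (complement whole)

    pair-measurable : ∀ {A B} → Measurable {F} A → Measurable B → ∀ n → Measurable (pair A B n)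
    pair-measurable a b zero          = a
    pair-measurable a b (suc zero)    = b
    pair-measurable a b (suc (suc n)) = ∅-measurable

    ⋃pair≐∪ : ∀ {A B : Event F} → ⋃ ℕ (pair A B) ≐ A ∪ B
    ⋃pair≐∪ = (λ { (zero , a) → inj₁ a ; (suc zero , b) → inj₂ b })
            , (λ { (inj₁ a) → 0 , a ; (inj₂ b) → 1 , b })

    ∪-measurable : ∀ {A B} → Measurable {F} A → Measurable B → Measurable (A ∪ B)
    ∪-measurable a b = extensional ⋃pair≐∪ (union (pair-measurable a b))

    ∩-measurable : ∀ {A B} → Measurable {F} A → Measurable B → Measurable (A ∩ B)
    ∩-measurable a b = extensional
      ((λ n → stable (n ∘ inj₁) , stable (n ∘ inj₂)) , λ { (x , y) (inj₁ ¬x) → ¬x x ; (x , y) (inj₂ ¬y) → ¬y y })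
      (complement (∪-measurable (complement a) (complement b)))

    ⋂-measurable : ∀ {A : ℕ → Event F} → (∀ n → Measurable (A n)) → Measurable (⋂ ℕ A)
    ⋂-measurable a = extensional ((λ n i → stable λ ¬x → n (i , ¬x)) , λ x (i , ¬x) → ¬x (x i))
      (complement (union λ n → complement (a n)))

  module Probability {F : EdgeSet} (P : ProbabilityMeasure F) where
    open ProbabilityMeasure P

    -- An empty event is disjoint from itself, so the constant sequence `A` is disjoint with union
    -- `A`; its first two terms give 2p ≤ p.
    Pr-∅ : ∀ {A} (a : Measurable A) → A ⊆ ∅ → Pr A a ≡ 0#
    Pr-∅ {A} a A⊆∅ = ≤-antisym
      (linear₁ (≤-respʳ (Pr-cong _ a (proj₂ , λ x → 0 , x)) twice)
        (solve 1 (λ c → :0 :+ (c :+ (c :+ :0)) := c :+ c) refl (Pr A a)))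
      (nonNegative a)
      where
      twice : Pr A a + (Pr A a + 0#) ≤ Pr (⋃ ℕ λ _ → A) (union λ _ → a)
      twice = SumsTo⇒partialSum≤ (λ _ → nonNegative a)
        (countably-additive (λ _ → a) λ _ _ _ (x , _) → A⊆∅ x) 2

    Pr-∪ : ∀ {A B} (a : Measurable A) (b : Measurable B) → A ⊥ B →
           Pr (A ∪ B) (∪-measurable a b) ≡ Pr A a + Pr B b
    Pr-∪ {A} {B} a b A⊥B = trans (Pr-cong _ (union (pair-measurable a b)) (proj₂ ⋃pair≐∪ , proj₁ ⋃pair≐∪))
      (≤-antisym (SumsTo⇒least pos sums bound)
        (≤-respˡ (cong (Pr A a +_) (ℛ.+-identityʳ (Pr B b))) (SumsTo⇒partialSum≤ pos sums 2)))
      where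
      pos  = λ n → nonNegative (pair-measurable a b n)
      disjoint : ∀ m n → m ≢ n → pair A B m ⊥ pair A B n
      disjoint zero          zero          m≢n x       = m≢n refl
      disjoint zero          (suc zero)    m≢n x       = A⊥B x
      disjoint (suc zero)    zero          m≢n (y , x) = A⊥B (x , y)
      disjoint (suc zero)    (suc zero)    m≢n x       = m≢n refl
      disjoint zero          (suc (suc n)) m≢n (_ , ())
      disjoint (suc zero)    (suc (suc n)) m≢n (_ , ())
      disjoint (suc (suc m)) n             m≢n (() , _)
      sums = countably-additive (pair-measurable a b) disjoint
      tail≡0 : ∀ n → partialSum (λ i → Pr ∅ (pair-measurable a b (suc (suc i)))) n ≡ 0#
      tail≡0 n = trans (partialSum-cong (λ i → Pr-∅ ∅-measurable id) n) (partialSum-zero n)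
      bound : ∀ n → partialSum (λ i → Pr (pair A B i) (pair-measurable a b i)) n ≤ Pr A a + Pr B b
      bound zero          = ≤-respˡ (ℛ.+-identityˡ 0#) (+-mono-≤ (nonNegative a) (nonNegative b))
      bound (suc zero)    = +-monoʳ-≤ _ (nonNegative b)
      bound (suc (suc n)) = ≤-reflexive (cong (Pr A a +_)
        (trans (cong (Pr B b +_) (tail≡0 n)) (ℛ.+-identityʳ _)))

    Pr-split : ∀ {A B} (a : Measurable A) (b : Measurable B) →
               Pr (A ∩ B) (∩-measurable a b) + Pr (A ∩ ∁ B) (∩-measurable a (complement b)) ≡ Pr A a
    Pr-split {A} {B} a b = trans (sym (Pr-∪ _ _ λ ((_ , x) , (_ , ¬x)) → ¬x x)) (Pr-cong _ _
      ((λ { (inj₁ (x , _)) → x ; (inj₂ (x , _)) → x }) , λ {C} x → decide x (em₀ {B C})))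
      where
      decide : ∀ {C} → A C → Dec (B C) → (A ∩ B ∪ A ∩ ∁ B) C
      decide x (yes y) = inj₁ (x , y)
      decide x (no ¬y) = inj₂ (x , ¬y)

    Pr-mono : ∀ {A B} (a : Measurable A) (b : Measurable B) → A ⊆ B → Pr A a ≤ Pr B b
    Pr-mono {A} {B} a b A⊆B = linear₁ (nonNegative (∩-measurable b (complement a)))
      (trans (ℛ.+-identityʳ _) (trans (sym (Pr-split b a))
        (cong (_+ Pr (B ∩ ∁ A) _) (Pr-cong _ a (proj₂ , λ x → A⊆B x , x)))))

    Pr-∁ : ∀ {A} (a : Measurable A) → Pr A a + Pr (∁ A) (complement a) ≡ 1#
    Pr-∁ {A} a = trans (cong₂ _+_ (Pr-cong _ _ ((λ x → _ , x) , proj₂)) (Pr-cong _ _ ((λ x → _ , x) , proj₂)))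
      (trans (Pr-split whole a) total)

    Pr-≤1 : ∀ {A} (a : Measurable A) → Pr A a ≤ 1#
    Pr-≤1 a = ≤-respʳ total (Pr-mono a whole _)

    -- The union bound, phrased through partial sums so that the series of the `Pr (A n)` need not
    -- be shown to converge. The fresh parts are disjoint, have the same union, and are no more
    -- probable.
    Pr-⋃-≤ : ∀ {A : ℕ → Event F} (a : ∀ n → Measurable (A n)) {s} →
             (∀ n → partialSum (λ i → Pr (A i) (a i)) n ≤ s) → Pr (⋃ ℕ A) (union a) ≤ s
    Pr-⋃-≤ {A} a bound = ≤-trans (Pr-mono (union a) (union fresh-measurable) ⋃⊆⋃fresh)
      (SumsTo⇒least (λ n → nonNegative (fresh-measurable n)) (countably-additive fresh-measurable fresh-disjoint)
        λ n → ≤-trans (partialSum-mono (λ i → Pr-mono (fresh-measurable i) (a i) proj₁) n) (bound n))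
      where
      open Disjointification em₀ A
      prefix-measurable : ∀ n → Measurable (prefix n)
      prefix-measurable zero    = ∅-measurable
      prefix-measurable (suc n) = ∪-measurable (prefix-measurable n) (a n)
      fresh-measurable : ∀ n → Measurable (fresh n)
      fresh-measurable n = ∩-measurable (a n) (complement (prefix-measurable n))

    Pr-⋃-null : ∀ {A : ℕ → Event F} (a : ∀ n → Measurable (A n)) →
                (∀ n → Pr (A n) (a n) ≡ 0#) → Pr (⋃ ℕ A) (union a) ≡ 0#
    Pr-⋃-null a null = ≤-antisym
      (Pr-⋃-≤ a λ n → ≤-reflexive (trans (partialSum-cong null n) (partialSum-zero n))) (nonNegative _)

    -- The complement of `B` lies in the union of the complements of the `A n`, which is a countable
    -- union of null events.
    almost-sure : ∀ {A : ℕ → Event F} {B} (a : ∀ n → Measurable (A n)) → (∀ n → Pr (A n) (a n) ≡ 1#) →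
                  ⋂ ℕ A ⊆ B → (b : Measurable B) → Pr B b ≡ 1#
    almost-sure {A} {B} a one ⋂A⊆B b = ≤-antisym (Pr-≤1 b) (linear₂ ∁B≤0 (≤-reflexive (sym (Pr-∁ b)))
        (solve 3 (λ x y o → x :+ (y :+ o) := o :+ (:0 :+ (x :+ y))) refl (Pr B b) (Pr (∁ B) (complement b)) 1#))
      where
      null : ∀ n → Pr (∁ (A n)) (complement (a n)) ≡ 0#
      null n = ≤-antisym (linear₂ (≤-reflexive (sym (one n))) (≤-reflexive (Pr-∁ (a n)))
        (solve 3 (λ x y o → :0 :+ (o :+ (x :+ y)) := y :+ (x :+ o)) refl (Pr (A n) (a n))
            (Pr (∁ (A n)) (complement (a n))) 1#))
        (nonNegative _)
      ∁B≤0 : Pr (∁ B) (complement b) ≤ 0#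
      ∁B≤0 = ≤-trans (Pr-mono (complement b) (union (complement ∘ a))
          λ ¬b → stable λ none → ¬b (⋂A⊆B λ n → stable λ ¬a → none (n , ¬a)))
        (≤-reflexive (Pr-⋃-null (complement ∘ a) null))

    Pr-∪-≤ : ∀ {A B} (a : Measurable A) (b : Measurable B) →
             Pr (A ∪ B) (∪-measurable a b) ≤ Pr A a + Pr B b
    Pr-∪-≤ {A} {B} a b = ≤-trans (Pr-mono _ (∪-measurable a b∖a) λ {C} x → decide x (em₀ {A C}))
      (≤-respˡ (sym (Pr-∪ a b∖a λ (x , (_ , ¬x)) → ¬x x)) (+-monoʳ-≤ _ (Pr-mono b∖a b proj₁)))
      where
      b∖a = ∩-measurable b (complement a)
      decide : ∀ {C} → (A ∪ B) C → Dec (A C) → (A ∪ B ∩ ∁ A) C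
      decide x        (yes y) = inj₁ y
      decide (inj₁ x) (no ¬y) = inj₁ x
      decide (inj₂ x) (no ¬y) = inj₂ (x , ¬y)

  -- Carathéodory's construction.

  record OuterMeasure (F : EdgeSet) : Set₁ where
    field
      μ*          : Event F → ℝ
      nonNegative : ∀ A → 0# ≤ μ* A
      empty       : μ* ∅ ≤ 0#
      monotone    : ∀ {A B} → A ⊆ B → μ* A ≤ μ* B
      subadditive : ∀ {A : ℕ → Event F} {s} → (∀ n → partialSum (μ* ∘ A) n ≤ s) → μ* (⋃ ℕ A) ≤ s

    -- Only the half of Carathéodory's criterion that subadditivity does not already give.
    Splits : Event F → Set₁
    Splits A = ∀ T → μ* (T ∩ A) + μ* (T ∩ ∁ A) ≤ μ* T

    subadditive₂ : ∀ {A B C} → C ⊆ A ∪ B → μ* C ≤ μ* A + μ* B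
    subadditive₂ {A} {B} C⊆A∪B = ≤-trans (monotone (proj₂ (⋃pair≐∪ {F} {A} {B}) ∘ C⊆A∪B)) (subadditive bound)
      where
      bound : ∀ n → partialSum (μ* ∘ pair A B) n ≤ μ* A + μ* B
      bound zero          = ≤-respˡ (ℛ.+-identityˡ 0#) (+-mono-≤ (nonNegative A) (nonNegative B))
      bound (suc zero)    = +-monoʳ-≤ _ (nonNegative B)
      bound (suc (suc n)) = +-monoʳ-≤ (μ* A) (≤-respʳ (ℛ.+-identityʳ _) (+-monoʳ-≤ (μ* B)
        (≤-trans (partialSum-mono (λ _ → empty) n) (≤-reflexive (partialSum-zero n)))))

    splits-cong : ∀ {A B} → A ≐ B → Splits A → Splits B
    splits-cong (A⊆B , B⊆A) splitA T = ≤-trans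
      (+-mono-≤ (monotone λ (t , b) → t , B⊆A b) (monotone λ (t , ¬b) → t , ¬b ∘ A⊆B)) (splitA T)

    splits-∁ : ∀ {A} → Splits A → Splits (∁ A)
    splits-∁ splitA T = ≤-trans
      (≤-trans (+-monoʳ-≤ _ (monotone λ (t , ¬¬a) → t , stable ¬¬a)) (≤-reflexive (ℛ.+-comm _ _))) (splitA T)

    splits-U : Splits U
    splits-U T = ≤-trans (+-mono-≤ (monotone proj₁) (≤-trans (monotone λ (_ , ¬u) → ¬u _) empty))
      (≤-reflexive (ℛ.+-identityʳ _))

    -- Split `T` by `A` and then `T ∩ A` by `B`. Of the three pieces, the two outside `A ∩ B` are
    -- put together again by subadditivity.
    splits-∩ : ∀ {A B} → Splits A → Splits B → Splits (A ∩ B)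
    splits-∩ {A} {B} splitA splitB T = linear₃ (splitA T) (splitB (T ∩ A))
      (+-mono-≤ (monotone {T ∩ (A ∩ B)} {(T ∩ A) ∩ B} λ (t , a , b) → (t , a) , b)
                (subadditive₂ {(T ∩ A) ∩ ∁ B} {T ∩ ∁ A} {T ∩ ∁ (A ∩ B)}
                  λ {C} (t , ¬ab) → decide t ¬ab (em₀ {A C})))
      (solve 7 (λ t ta t¬a tab ta¬b x y →
          t :+ ((ta :+ t¬a) :+ ((tab :+ ta¬b) :+ (x :+ y))) := (x :+ y) :+ (t :+ (ta :+ (tab :+ (ta¬b :+ t¬a))))) refl
        (μ* T) (μ* (T ∩ A)) (μ* (T ∩ ∁ A)) (μ* ((T ∩ A) ∩ B)) (μ* ((T ∩ A) ∩ ∁ B))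
        (μ* (T ∩ (A ∩ B))) (μ* (T ∩ ∁ (A ∩ B))))
      where
      decide : ∀ {C} → T C → ¬ (A ∩ B) C → Dec (A C) → ((T ∩ A) ∩ ∁ B ∪ T ∩ ∁ A) C
      decide t ¬ab (yes a) = inj₁ ((t , a) , λ b → ¬ab (a , b))
      decide t ¬ab (no ¬a) = inj₂ (t , ¬a)

    splits-∪ : ∀ {A B} → Splits A → Splits B → Splits (A ∪ B)
    splits-∪ splitA splitB = splits-cong
      ((λ n → stable λ ¬ab → n ((¬ab ∘ inj₁) , (¬ab ∘ inj₂))) , λ { (inj₁ a) (¬a , _) → ¬a a ; (inj₂ b)
          (_ , ¬b) → ¬b b })
      (splits-∁ (splits-∩ (splits-∁ splitA) (splits-∁ splitB)))

    module _ {A : ℕ → Event F} (splitA : ∀ n → Splits (A n)) where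
      open Disjointification em₀ A

      splits-prefix : ∀ n → Splits (prefix n)
      splits-prefix zero    = splits-cong ((λ ¬u → ¬u _) , λ ()) (splits-∁ splits-U)
      splits-prefix (suc n) = splits-∪ (splits-prefix n) (splitA n)

      -- By induction: testing `prefix n` against the set `T ∩ prefix (suc n)` separates the newest
      -- fresh piece from the earlier ones.
      partialSum-fresh : ∀ T n → partialSum (λ i → μ* (T ∩ fresh i)) n ≤ μ* (T ∩ prefix n)
      partialSum-fresh T zero    = nonNegative _
      partialSum-fresh T (suc n) = ≤-respˡ (sym (partialSum-last (λ i → μ* (T ∩ fresh i)) n)) (≤-trans
        (+-mono-≤
          (≤-trans (partialSum-fresh T n) (monotone {B = (T ∩ prefix (suc n)) ∩ prefix n} λ (t , p) → (t , inj₁ p) , p))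
          (monotone {B = (T ∩ prefix (suc n)) ∩ ∁ (prefix n)} λ (t , a , ¬p) → (t , inj₂ a) , ¬p))
        (splits-prefix n (T ∩ prefix (suc n))))

      -- For each `n` the fresh pieces within `prefix n`, together with the part of `T` outside the
      -- whole union, weigh at most `μ* T`. Hence `μ* T - μ* (T ∩ ∁ (⋃ ℕ A))` bounds all partial
      -- sums, and countable subadditivity passes to the union.
      splits-⋃ : Splits (⋃ ℕ A)
      splits-⋃ T = linear₁
        (≤-trans (monotone {B = ⋃ ℕ λ i → T ∩ fresh i} λ (t , a) → let i , f = ⋃⊆⋃fresh a in i , t , f)
          (subadditive {s = μ* T - μ* (T ∩ ∁ (⋃ ℕ A))} λ n →
            linear₃ (partialSum-fresh T n) (splits-prefix n T)
              (monotone {T ∩ ∁ (⋃ ℕ A)} {T ∩ ∁ (prefix n)} λ (t , ¬a) → t , ¬a ∘ prefix⊆⋃ n)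
              (solve 5 (λ s tp t¬p t t¬a → (t :- t¬a) :+ (s :+ ((tp :+ t¬p) :+ t¬a)) := s :+ (tp :+ (t :+ t¬p))) refl
                (partialSum (λ i → μ* (T ∩ fresh i)) n) (μ* (T ∩ prefix n)) (μ* (T ∩ ∁ (prefix n))) (μ* T)
                    (μ* (T ∩ ∁ (⋃ ℕ A))))))
        (solve 3 (λ t x y → t :+ x := (x :+ y) :+ (t :- y)) refl (μ* T) (μ* (T ∩ ⋃ ℕ A)) (μ* (T ∩ ∁ (⋃ ℕ A))))

      disjoint-sum : (∀ m n → m ≢ n → A m ⊥ A n) → (μ* ∘ A) SumsTo μ* (⋃ ℕ A)
      disjoint-sum disjoint = supremum⇒SumsTo (nonNegative ∘ A)
        (λ n → ≤-trans (partialSum-mono (λ i → monotone λ a → (i , a) , a , λ p → not-before i p a) n)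
          (≤-trans (partialSum-fresh (⋃ ℕ A) n) (monotone proj₁)))
        (λ b bound → subadditive bound)
        where
        not-before : ∀ i → prefix i ⊆ ∁ (A i)
        not-before i = prefix-least i λ m m<i a a′ → disjoint m i (ℕ.<⇒≢ m<i) (a , a′)

    module _ (splits-Cuts : ∀ {e} → e ∈ member F → Splits (Cuts e)) where
      measurable⇒splits : ∀ {A} → Measurable A → Splits A
      measurable⇒splits (generator e∈F)   = splits-Cuts e∈F
      measurable⇒splits whole             = splits-U
      measurable⇒splits (complement a)    = splits-∁ (measurable⇒splits a)
      measurable⇒splits (union a)         = splits-⋃ λ n → measurable⇒splits (a n)
      measurable⇒splits (extensional e a) = splits-cong e (measurable⇒splits a)

      toProbabilityMeasure : μ* U ≡ 1# → ProbabilityMeasure F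
      toProbabilityMeasure total = record
        { Pr                 = λ A _ → μ* A
        ; Pr-cong            = λ _ _ (A⊆B , B⊆A) → ≤-antisym (monotone A⊆B) (monotone B⊆A)
        ; nonNegative        = λ {A} _ → nonNegative A
        ; total              = total
        ; countably-additive = λ a → disjoint-sum λ n → measurable⇒splits (a n)
        }

-- Events that depend on finitely many edges.

module FiniteEvents (em : ExcludedMiddle (lsuc 0ℓ)) (R : CompleteOrderedField) (k : ℕ) where
  open CuttingSchemes em R k
  open Reals em R
  open Measures em R k

  ≈-sym : ∀ {e f} → e ≈ f → f ≈ e
  ≈-sym (inj₁ (p , q)) = inj₁ (sym p , sym q)
  ≈-sym (inj₂ (p , q)) = inj₂ (sym q , sym p)

  ≈-trans : ∀ {e f g} → e ≈ f → f ≈ g → e ≈ g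
  ≈-trans (inj₁ (p , q)) (inj₁ (r , s)) = inj₁ (trans p r , trans q s)
  ≈-trans (inj₁ (p , q)) (inj₂ (r , s)) = inj₂ (trans p r , trans q s)
  ≈-trans (inj₂ (p , q)) (inj₁ (r , s)) = inj₂ (trans p s , trans q r)
  ≈-trans (inj₂ (p , q)) (inj₂ (r , s)) = inj₁ (trans p s , trans q r)

  -- Instantiated twice, with the measurable events and with those definable by a formula, so that
  -- one argument shows events depending on finitely many edges to be both.
  record IsBooleanAlgebra {F : EdgeSet} (𝒜 : Event F → Set₁) : Set₁ where
    field
      𝒜-cong : ∀ {A B} → A ≐ B → 𝒜 A → 𝒜 B
      𝒜-U    : 𝒜 U
      𝒜-∁    : ∀ {A} → 𝒜 A → 𝒜 (∁ A)
      𝒜-∩    : ∀ {A B} → 𝒜 A → 𝒜 B → 𝒜 (A ∩ B)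

    𝒜-∅ : 𝒜 ∅
    𝒜-∅ = 𝒜-cong ((λ ¬u → ¬u _) , λ ()) (𝒜-∁ 𝒜-U)

    𝒜-∪ : ∀ {A B} → 𝒜 A → 𝒜 B → 𝒜 (A ∪ B)
    𝒜-∪ a b = 𝒜-cong
      ((λ n → stable λ ¬ab → n ((¬ab ∘ inj₁) , (¬ab ∘ inj₂))) , λ { (inj₁ a) (¬a , _) → ¬a a ; (inj₂ b)
          (_ , ¬b) → ¬b b })
      (𝒜-∁ (𝒜-∩ (𝒜-∁ a) (𝒜-∁ b)))

  measurable-isBooleanAlgebra : ∀ {F} → IsBooleanAlgebra (Measurable {F})
  measurable-isBooleanAlgebra = record
    { 𝒜-cong = extensional ; 𝒜-U = whole ; 𝒜-∁ = complement ; 𝒜-∩ = ∩-measurable }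

  AgreeAt : ∀ {F} → SubsetOf F → SubsetOf F → Edge → Set
  AgreeAt C C′ e = (e ∈ elements C → e ∈ elements C′) × (e ∈ elements C′ → e ∈ elements C)

  DeterminedBy : ∀ {F} → List Edge → Event F → Event F → Set₁
  DeterminedBy es D A = ∀ C C′ → D C → D C′ → All (AgreeAt C C′) es → A C → A C′

  module _ {F : EdgeSet} {𝒜 : Event F → Set₁} (isBA : IsBooleanAlgebra 𝒜)
           (𝒜-Cuts : ∀ {e} → e ∈ member F → 𝒜 (Cuts e)) where
    open IsBooleanAlgebra isBA

    -- An edge outside `F` lies in no subset of `F`, so its event is empty. The list in a `Finite`
    -- witness may contain such edges.
    𝒜-Cuts′ : ∀ e → 𝒜 (Cuts e)
    𝒜-Cuts′ e with em₀ {e ∈ member F}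
    ... | yes e∈F = 𝒜-Cuts e∈F
    ... | no e∉F = 𝒜-cong ((λ ()) , λ {C} e∈C → e∉F (SubsetOf.subset C e∈C)) 𝒜-∅

    -- The induction decides one edge of the list at a time and records the decision in `D`. When no
    -- edge is left, `A` is constant on `D`, so the event is `D` or empty.
    determined-within : ∀ es {D A} → 𝒜 D → DeterminedBy es D A → 𝒜 (A ∩ D)
    determined-within [] {D} {A} d determined with em {∃ (A ∩ D)}
    ... | yes (C₀ , a₀ , d₀) = 𝒜-cong ((λ {C} d → determined C₀ C d₀ d [] a₀ , d) , proj₂) d
    ... | no none = 𝒜-cong ((λ ()) , λ {C} x → none (C , x)) 𝒜-∅
    determined-within (e ∷ es) {D} {A} d determined = 𝒜-cong
      ((λ { (inj₁ (a , d , _)) → a , d ; (inj₂ (a , d , _)) → a , d }) , λ {C} (a , d) → decide a d (em₀ {Cuts e C}))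
      (𝒜-∪ (determined-within es (𝒜-∩ d (𝒜-Cuts′ e)) λ C C′ (d , x) (d′ , x′) agree →
               determined C C′ d d′ (((λ _ → x′) , (λ _ → x)) ∷ agree))
           (determined-within es (𝒜-∩ d (𝒜-∁ (𝒜-Cuts′ e))) λ C C′ (d , x) (d′ , x′) agree →
               determined C C′ d d′ (((λ y → contradiction y x) , (λ y → contradiction y x′)) ∷ agree)))
      where
      decide : ∀ {C} → A C → D C → Dec (Cuts e C) → (A ∩ (D ∩ Cuts e) ∪ A ∩ (D ∩ ∁ (Cuts e))) C
      decide a d (yes x) = inj₁ (a , d , x)
      decide a d (no ¬x) = inj₂ (a , d , ¬x)

    determined : ∀ es {A} → (∀ C C′ → All (AgreeAt C C′) es → A C → A C′) → 𝒜 A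
    determined es det = 𝒜-cong (proj₁ , λ a → a , _) (determined-within es 𝒜-U λ C C′ _ _ → det C C′)

  Path-map : ∀ {G G′ : Pred Edge 0ℓ} → G ⊆ G′ → ∀ {x y} → Path G x y → Path G′ x y
  Path-map G⊆G′ = Star.map λ (e , e∈G , ends) → e , G⊆G′ e∈G , ends

  agree-on-finite : ∀ {E F} (finE : Finite E) (C C′ : SubsetOf F) → All (AgreeAt C C′) (proj₁ finE) →
                    ∀ {e} → e ∈ member E → e ∈ elements C′ → e ∈ elements C
  agree-on-finite (es , cover) C C′ agree {e} e∈E e∈C′ with f , f∈es , e≈f ← find (cover e∈E) =
    respects (SubsetOf.set C) (≈-sym {e} {f} e≈f)
      (proj₂ (All.lookup agree f∈es) (respects (SubsetOf.set C′) e≈f e∈C′))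

  kWayCut-measurable : ∀ E → Finite E → Measurable (IsKWayCut E)
  kWayCut-measurable E finE = determined measurable-isBooleanAlgebra generator (proj₁ finE)
    λ C C′ agree cut i j i≢j path → cut i j i≢j
      (Path-map (λ (e∈E , e∉C′) → e∈E , λ e∈C → e∉C′
          (agree-on-finite {E} finE C′ C (All.map (λ (p , q) → q , p) agree) e∈E e∈C)) path)

  -- The event depends only on the finitely many edges of `E`, so it is a Boolean combination of
  -- cutting events. Applied to definable events, this carries probability 1 over to the limit
  -- measure.
  restricted-kWayCut : ∀ {E F} {𝒜 : Event F → Set₁} → IsBooleanAlgebra 𝒜 →
    (∀ {e} → e ∈ member F → 𝒜 (Cuts e)) → Finite E → 𝒜 (restrictSet ⊢ IsKWayCut E)
  restricted-kWayCut {E} isBA 𝒜-Cuts finE = determined isBA 𝒜-Cuts (proj₁ finE)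
    λ C C′ agree cut i j i≢j path → cut i j i≢j
      (Path-map (λ (e∈E , e∉C′) → e∈E , λ (e∈C , _) →
         e∉C′ (agree-on-finite {E} finE C′ C (All.map (λ (p , q) → q , p) agree) e∈E e∈C , e∈E)) path)

-- Diagonal extraction of a subsequence along which countably many sequences converge.

module CohesiveSequences (em : ExcludedMiddle (lsuc 0ℓ)) (R : CompleteOrderedField) where
  open RealAnalysis R
  open Reals em R

  Infinite : Pred ℕ 0ℓ → Set
  Infinite S = ∀ N → ∃[ n ] N ℕ.≤ n × S n

  infinite-split : ∀ S φ → Infinite S → Infinite (S ∩ φ) ⊎ Infinite (S ∩ ∁ φ)
  infinite-split S φ inf with em₀ {Infinite (S ∩ φ)}
  ... | yes p = inj₁ p
  ... | no ¬p = inj₂ λ N → stable λ none → ¬p λ M →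
    let n , M⊔N≤n , s = inf (M ℕ.⊔ N)
    in n , ℕ.m⊔n≤o⇒m≤o M N M⊔N≤n , s , stable λ ¬φ → none (n , ℕ.m⊔n≤o⇒n≤o M N M⊔N≤n , s , ¬φ)

  Oscillation≤ : ℝ → (ℕ → ℝ) → Pred ℕ 0ℓ → Set
  Oscillation≤ ε a S = ∀ {m n} → S m → S n → a m ≤ a n + ε

  oscillation-⊆ : ∀ {ε a S S′} → S′ ⊆ S → Oscillation≤ ε a S → Oscillation≤ ε a S′
  oscillation-⊆ S′⊆S osc p q = osc (S′⊆S p) (S′⊆S q)

  record Refinement (S : Pred ℕ 0ℓ) (Q : Pred ℕ 0ℓ → Set) : Set₁ where
    constructor refinement
    field
      {set}    : Pred ℕ 0ℓ
      subset   : set ⊆ S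
      infinite : Infinite set
      property : Q set

  -- Halve the interval [0, 1] `m` times, each time keeping a half that is visited infinitely often;
  -- `u` is the lower end of what remains.
  bisect : ∀ {a : ℕ → ℝ} → (∀ n → 0# ≤ a n) → (∀ n → a n ≤ 1#) → ∀ m {S} → Infinite S →
           Refinement S λ S′ → ∃[ u ] ∀ {n} → S′ n → u ≤ a n × a n ≤ u + δ m
  bisect 0≤a a≤1 zero inf = refinement id inf (0# , λ {n} _ → 0≤a n , ≤-respʳ (sym (ℛ.+-identityˡ 1#)) (a≤1 n))
  bisect {a} 0≤a a≤1 (suc m) inf
    with refinement {S′} S′⊆S inf′ (u , within) ← bisect 0≤a a≤1 m inf
    with infinite-split S′ (λ n → a n ≤ u + δ (suc m)) inf′
  ... | inj₁ low  = refinement (S′⊆S ∘ proj₁) low (u , λ (s , q) → proj₁ (within s) , q)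
  ... | inj₂ high = refinement (S′⊆S ∘ proj₁) high (u + δ (suc m) , λ (s , ¬q) → ≰⇒≥ ¬q ,
    ≤-respʳ (trans (cong (u +_) (sym (δ-halves m))) (sym (ℛ.+-assoc u _ _))) (proj₂ (within s)))

  refine : ∀ {a : ℕ → ℝ} → (∀ n → 0# ≤ a n) → (∀ n → a n ≤ 1#) → ∀ m {S} → Infinite S → Refinement S
      (Oscillation≤ (δ m) a)
  refine {a} 0≤a a≤1 m inf with refinement S′⊆S inf′ (u , within) ← bisect 0≤a a≤1 m inf =
    refinement S′⊆S inf′ λ {i} {j} p q → linear₂ (proj₂ (within p)) (proj₁ (within q))
      (solve 4 (λ x y u d → (y :+ d) :+ (x :+ u) := x :+ ((u :+ d) :+ y)) refl (a i) (a j) u (δ m))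

  module _ {I : Set} {a : I → ℕ → ℝ} (0≤a : ∀ i n → 0# ≤ a i n) (a≤1 : ∀ i n → a i n ≤ 1#) (stage : ℕ → List I) where

    refineAll : ∀ m is {S} → Infinite S → Refinement S λ S′ → All (λ i → Oscillation≤ (δ m) (a i) S′) is
    refineAll m []       inf = refinement id inf []
    refineAll m (i ∷ is) inf
      with refinement S₁⊆S inf₁ all ← refineAll m is inf
      with refinement S₂⊆S₁ inf₂ osc ← refine (0≤a i) (a≤1 i) m inf₁
      = refinement (S₁⊆S ∘ S₂⊆S₁) inf₂ (osc ∷ All.map (oscillation-⊆ S₂⊆S₁) all)

    abstract
      -- Stage `m` treats the finitely many indices in `stage m` with tolerance `δ m`. An index
      -- listed at all late stages is thus treated again and again with tolerances tending to zero.
      chain : ℕ → Σ[ S ∈ Pred ℕ 0ℓ ] Infinite S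
      next  : ∀ m → Refinement (proj₁ (chain m)) λ S′ → All (λ i → Oscillation≤ (δ m) (a i) S′) (stage m)
      chain zero    = U , λ N → N , ℕ.≤-refl , _
      chain (suc m) = Refinement.set (next m) , Refinement.infinite (next m)
      next m = refineAll m (stage m) (proj₂ (chain m))

      chain-⊆ : ∀ {m n} → m ℕ.≤ n → proj₁ (chain n) ⊆ proj₁ (chain m)
      chain-⊆ m≤n = go (ℕ.≤⇒≤′ m≤n)
        where
        go : ∀ {m n} → m ℕ.≤′ n → proj₁ (chain n) ⊆ proj₁ (chain m)
        go (ℕ.≤′-reflexive refl) s = s
        go (ℕ.≤′-step {n} m≤′n)  s = go m≤′n (Refinement.subset (next n) s)

      -- It need not be strictly increasing; `j ≤ subsequence j` is what makes it tend to infinity.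
      subsequence : ℕ → ℕ
      subsequence j = proj₁ (proj₂ (chain j) j)

      subsequence-≥ : ∀ j → j ℕ.≤ subsequence j
      subsequence-≥ j = proj₁ (proj₂ (proj₂ (chain j) j))

      subsequence∈chain : ∀ j → proj₁ (chain j) (subsequence j)
      subsequence∈chain j = proj₂ (proj₂ (proj₂ (chain j) j))

      subsequence-converges : ∀ {i} N → (∀ n → N ℕ.≤ n → i ∈ˡ stage n) → ∃ ((a i ∘ subsequence) ConvergesTo_)
      subsequence-converges {i} N listed = Cauchy⇒ConvergesTo λ ε 0<ε →
        let M , δM≤ε = δ-small ε 0<ε
            K = M ℕ.⊔ N
            osc = All.lookup (Refinement.property (next K)) (listed K (ℕ.m≤n⊔m M N))
        -- The oscillation bound of stage `K` holds on the refined set `chain (suc K)`, hence for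
        -- the terms from `suc K` on.
        in suc K , λ m n K<m K<n → ≤-trans
             (osc (chain-⊆ K<m (subsequence∈chain m)) (chain-⊆ K<n (subsequence∈chain n)))
             (+-monoʳ-≤ _ (≤-trans (δ-anti (ℕ.m≤m⊔n M N)) δM≤ε))

-- Boolean combinations of cutting events, and compactness.

module Formulas (em : ExcludedMiddle (lsuc 0ℓ)) (R : CompleteOrderedField) (k : ℕ) where
  open CuttingSchemes em R k
  open Reals em R
  open Measures em R k
  open FiniteEvents em R k

  -- Syntax in place of events, because formulas can be enumerated: the diagonal argument needs a
  -- countable index set.
  data Formula : Set where
    var : ℕ → Formula
    not : Formula → Formula
    and : Formula → Formula → Formula

  or : Formula → Formula → Formula
  or f g = not (and (not f) (not g))

  false true : Formula
  false = and (var 0) (not (var 0))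
  true  = not false

  or< : ℕ → (ℕ → Formula) → Formula
  or< zero    g = false
  or< (suc n) g = or (or< n g) (g n)

  -- Every list contains the one before it, so a formula stays listed from some stage on, as
  -- `subsequence-converges` demands.
  formulas : ℕ → List Formula
  formulas zero    = []
  formulas (suc n) = var n ∷ formulas n ++ map not (formulas n) ++ cartesianProductWith and (formulas n) (formulas n)

  formulas-step : ∀ {f n} → f ∈ˡ formulas n → f ∈ˡ formulas (suc n)
  formulas-step f∈ = there (∈-++⁺ˡ f∈)

  formulas-mono : ∀ {f m n} → m ℕ.≤ n → f ∈ˡ formulas m → f ∈ˡ formulas n
  formulas-mono m≤n f∈ = go (ℕ.≤⇒≤′ m≤n) f∈
    where
    go : ∀ {f m n} → m ℕ.≤′ n → f ∈ˡ formulas m → f ∈ˡ formulas n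
    go (ℕ.≤′-reflexive refl) f∈ = f∈
    go (ℕ.≤′-step m≤′n)      f∈ = formulas-step (go m≤′n f∈)

  listed : ∀ f → ∃[ n ] f ∈ˡ formulas n
  listed (var n)   = suc n , here refl
  listed (not f)   with n , f∈ ← listed f = suc n , there (∈-++⁺ʳ (formulas n) (∈-++⁺ˡ (∈-map⁺ not f∈)))
  listed (and f g) with m , f∈ ← listed f | n , g∈ ← listed g =
    suc (m ℕ.⊔ n) , there (∈-++⁺ʳ (formulas (m ℕ.⊔ n)) (∈-++⁺ʳ (map not (formulas (m ℕ.⊔ n)))
      (∈-cartesianProductWith⁺ and (formulas-mono (ℕ.m≤m⊔n m n) f∈) (formulas-mono (ℕ.m≤n⊔m m n) g∈))))

  module Semantics {F : EdgeSet} (edge : ℕ → Edge) (edge∈F : ∀ n → edge n ∈ member F)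
                   (edge-onto : ∀ e → e ∈ member F → ∃[ n ] e ≈ edge n) where

    ⟦_⟧ : Formula → Event F
    ⟦ var n ⟧   = Cuts (edge n)
    ⟦ not f ⟧   = ∁ ⟦ f ⟧
    ⟦ and f g ⟧ = ⟦ f ⟧ ∩ ⟦ g ⟧

    ⟦⟧-measurable : ∀ f → Measurable ⟦ f ⟧
    ⟦⟧-measurable (var n)   = generator (edge∈F n)
    ⟦⟧-measurable (not f)   = complement (⟦⟧-measurable f)
    ⟦⟧-measurable (and f g) = ∩-measurable (⟦⟧-measurable f) (⟦⟧-measurable g)

    ⟦false⟧ : ⟦ false ⟧ ⊆ ∅
    ⟦false⟧ (x , ¬x) = ¬x x

    ⟦or⟧⁻ : ∀ f g → ⟦ or f g ⟧ ⊆ ⟦ f ⟧ ∪ ⟦ g ⟧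
    ⟦or⟧⁻ f g n = stable λ ¬fg → n (¬fg ∘ inj₁ , ¬fg ∘ inj₂)

    ⟦or⟧⁺ : ∀ f g → ⟦ f ⟧ ∪ ⟦ g ⟧ ⊆ ⟦ or f g ⟧
    ⟦or⟧⁺ f g (inj₁ x) (¬x , _) = ¬x x
    ⟦or⟧⁺ f g (inj₂ y) (_ , ¬y) = ¬y y

    ⟦or<⟧⁻ : ∀ n g {C} → ⟦ or< n g ⟧ C → ∃[ i ] i ℕ.< n × ⟦ g i ⟧ C
    ⟦or<⟧⁻ zero    g {C} x = ⊥-elim (⟦false⟧ {C} x)
    ⟦or<⟧⁻ (suc n) g x with ⟦or⟧⁻ (or< n g) (g n) x
    ... | inj₁ y = let i , i<n , z = ⟦or<⟧⁻ n g y in i , ℕ.m≤n⇒m≤1+n i<n , z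
    ... | inj₂ y = n , ℕ.≤-refl , y

    ⟦or<⟧⁺ : ∀ {n g i} → i ℕ.< n → ⟦ g i ⟧ ⊆ ⟦ or< n g ⟧
    ⟦or<⟧⁺ {suc n} {g} (s≤s i≤n) x with ℕ.m≤n⇒m<n∨m≡n i≤n
    ... | inj₁ i<n  = ⟦or⟧⁺ (or< n g) (g n) (inj₁ (⟦or<⟧⁺ {n} {g} i<n x))
    ... | inj₂ refl = ⟦or⟧⁺ (or< n g) (g n) (inj₂ x)

    Definable : Event F → Set₁
    Definable A = Σ[ f ∈ Formula ] A ≐ ⟦ f ⟧

    definable-isBooleanAlgebra : IsBooleanAlgebra Definable
    definable-isBooleanAlgebra = record
      { 𝒜-cong = λ { (A⊆B , B⊆A) (f , A⊆f , f⊆A) → f , A⊆f ∘ B⊆A , A⊆B ∘ f⊆A }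
      ; 𝒜-U    = true , (λ {C} _ → ⟦false⟧ {C}) , _
      ; 𝒜-∁    = λ { (f , A⊆f , f⊆A) → not f , (λ ¬a → ¬a ∘ f⊆A) , λ ¬f → ¬f ∘ A⊆f }
      ; 𝒜-∩    = λ { (f , A⊆f , f⊆A) (g , B⊆g , g⊆B) →
                     and f g , (λ (a , b) → A⊆f a , B⊆g b) , λ (x , y) → f⊆A x , g⊆B y }
      }

    Cuts≐var : ∀ {e} (e∈F : e ∈ member F) → Cuts e ≐ ⟦ var (proj₁ (edge-onto e e∈F)) ⟧
    Cuts≐var {e} e∈F with n , e≈ ← edge-onto e e∈F =
      (λ {C} → respects (SubsetOf.set C) e≈) , λ {C} → respects (SubsetOf.set C) (≈-sym {e} {edge n} e≈)

    Increasing : (ℕ → Formula) → Set₁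
    Increasing g = ∀ n → ⟦ g n ⟧ ⊆ ⟦ g (suc n) ⟧

    increasing-≤ : ∀ {g} → Increasing g → ∀ {m n} → m ℕ.≤ n → ⟦ g m ⟧ ⊆ ⟦ g n ⟧
    increasing-≤ {g} incr m≤n = go (ℕ.≤⇒≤′ m≤n)
      where
      go : ∀ {m n} → m ℕ.≤′ n → ⟦ g m ⟧ ⊆ ⟦ g n ⟧
      go (ℕ.≤′-reflexive refl) x = x
      go (ℕ.≤′-step {n} m≤′n)  x = incr n (go m≤′n x)

    -- Compactness of the space of subsets of F, by König's lemma.

    module Compactness (f : Formula) {g : ℕ → Formula} (incr : Increasing g) where

      -- Since `g` increases, this says that no finite part of the cover contains `D`; it is the
      -- analogue of an infinite subtree in König's lemma.
      Persistent : Event F → Set₁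
      Persistent D = ∀ n → Σ[ C ∈ SubsetOf F ] D C × ¬ ⟦ g n ⟧ C

      -- If `D ∩ ∁ A` is covered at level `n`, then a point of `D` that escapes level `m ⊔ n` must
      -- lie in `A`, and it escapes level `m` too.
      persistent-split : ∀ D A → Persistent D → ¬ Persistent (D ∩ A) → Persistent (D ∩ ∁ A)
      persistent-split D A persists ¬persists n = stable₁ λ none → ¬persists λ m →
        let C , d , ¬g = persists (m ℕ.⊔ n)
        in C , (d , stable λ ¬a → none (C , (d , ¬a) , ¬g ∘ increasing-≤ {g} incr (ℕ.m≤n⊔m m n)))
             , ¬g ∘ increasing-≤ {g} incr (ℕ.m≤m⊔n m n)

      module _ (persists : Persistent ⟦ f ⟧) where

        branch : ℕ → Σ[ D ∈ Event F ] Persistent D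
        branch zero    = ⟦ f ⟧ , persists
        branch (suc j) with em {Persistent (proj₁ (branch j) ∩ ⟦ var j ⟧)}
        ... | yes q = proj₁ (branch j) ∩ ⟦ var j ⟧ , q
        ... | no ¬q = proj₁ (branch j) ∩ ∁ ⟦ var j ⟧ , persistent-split _ _ (proj₂ (branch j)) ¬q

        D : ℕ → Event F
        D j = proj₁ (branch j)

        D-step : ∀ j → D (suc j) ⊆ D j
        D-step j with em {Persistent (D j ∩ ⟦ var j ⟧)}
        ... | yes _ = proj₁
        ... | no  _ = proj₁

        D-decides : ∀ j → ¬ D (suc j) ⊆ ⟦ var j ⟧ → D (suc j) ⊆ ∁ ⟦ var j ⟧
        D-decides j with em {Persistent (D j ∩ ⟦ var j ⟧)}
        ... | yes _ = λ ¬⊆ → contradiction (λ {_} → proj₂) ¬⊆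
        ... | no  _ = λ _ → proj₂

        D-anti : ∀ {m n} → m ℕ.≤ n → D n ⊆ D m
        D-anti m≤n = go (ℕ.≤⇒≤′ m≤n)
          where
          go : ∀ {m n} → m ℕ.≤′ n → D n ⊆ D m
          go (ℕ.≤′-reflexive refl) d = d
          go (ℕ.≤′-step {n} m≤′n)  d = go m≤′n (D-step n d)

        Chosen : ℕ → Set
        Chosen j = True (em {D (suc j) ⊆ ⟦ var j ⟧})

        limit : SubsetOf F
        limit = record
          { set    = record
            { member   = λ e → ∃[ j ] edge j ≈ e × Chosen j
            ; respects = λ { {e} {f} e≈f (j , j≈e , chosen) → j , ≈-trans {edge j} {e} {f} j≈e e≈f , chosen }
            }
          ; subset = λ { {e} (j , j≈e , _) → respects F {edge j} {e} j≈e (edge∈F j) }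
          }

        -- A formula mentions finitely many variables, so below some depth of the branch all sets
        -- give it the same truth value as `limit`.
        limit-reflects : ∀ f → ∃[ m ] (D m ⊆ λ C → (⟦ f ⟧ C → ⟦ f ⟧ limit) × (⟦ f ⟧ limit → ⟦ f ⟧ C))
        limit-reflects (var j) with em {D (suc j) ⊆ ⟦ var j ⟧}
        ... | yes D⊆ = suc j , λ d → (λ _ → j , inj₁ (refl , refl) , fromWitness (λ {C} → D⊆ {C})) , λ _ → D⊆ d
        ... | no ¬D⊆ = suc j , λ d → (λ x → contradiction x (D-decides j ¬D⊆ d)) , λ (i , i≈j , chosen) →
          -- The enumeration may list the same edge at two indices `i` and `j`. A set `C` far enough
          -- down the branch satisfies both decisions, and as it respects `≈` they cannot conflict.
          let m = suc i ℕ.⊔ suc j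
              C , d′ , _ = proj₂ (branch m) 0
              x : edge j ∈ elements C
              x = respects (SubsetOf.set C) {edge i} {edge j} i≈j
                  (toWitness chosen (D-anti (ℕ.m≤m⊔n (suc i) (suc j)) d′))
          in contradiction x (D-decides j ¬D⊆ (D-anti (ℕ.m≤n⊔m (suc i) (suc j)) d′))
        limit-reflects (not f) with m , agree ← limit-reflects f =
          m , λ d → (λ ¬x → ¬x ∘ proj₂ (agree d)) , λ ¬x → ¬x ∘ proj₁ (agree d)
        limit-reflects (and f g) with m , agree₁ ← limit-reflects f | n , agree₂ ← limit-reflects g =
          m ℕ.⊔ n , λ d →
            let a = agree₁ (D-anti (ℕ.m≤m⊔n m n) d)
                b = agree₂ (D-anti (ℕ.m≤n⊔m m n) d)
            in (λ (x , y) → proj₁ a x , proj₁ b y) , λ (x , y) → proj₂ a x , proj₂ b y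

        limit∈f : ⟦ f ⟧ limit
        limit∈f with m , agree ← limit-reflects f =
          let C , d , _ = proj₂ (branch m) 0 in proj₁ (agree d) (D-anti {0} {m} z≤n d)

        limit∉g : ∀ n → ¬ ⟦ g n ⟧ limit
        limit∉g n x with m , agree ← limit-reflects (g n) =
          let C , d , ¬gC = proj₂ (branch m) n in ¬gC (proj₂ (agree d) x)

      compact : ⟦ f ⟧ ⊆ ⋃ ℕ (⟦_⟧ ∘ g) → ∃[ n ] ⟦ f ⟧ ⊆ ⟦ g n ⟧
      compact f⊆⋃g = stable₁ λ none →
        let persists : Persistent ⟦ f ⟧
            persists n = stable₁ λ none′ → none (n , λ {C} x → stable λ ¬g → none′ (C , x , ¬g))
            n , x = f⊆⋃g (limit∈f persists)
        in limit∉g persists n x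

-- The limit of a sequence of probability measures.

module LimitMeasures (em : ExcludedMiddle (lsuc 0ℓ)) (R : CompleteOrderedField) (k : ℕ) where
  open CuttingSchemes em R k
  open Reals em R
  open Measures em R k
  open FiniteEvents em R k
  open CohesiveSequences em R
  open Formulas em R k

  module LimitMeasure {F : EdgeSet} (edge : ℕ → Edge) (edge∈F : ∀ n → edge n ∈ member F)
                      (edge-onto : ∀ e → e ∈ member F → ∃[ n ] e ≈ edge n)
                      (P : ℕ → ProbabilityMeasure F) where
    open Semantics {F} edge edge∈F edge-onto
    private
      module P n = ProbabilityMeasure (P n)
      module P′ n = Probability (P n)

    prob : Formula → ℕ → ℝ
    prob f n = P.Pr n ⟦ f ⟧ (⟦⟧-measurable f)

    0≤prob : ∀ f n → 0# ≤ prob f n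
    0≤prob f n = P.nonNegative n (⟦⟧-measurable f)

    prob≤1 : ∀ f n → prob f n ≤ 1#
    prob≤1 f n = P′.Pr-≤1 n (⟦⟧-measurable f)

    abstract
      subseq : ℕ → ℕ
      subseq = subsequence {a = prob} 0≤prob prob≤1 formulas

      subseq-≥ : ∀ n → n ℕ.≤ subseq n
      subseq-≥ = subsequence-≥ {a = prob} 0≤prob prob≤1 formulas

      converges : ∀ f → ∃ ((prob f ∘ subseq) ConvergesTo_)
      converges f = subsequence-converges {a = prob} 0≤prob prob≤1 formulas (proj₁ (listed f))
        λ n N≤n → formulas-mono N≤n (proj₂ (listed f))

    μ : Formula → ℝ
    μ f = proj₁ (converges f)

    μ-lim : ∀ f → (prob f ∘ subseq) ConvergesTo μ f
    μ-lim f = proj₂ (converges f)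

    0≤μ : ∀ f → 0# ≤ μ f
    0≤μ f = ConvergesTo⇒≥ 0 (μ-lim f) λ n _ → 0≤prob f (subseq n)

    μ≤1 : ∀ f → μ f ≤ 1#
    μ≤1 f = ConvergesTo⇒≤ 0 (μ-lim f) λ n _ → prob≤1 f (subseq n)

    μ-split : ∀ f g → μ (and f g) + μ (and f (not g)) ≡ μ f
    μ-split f g = ConvergesTo-unique
      (ConvergesTo-cong (λ n → P′.Pr-split (subseq n) (⟦⟧-measurable f) (⟦⟧-measurable g))
        (ConvergesTo-+ (μ-lim (and f g)) (μ-lim (and f (not g)))))
      (μ-lim f)

    μ-cong : ∀ f g → ⟦ f ⟧ ≐ ⟦ g ⟧ → μ f ≡ μ g
    μ-cong f g f≐g = ConvergesTo-unique
      (ConvergesTo-cong (λ n → P.Pr-cong (subseq n) _ _ f≐g) (μ-lim f)) (μ-lim g)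

    μ-mono : ∀ f g → ⟦ f ⟧ ⊆ ⟦ g ⟧ → μ f ≤ μ g
    μ-mono f g f⊆g = linear₁ (0≤μ (and g (not f))) (trans (ℛ.+-identityʳ (μ g)) (trans (sym (μ-split g f))
      (cong (_+ μ (and g (not f))) (μ-cong (and g f) f (proj₂ , λ x → f⊆g x , x)))))

    μ-false : μ false ≤ 0#
    μ-false = ConvergesTo⇒≤ 0 (μ-lim false) λ n _ →
      ≤-reflexive (P′.Pr-∅ (subseq n) (⟦⟧-measurable false) (λ {C} → ⟦false⟧ {C}))

    1≤μ : ∀ f → (∀ C → ⟦ f ⟧ C) → 1# ≤ μ f
    1≤μ f all = ConvergesTo⇒≥ 0 (μ-lim f) λ n _ →
      ≤-trans (≤-reflexive (sym (P.total (subseq n)))) (P′.Pr-mono (subseq n) whole (⟦⟧-measurable f) λ {C} _ → all C)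

    μ-or : ∀ f g → μ (or f g) ≤ μ f + μ g
    μ-or f g = ≤-respˡ (μ-split (or f g) f) (+-mono-≤ (μ-mono (and (or f g) f) f proj₂)
      (μ-mono (and (or f g) (not f)) g λ (x , ¬f) → case ¬f (⟦or⟧⁻ f g x)))
      where
      case : ∀ {C} → ¬ ⟦ f ⟧ C → (⟦ f ⟧ ∪ ⟦ g ⟧) C → ⟦ g ⟧ C
      case ¬f (inj₁ x) = contradiction x ¬f
      case ¬f (inj₂ y) = y

    μ-or< : ∀ n g → μ (or< n g) ≤ partialSum (μ ∘ g) n
    μ-or< zero    g = μ-false
    μ-or< (suc n) g = ≤-respʳ (sym (partialSum-last (μ ∘ g) n))
      (≤-trans (μ-or (or< n g) (g n)) (linear₁ (μ-or< n g)
        (solve 3 (λ x y z → (y :+ z) :+ x := (x :+ z) :+ y) refl (μ (or< n g)) (partialSum (μ ∘ g) n) (μ (g n)))))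

    -- Covers are increasing unions rather than series, so that countable
    -- subadditivity needs no rearrangement of double series.

    record Cover (A : Event F) (s : ℝ) : Set₁ where
      field
        formula    : ℕ → Formula
        increasing : Increasing formula
        covers     : A ⊆ ⋃ ℕ (⟦_⟧ ∘ formula)
        bounded    : ∀ n → μ (formula n) ≤ s
    open Cover

    abstract
      outer : ∀ A → ∃ (IsInf _≤_ (Cover A))
      outer A = infimum (Cover A)
        (1# , record { formula = λ _ → true ; increasing = λ _ x → x ; covers = λ {C} _ → 0 , ⟦false⟧ {C} ; bounded = λ _ → μ≤1 true })
        (0# , λ c → ≤-trans (0≤μ _) (bounded c 0))

    μ* : Event F → ℝ
    μ* A = proj₁ (outer A)

    μ*-least : ∀ {A s} → Cover A s → μ* A ≤ s
    μ*-least {A} = proj₁ (proj₂ (outer A))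

    μ*-greatest : ∀ {A b} → (∀ {s} → Cover A s → b ≤ s) → b ≤ μ* A
    μ*-greatest {A} = proj₂ (proj₂ (outer A))

    near-cover : ∀ A ε → 0# < ε → ∃[ s ] s ≤ μ* A + ε × Cover A s
    near-cover A ε 0<ε = stable₁ λ none → <⇒≱ 0<ε
      (linear₁ (μ*-greatest {A} λ {s} c → ≰⇒≥ λ s≤ → none (s , s≤ , c))
        (solve 2 (λ m e → :0 :+ (m :+ e) := e :+ m) refl (μ* A) ε))

    μ*-subadditive : ∀ {A : ℕ → Event F} {s} → (∀ n → partialSum (μ* ∘ A) n ≤ s) → μ* (⋃ ℕ A) ≤ s
    μ*-subadditive {A} {s} bound = ≤+cδ⇒≤ 1# 0≤1 λ m → ≤-respʳ (cong (s +_) (sym (ℛ.*-identityˡ (δ m))))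
      (μ*-least (combined m))
      where
      module _ (m : ℕ) where
        η : ℕ → ℝ
        -- The slacks allowed to the individual covers add up to at most `δ m`.
        η i = δ m * δ (suc i)
        c : ∀ i → ∃[ t ] t ≤ μ* (A i) + η i × Cover (A i) t
        c i = near-cover (A i) (η i) (*-pos (0<δ m) (0<δ (suc i)))
        g : ℕ → ℕ → Formula
        g i = formula (proj₂ (proj₂ (c i)))
        combined : Cover (⋃ ℕ A) (s + δ m)
        combined = record
          -- Diagonally: stage `n` unites the `n`-th stages of the first `n` covers, so it is a
          -- single formula and grows with `n`.
          { formula    = λ n → or< n λ i → g i n
          ; increasing = λ n x → let i , i<n , y = ⟦or<⟧⁻ n (λ i → g i n) x in
              ⟦or<⟧⁺ {suc n} {λ i → g i (suc n)} (ℕ.m≤n⇒m≤1+n i<n) (increasing (proj₂ (proj₂ (c i))) n y)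
          ; covers     = λ (i , a) → let n , x = covers (proj₂ (proj₂ (c i))) a ; N = suc i ℕ.⊔ n in
              N , ⟦or<⟧⁺ {N} {λ i → g i N} (ℕ.m≤m⊔n (suc i) n)
                    (increasing-≤ {g i} (increasing (proj₂ (proj₂ (c i)))) (ℕ.m≤n⊔m (suc i) n) x)
          ; bounded    = λ n → ≤-trans (μ-or< n λ i → g i n) (≤-trans
              (partialSum-mono (λ i → ≤-trans (bounded (proj₂ (proj₂ (c i))) n) (proj₁ (proj₂ (c i)))) n)
              (≤-respˡ (sym (partialSum-+ (μ* ∘ A) η n)) (+-mono-≤ (bound n) (partialSum-δ (δ m) (proj₁ (0<δ m)) n))))
          }

    outerMeasure : OuterMeasure F
    outerMeasure = record
      { μ*          = μ*
      ; nonNegative = λ A → μ*-greatest {A} λ c → ≤-trans (0≤μ _) (bounded c 0)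
      ; empty       = μ*-least record { formula = λ _ → false ; increasing = λ _ x → x ; covers = λ
          () ; bounded = λ _ → μ-false }
      ; monotone    = λ {A} A⊆B → μ*-greatest λ c → μ*-least {A} record
          { formula = formula c ; increasing = increasing c ; covers = covers c ∘ A⊆B ; bounded = bounded c }
      ; subadditive = μ*-subadditive
      }
    open OuterMeasure outerMeasure using (Splits; splits-cong; toProbabilityMeasure; monotone)

    -- A cover of `T` is intersected with `b` and with its negation. The inner pieces have supremum
    -- `t`; since an inner and an outer piece from different stages can be raised to a common stage,
    -- where they total at most `s`, every outer piece is at most `s - t`.
    splits-⟦⟧ : ∀ b → Splits ⟦ b ⟧
    splits-⟦⟧ b T = μ*-greatest {T} λ {s} c →
      let g = formula c
          pieces : ∀ m n → μ (and (g m) b) + μ (and (g n) (not b)) ≤ s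
          pieces m n = let N = m ℕ.⊔ n in ≤-trans
            (+-mono-≤ (μ-mono (and (g m) b) (and (g N) b) λ (x , y) → increasing-≤ {g} (increasing c)
                (ℕ.m≤m⊔n m n) x , y)
                      (μ-mono (and (g n) (not b)) (and (g N) (not b)) λ (x , y) → increasing-≤ {g}
                          (increasing c) (ℕ.m≤n⊔m m n) x , y))
            (≤-respˡ (sym (μ-split (g N) b)) (bounded c N))
          t , upper , least = complete (λ x → ∃[ m ] x ≡ μ (and (g m) b)) (_ , 0 , refl)
            (1# , λ { (m , refl) → μ≤1 (and (g m) b) })
          inside : Cover (T ∩ ⟦ b ⟧) t
          inside = record
            { formula    = λ n → and (g n) b
            ; increasing = λ n (x , y) → increasing c n x , y
            ; covers     = λ (x , y) → let n , z = covers c x in n , z , y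
            ; bounded    = λ n → upper (n , refl)
            }
          outside : Cover (T ∩ ∁ ⟦ b ⟧) (s - t)
          outside = record
            { formula    = λ n → and (g n) (not b)
            ; increasing = λ n (x , y) → increasing c n x , y
            ; covers     = λ (x , y) → let n , z = covers c x in n , z , y
            ; bounded    = λ n → linear₁ (least {s - μ (and (g n) (not b))} λ { (m , refl) → linear₁ (pieces m n)
                (solve 3 (λ x y s → (s :- y) :+ (x :+ y) := x :+ s) refl (μ (and (g m) b)) (μ (and (g n) (not b))) s) })
                (solve 3 (λ t y s → (s :- t) :+ t := y :+ (s :- y)) refl t (μ (and (g n) (not b))) s)
            }
      in ≤-respʳ (solve 2 (λ s t → t :+ (s :- t) := s) refl s t) (+-mono-≤ (μ*-least inside) (μ*-least outside))

    -- Compactness gives the lower bound: an increasing cover of `⟦ f ⟧` contains it at some finite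
    -- stage, so no countable cover is cheaper than `μ f`.
    μ*-⟦⟧ : ∀ f → μ* ⟦ f ⟧ ≡ μ f
    μ*-⟦⟧ f = ≤-antisym
      (μ*-least record { formula = λ _ → f ; increasing = λ _ x → x ; covers = λ x → 0 , x ; bounded = λ _ → ≤-refl })
      (μ*-greatest {⟦ f ⟧} λ c → let n , f⊆g = Compactness.compact f {formula c} (increasing c) (covers c) in
        ≤-trans (μ-mono f (formula c n) f⊆g) (bounded c n))

    splits-Cuts : ∀ {e} → e ∈ member F → Splits (Cuts e)
    splits-Cuts {e} e∈F = splits-cong {⟦ var n ⟧} {Cuts e}
      ((λ {C} → proj₂ (Cuts≐var {e} e∈F) {C}) , λ {C} → proj₁ (Cuts≐var {e} e∈F) {C}) (splits-⟦⟧ (var n))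
      where n = proj₁ (edge-onto e e∈F)

    limitMeasure : ProbabilityMeasure F
    limitMeasure = toProbabilityMeasure (λ {e} → splits-Cuts {e})
      (trans (≤-antisym (monotone λ {C} _ → ⟦false⟧ {C}) (monotone _))
        (trans (μ*-⟦⟧ true) (≤-antisym (μ≤1 true) (1≤μ true λ C → ⟦false⟧ {C}))))

    open ProbabilityMeasure limitMeasure using (Pr)

    Pr≡μ : ∀ {A} (a : Measurable A) (d : Definable A) → Pr A a ≡ μ (proj₁ d)
    Pr≡μ a (f , A≐f) = trans (ProbabilityMeasure.Pr-cong limitMeasure a (⟦⟧-measurable f) A≐f) (μ*-⟦⟧ f)

    -- The error term disappears in the limit, because `n ≤ subseq n` forces `δ (subseq n)` to zero.
    limit-≤ : ∀ {A} (a : Measurable A) → Definable A → ∀ {c d} → 0# ≤ d →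
              (∀ n → P.Pr n A a ≤ c + d * δ n) → Pr A a ≤ c
    limit-≤ a (f , A≐f) {c} {d} 0≤d bound = ≤-respˡ (sym (Pr≡μ a (f , A≐f))) (≤+cδ⇒≤ d 0≤d λ N →
      ConvergesTo⇒≤ N (μ-lim f) λ n N≤n → ≤-trans
        (≤-respˡ (P.Pr-cong (subseq n) a (⟦⟧-measurable f) A≐f) (bound (subseq n)))
        (+-monoʳ-≤ c (*-monoʳ-≤ 0≤d (δ-anti (ℕ.≤-trans N≤n (subseq-≥ n))))))

    limit-≡1 : ∀ {A} (a : Measurable A) → Definable A → (∀ n → P.Pr n A a ≡ 1#) → Pr A a ≡ 1#
    limit-≡1 a (f , A≐f) one = trans (Pr≡μ a (f , A≐f)) (≤-antisym (μ≤1 f)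
      (ConvergesTo⇒≥ 0 (μ-lim f) λ n _ → ≤-reflexive
        (trans (sym (one (subseq n))) (P.Pr-cong (subseq n) a (⟦⟧-measurable f) A≐f))))

-- Enumeration of pairs of naturals.

module Enumerations where

  step : ℕ × ℕ → ℕ × ℕ
  step (i , zero)  = zero , suc i
  step (i , suc j) = suc i , j

  unpair : ℕ → ℕ × ℕ
  unpair zero    = 0 , 0
  unpair (suc n) = step (unpair n)

  -- The walk along the antidiagonals reaches (i , j) by induction on i + j.

  unpair-onto : ∀ i j → ∃[ n ] unpair n ≡ (i , j)
  unpair-onto i j = go (i ℕ.+ j) i j refl
    where
    go : ∀ d i j → i ℕ.+ j ≡ d → ∃[ n ] unpair n ≡ (i , j)
    go d       (suc i) j       eq with n , p ← go d i (suc j) (trans (ℕ.+-suc i j) eq) = suc n , cong step p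
    go zero    zero    zero    eq = 0 , refl
    go (suc d) zero    (suc j) eq with n , p ← go d j zero
        (trans (ℕ.+-identityʳ j) (ℕ.suc-injective eq)) = suc n , cong step p

-- Rational points of the simplex: density and enumeration.

module RationalApproximation (em : ExcludedMiddle (lsuc 0ℓ)) (R : CompleteOrderedField) where
  open RealAnalysis R
  open Reals em R
  open Enumerations
  private
    module Sum = SumProperties ℛ.+-commutativeMonoid
    module Mult = MultProperties ℛ.+-monoid

  sum-mono : ∀ {n} {f g : Fin n → ℝ} → (∀ i → f i ≤ g i) → sum f ≤ sum g
  sum-mono {zero}  f≤g = ≤-refl
  sum-mono {suc n} f≤g = +-mono-≤ (f≤g Fin.zero) (sum-mono (f≤g ∘ Fin.suc))

  0≤sum : ∀ {n} {f : Fin n → ℝ} → (∀ i → 0# ≤ f i) → 0# ≤ sum f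
  0≤sum {zero}  0≤f = ≤-refl
  0≤sum {suc n} 0≤f = ≤-respˡ (ℛ.+-identityˡ 0#) (+-mono-≤ (0≤f Fin.zero) (0≤sum (0≤f ∘ Fin.suc)))

  term≤sum : ∀ {n} {f : Fin n → ℝ} → (∀ i → 0# ≤ f i) → ∀ i → f i ≤ sum f
  term≤sum {f = f} 0≤f Fin.zero    = ≤-respˡ (ℛ.+-identityʳ _) (+-monoʳ-≤ (f Fin.zero) (0≤sum (0≤f ∘ Fin.suc)))
  term≤sum {f = f} 0≤f (Fin.suc i) = ≤-respˡ (ℛ.+-identityˡ _) (+-mono-≤ (0≤f Fin.zero) (term≤sum (0≤f ∘ Fin.suc) i))

  x≤∣x∣ : ∀ x → x ≤ ∣ x ∣
  x≤∣x∣ x = ∣x∣≤⇒x≤ ≤-refl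

  -x≤∣x∣ : ∀ x → - x ≤ ∣ x ∣
  -x≤∣x∣ x = ∣x∣≤⇒-x≤ ≤-refl

  0≤∣x∣ : ∀ x → 0# ≤ ∣ x ∣
  0≤∣x∣ x with ≤-total 0# x
  ... | inj₁ 0≤x = ≤-trans 0≤x (x≤∣x∣ x)
  ... | inj₂ x≤0 = ≤-trans (linear₁ x≤0 (solve 1 (λ x → :- x :+ x := :0 :+ :0) refl x)) (-x≤∣x∣ x)

  -- At the endpoints of an edge this is `length` by computation, but it also covers coinciding
  -- points, between which there is no edge.
  dist : ∀ {n} → Vec ℝ n → Vec ℝ n → ℝ
  dist x y = ½ * sum λ i → ∣ lookup x i - lookup y i ∣

  0≤dist : ∀ {n} (x y : Vec ℝ n) → 0# ≤ dist x y
  0≤dist x y = *-nonNegative (proj₁ 0<½) (0≤sum λ i → 0≤∣x∣ (lookup x i - lookup y i))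

  dist-triangle : ∀ {n} (x y z : Vec ℝ n) → dist x z ≤ dist x y + dist y z
  dist-triangle x y z = ≤-respʳ
    (trans (cong (½ *_) (Sum.∑-distrib-+ (λ i → ∣ lookup x i - lookup y i ∣) (λ i → ∣ lookup y i - lookup z i ∣)))
      (ℛ.distribˡ ½ _ _))
    (*-monoʳ-≤ (proj₁ 0<½) (sum-mono λ i → triangle (lookup x i) (lookup y i) (lookup z i)))
    where
    triangle : ∀ a b c → ∣ a - c ∣ ≤ ∣ a - b ∣ + ∣ b - c ∣
    triangle a b c = ∣∣-least
      (linear₂ (x≤∣x∣ (a - b)) (x≤∣x∣ (b - c))
        (solve 5 (λ a b c p q → (p :+ q) :+ ((a :- b) :+ (b :- c)) := (a :- c) :+
            (p :+ q)) refl a b c ∣ a - b ∣ ∣ b - c ∣))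
      (linear₂ (-x≤∣x∣ (a - b)) (-x≤∣x∣ (b - c))
        (solve 5 (λ a b c p q → (p :+ q) :+ (:- (a :- b) :+ :- (b :- c)) := :- (a :- c) :+
            (p :+ q)) refl a b c ∣ a - b ∣ ∣ b - c ∣))

  dist-sym-≤ : ∀ {n} (x y : Vec ℝ n) → dist x y ≤ dist y x
  dist-sym-≤ x y = *-monoʳ-≤ (proj₁ 0<½) (sum-mono λ i → flip (lookup x i) (lookup y i))
    where
    flip : ∀ a b → ∣ a - b ∣ ≤ ∣ b - a ∣
    flip a b = ∣∣-least
      (≤-respˡ (solve 2 (λ a b → :- (b :- a) := a :- b) refl a b) (-x≤∣x∣ (b - a)))
      (≤-respˡ (solve 2 (λ a b → b :- a := :- (a :- b)) refl a b) (x≤∣x∣ (b - a)))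

  dist-refl : ∀ {n} (x : Vec ℝ n) → dist x x ≤ 0#
  dist-refl {n} x = ≤-respʳ (trans (cong (½ *_) (Sum.sum-replicate-zero n)) (ℛ.zeroʳ ½))
    (*-monoʳ-≤ (proj₁ 0<½) (sum-mono {f = λ i → ∣ lookup x i - lookup x i ∣} {λ _ → 0#} λ i → ∣∣-least
      (≤-reflexive (ℛ.-‿inverseʳ (lookup x i)))
      (≤-reflexive (solve 1 (λ a → :- (a :- a) := :0) refl (lookup x i)))))

  dist-pos : ∀ {n} {x y : Vec ℝ n} → x ≢ y → 0# < dist x y
  dist-pos {x = x} {y} x≢y = ≰⇒> λ d≤0 → x≢y (Pointwise-≡⇒≡ (ext λ i →
    let S   = sum λ i → ∣ lookup x i - lookup y i ∣
        S≤0 = ≤-respˡ (½+½ S) (≤-respʳ (ℛ.+-identityˡ 0#) (+-mono-≤ d≤0 d≤0))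
        ∣d∣≤0 = ≤-trans (term≤sum (λ i → 0≤∣x∣ (lookup x i - lookup y i)) i) S≤0
    in ≤-antisym
         (linear₁ (∣x∣≤⇒x≤ ∣d∣≤0) (solve 2 (λ a b → b :+ (a :- b) := a :+ :0) refl (lookup x i) (lookup y i)))
         (linear₁ (∣x∣≤⇒-x≤ ∣d∣≤0) (solve 2 (λ a b → a :+ :- (a :- b) := b :+ :0) refl (lookup x i) (lookup y i)))))

  nat-reflects-≤ : ∀ {m n} → nat m ≤ nat n → m ℕ.≤ n
  nat-reflects-≤ {m} {n} p with m ℕ.≤? n
  ... | yes m≤n = m≤n
  ... | no  m≰n with d , refl ← ℕ.m≤n⇒∃[o]m+o≡n (ℕ.≰⇒> m≰n) =
    contradiction (linear₂ (≤-respˡ (Mult.×-homo-+ 1# (suc n) d) p) (0≤nat d)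
      (solve 2 (λ a b → :0 :+ ((:1 :+ a :+ b) :+ :0) := :1 :+ (a :+ b)) refl (nat n) (nat d))) 1≰0

  abstract
    floor : ∀ x → 0# ≤ x → ∃[ n ] nat n ≤ x × x ≤ nat n + 1#
    floor x 0≤x with N , x≤N ← archimedean x = go N x≤N
      where
      go : ∀ N → x ≤ nat N → ∃[ n ] nat n ≤ x × x ≤ nat n + 1#
      go zero    x≤0 = 0 , 0≤x , ≤-trans x≤0 (≤-respʳ (sym (ℛ.+-identityˡ 1#)) 0≤1)
      go (suc N) x≤ with em₀ {x ≤ nat N}
      ... | yes p = go N p
      ... | no ¬p = N , ≰⇒≥ ¬p , ≤-respʳ (ℛ.+-comm 1# (nat N)) x≤

  fraction : ℕ → ℕ → ℝ
  fraction n m = nat n * nat (suc m) ⁻¹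

  -- A `ℚ` is stored in lowest terms, so a fraction n/m is compared with the quotient left after the
  -- common factor `g` is cancelled.
  reduce : ∀ {a d g n m} → a * g ≡ n → d * g ≡ m → 0# < d → 0# < m → n * m ⁻¹ ≡ a * d ⁻¹
  reduce {a} {d} {g} refl refl 0<d 0<m = begin
    a * g * (d * g) ⁻¹                    ≡⟨ cong (λ z → a * z * m ⁻¹) (sym (ℛ.*-identityˡ g)) ⟩
    a * (1# * g) * (d * g) ⁻¹             ≡⟨ cong (λ z → a * (z * g) * m ⁻¹) (sym (inverseʳ 0<d)) ⟩
    a * (d * d ⁻¹ * g) * (d * g) ⁻¹       ≡⟨ solve 5
        (λ a d d′ g m′ → a :* (d :* d′ :* g) :* m′ := a :* d′ :* (d :* g :* m′)) refl a d (d ⁻¹) g (m ⁻¹) ⟩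
    a * d ⁻¹ * (d * g * (d * g) ⁻¹)       ≡⟨ cong (a * d ⁻¹ *_) (inverseʳ 0<m) ⟩
    a * d ⁻¹ * 1#                         ≡⟨ ℛ.*-identityʳ _ ⟩
    a * d ⁻¹                              ∎
    where
    open ≡-Reasoning
    m = d * g

  0<↧ : ∀ q → 0# < fromℤ (↧ q)
  0<↧ (mkℚ _ d _) = 0<nat d

  fraction-rational : ∀ n m → IsRational (fraction n m)
  fraction-rational n m = q , reduce {fromℤ (↥ q)} {fromℤ (↧ q)} {fromℤ g}
    (trans (sym (fromℤ-* (↥ q) g)) (cong fromℤ (ℚ.↥-/ (ℤ.+ n) (suc m))))
    (trans (sym (fromℤ-* (↧ q) g)) (cong fromℤ (ℚ.↧-/ (ℤ.+ n) (suc m))))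
    (0<↧ q) (0<nat m)
    where
    q = ℤ.+ n ℚ./ suc m
    g = ℤ.gcd (ℤ.+ n) (ℤ.+ suc m)

  0-rational : IsRational 0#
  0-rational = ℚ.0ℚ , sym (ℛ.zeroˡ _)

  1-rational : IsRational 1#
  1-rational = ℚ.1ℚ , sym (inverseʳ (0<nat 0))

  fraction-≤ : ∀ {n m x} → nat n ≤ nat (suc m) * x → fraction n m ≤ x
  fraction-≤ {n} {m} {x} p = ≤-respʳ
    (begin
      M * x * M ⁻¹      ≡⟨ solve 3 (λ m x i → m :* x :* i := m :* i :* x) refl M x (M ⁻¹) ⟩
      M * M ⁻¹ * x      ≡⟨ cong (_* x) (inverseʳ (0<nat m)) ⟩
      1# * x            ≡⟨ ℛ.*-identityˡ x ⟩
      x                 ∎)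
    (*-monoˡ-≤ (proj₁ (⁻¹-pos (0<nat m))) p)
    where
    open ≡-Reasoning
    M = nat (suc m)

  fraction-≥ : ∀ {y m x} → nat (suc m) * x ≤ y → x ≤ y * nat (suc m) ⁻¹
  fraction-≥ {y} {m} {x} p = ≤-respˡ
    (begin
      M * x * M ⁻¹      ≡⟨ solve 3 (λ m x i → m :* x :* i := m :* i :* x) refl M x (M ⁻¹) ⟩
      M * M ⁻¹ * x      ≡⟨ cong (_* x) (inverseʳ (0<nat m)) ⟩
      1# * x            ≡⟨ ℛ.*-identityˡ x ⟩
      x                 ∎)
    (*-monoˡ-≤ (proj₁ (⁻¹-pos (0<nat m))) p)
    where
    open ≡-Reasoning
    M = nat (suc m)

  0≤fraction : ∀ n m → 0# ≤ fraction n m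
  0≤fraction n m = *-nonNegative (0≤nat n) (proj₁ (⁻¹-pos (0<nat m)))

  -- `total` retains the common denominator of the rounded coordinates; it is what makes their
  -- complement to 1 a rational again.
  record RoundedDown {n} (m : ℕ) (xs : Vec ℝ n) : Set where
    field
      qs          : Vec ℝ n
      nonNegative : Allᵛ.All (0# ≤_) qs
      rational    : Allᵛ.All IsRational qs
      total       : ∃[ N ] sum (lookup qs) ≡ fraction N m
      ℓ₁          : sum (λ i → ∣ lookup xs i - lookup qs i ∣) ≤ sum (lookup xs) - sum (lookup qs)
      error       : sum (lookup xs) - sum (lookup qs) ≤ fraction n m

  roundDown-∷ : ∀ {n m x} {xs : Vec ℝ n} → ∃[ a ] nat a ≤ nat (suc m) * x × nat (suc m) * x ≤ nat a + 1# →
    RoundedDown m xs → RoundedDown m (x ∷ xs)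
  roundDown-∷ {n} {m} {x} {xs} (a , a≤ , ≤a) r = record
    { qs          = q ∷ qs
    ; nonNegative = 0≤fraction a m ∷ nonNegative
    ; rational    = fraction-rational a m ∷ rational
    ; total       = a ℕ.+ proj₁ total , trans (cong (q +_) (proj₂ total))
        (trans (sym (ℛ.distribʳ (nat (suc m) ⁻¹) (nat a) (nat (proj₁ total))))
          (cong (_* nat (suc m) ⁻¹) (sym (Mult.×-homo-+ 1# a (proj₁ total)))))
    ; ℓ₁          = ≤-trans (+-mono-≤ (∣∣-least {x - q} {x - q} ≤-refl
          (linear₂ q≤x q≤x (solve 2 (λ x q → (x :- q) :+ (q :+ q) := :- (x :- q) :+ (x :+ x)) refl x q))) ℓ₁)
        (≤-reflexive (rearrange (sum (lookup xs)) (sum (lookup qs))))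
    ; error       = ≤-respˡ (rearrange (sum (lookup xs)) (sum (lookup qs)))
        (≤-trans (+-mono-≤ {x - q} {1# * nat (suc m) ⁻¹}
            (linear₁ x≤q′ (solve 4 (λ x a o i → o :* i :+ x := (x :- a :* i) :+ (a :+ o) :* i) refl x
                (nat a) 1# (nat (suc m) ⁻¹))) error)
          (≤-reflexive (sym (ℛ.distribʳ (nat (suc m) ⁻¹) 1# (nat n)))))
    }
    where
    open RoundedDown r
    q = fraction a m
    q≤x : q ≤ x
    q≤x = fraction-≤ {a} {m} a≤
    x≤q′ : x ≤ (nat a + 1#) * nat (suc m) ⁻¹
    x≤q′ = fraction-≥ {m = m} ≤a
    rearrange : ∀ s t → (x - q) + (s - t) ≡ (x + s) - (q + t)
    rearrange s t = solve 4 (λ x q s t → (x :- q) :+ (s :- t) := (x :+ s) :- (q :+ t)) refl x q s t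

  roundDown : ∀ {n} m (xs : Vec ℝ n) → Allᵛ.All (0# ≤_) xs → RoundedDown m xs
  roundDown m []       _           = record
    { qs = [] ; nonNegative = [] ; rational = [] ; total = 0 , sym (ℛ.zeroˡ _)
    ; ℓ₁ = ≤-reflexive (sym (ℛ.-‿inverseʳ 0#))
    ; error = ≤-reflexive (trans (ℛ.-‿inverseʳ 0#) (sym (ℛ.zeroˡ _))) }
  roundDown m (x ∷ xs) (0≤x ∷ 0≤xs) =
    roundDown-∷ (floor (nat (suc m) * x) (*-nonNegative (0≤nat (suc m)) 0≤x)) (roundDown m xs 0≤xs)

  fraction-complement : ∀ {N m} → N ℕ.≤ suc m → 1# - fraction N m ≡ fraction (suc m ℕ.∸ N) m
  fraction-complement {N} {m} N≤M = begin
      1# - nat N * i                ≡⟨ cong (_- nat N * i) (sym (inverseʳ (0<nat m))) ⟩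
      nat (suc m) * i - nat N * i   ≡⟨ cong (λ z → nat z * i - nat N * i) (sym (ℕ.m+[n∸m]≡n N≤M)) ⟩
      nat (N ℕ.+ r) * i - nat N * i ≡⟨ cong (λ z → z * i - nat N * i) (Mult.×-homo-+ 1# N r) ⟩
      (nat N + nat r) * i - nat N * i ≡⟨ solve 3 (λ n r i → (n :+ r) :* i :- n :* i := r :* i) refl (nat N) (nat r) i ⟩
      nat r * i                     ∎
    where
    open ≡-Reasoning
    i = nat (suc m) ⁻¹
    r = suc m ℕ.∸ N

  Approximation : ∀ {n} → ℝ → Vec ℝ n → Set
  Approximation {n} ε x =
    Σ[ y ∈ Vec ℝ n ] (Allᵛ.All (0# ≤_) y × sum (lookup y) ≡ 1#) × Allᵛ.All IsRational y × dist x y ≤ ε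

  -- Round all coordinates but the first down to multiples of 1/(m+1); the first
  -- coordinate absorbs the difference.

  correct : ∀ {n m ε x₀} {xs : Vec ℝ n} → 0# ≤ x₀ → x₀ + sum (lookup xs) ≡ 1# → RoundedDown m xs →
    nat n ≤ nat (suc m) * ε → Approximation ε (x₀ ∷ xs)
  correct {n} {m} {ε} {x₀} {xs} 0≤x₀ total₁ rounded n≤εM = q₀ ∷ qs ,
      (0≤q₀ ∷ nonNegative , sum≡1) , q₀-rational ∷ rational , close
    where
    open RoundedDown rounded
    N = proj₁ total
    X = sum (lookup xs)
    Q = sum (lookup qs)
    q₀ = 1# - Q
    X≤1 : X ≤ 1#
    X≤1 = ≤-respʳ total₁ (≤-respˡ (ℛ.+-identityˡ X) (+-mono-≤ 0≤x₀ (≤-refl {X})))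
    Q≤X : Q ≤ X
    Q≤X = 0≤-⇒≤ (≤-trans (0≤sum λ i → 0≤∣x∣ (lookup xs i - lookup qs i)) ℓ₁)
    0≤q₀ = ≤⇒0≤- (≤-trans Q≤X X≤1)
    N≤M : N ℕ.≤ suc m
    N≤M = nat-reflects-≤ (≤-respˡ (begin
        nat (suc m) * fraction N m ≡⟨ solve 3 (λ a b c → a :* (b :* c) := a :* c :* b) refl (nat (suc m))
            (nat N) (nat (suc m) ⁻¹) ⟩
        nat (suc m) * nat (suc m) ⁻¹ * nat N ≡⟨ cong (_* nat N) (inverseʳ (0<nat m)) ⟩
        1# * nat N ≡⟨ ℛ.*-identityˡ _ ⟩
        nat N ∎)
      (≤-respʳ (ℛ.*-identityʳ _) (*-monoʳ-≤ (0≤nat (suc m))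
          (≤-trans (≤-reflexive (sym (proj₂ total))) (≤-trans Q≤X X≤1)))))
      where open ≡-Reasoning
    q₀-rational : IsRational q₀
    q₀-rational = subst IsRational
      (sym (trans (cong (λ z → 1# - z) (proj₂ total)) (fraction-complement {N} {m} N≤M)))
      (fraction-rational (suc m ℕ.∸ N) m)
    sum≡1 : q₀ + Q ≡ 1#
    sum≡1 = solve 2 (λ o q → (o :- q) :+ q := o) refl 1# Q
    x₀≡ : x₀ ≡ 1# - X
    x₀≡ = trans (solve 2 (λ x s → x := (x :+ s) :- s) refl x₀ X) (cong (_- X) total₁)
    first : ∣ x₀ - q₀ ∣ ≤ X - Q
    first = ∣∣-least
      (≤-respˡ (cong (_- q₀) (sym x₀≡))
          (linear₂ Q≤X Q≤X (solve 3 (λ o x q → (x :- q) :+ (q :+ q) := ((o :- x) :- (o :- q)) :+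
              (x :+ x)) refl 1# X Q)))
      (≤-respˡ (cong (λ z → - (z - q₀)) (sym x₀≡))
          (≤-reflexive (solve 3 (λ o x q → :- ((o :- x) :- (o :- q)) := x :- q) refl 1# X Q)))
    close : dist (x₀ ∷ xs) (q₀ ∷ qs) ≤ ε
    close = ≤-trans (≤-respʳ (trans (ℛ.distribˡ ½ _ _) (½+½ (X - Q))) (*-monoʳ-≤ (proj₁ 0<½) (+-mono-≤ first ℓ₁)))
      (≤-trans error (fraction-≤ {n} {m} n≤εM))

  approximate : ∀ {n} (x : Vec ℝ n) → Allᵛ.All (0# ≤_) x → sum (lookup x) ≡ 1# → ∀ ε → 0# < ε → Approximation ε x
  approximate []       _            0≡1 ε 0<ε = contradiction 0≡1 0≢1
  approximate {suc n} (x₀ ∷ xs) (0≤x₀ ∷ 0≤xs) total₁ ε 0<ε =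
    correct {m = m} 0≤x₀ total₁ (roundDown m xs 0≤xs) n≤εM
    where
    -- With m ≥ n/ε the accumulated rounding error n/(m + 1) is at most ε.
    arch = archimedean (nat n * ε ⁻¹)
    m = proj₁ arch
    n≤εM : nat n ≤ nat (suc m) * ε
    n≤εM = linear₂ (*-monoˡ-≤ (proj₁ 0<ε) (proj₂ arch)) (proj₁ 0<ε) (begin
        (1# + nat m) * ε + (nat n * ε ⁻¹ * ε + 0#)
          ≡⟨ solve 4 (λ e a n i → (:1 :+ a) :* e :+ (n :* i :* e :+ :0) := n :* (e :* i) :+
              (a :* e :+ e)) refl ε (nat m) (nat n) (ε ⁻¹) ⟩
        nat n * (ε * ε ⁻¹) + (nat m * ε + ε) ≡⟨ cong (λ z → nat n * z + (nat m * ε + ε)) (inverseʳ 0<ε) ⟩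
        nat n * 1# + (nat m * ε + ε) ≡⟨ cong (_+ (nat m * ε + ε)) (ℛ.*-identityʳ _) ⟩
        nat n + (nat m * ε + ε) ∎)
      where open ≡-Reasoning

  signed : ℕ × ℕ → ℤ
  signed (zero  , n) = ℤ.+ n
  signed (suc _ , n) = -[1+ n ]

  -- The first component of the pair codes a signed numerator, the second the denominator less one.
  -- Fractions need not be reduced; surjectivity is the aim.
  rational : ℕ → ℝ
  rational n = fromℤ (signed (unpair (proj₁ (unpair n)))) * nat (suc (proj₂ (unpair n))) ⁻¹

  rational-onto : ∀ {x} → IsRational x → ∃[ n ] x ≡ rational n
  rational-onto (mkℚ z d _ , refl) =
    let s , s-eq = sign z
        c , c-eq = unpair-onto s d
    in c , sym (cong₂ (λ z d → fromℤ z * nat (suc d) ⁻¹)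
         (trans (cong (λ p → signed (unpair (proj₁ p))) c-eq) s-eq) (cong proj₂ c-eq))
    where
    sign : ∀ z → ∃[ n ] signed (unpair n) ≡ z
    sign (ℤ.+ n)  = let c , eq = unpair-onto 0 n in c , cong signed eq
    sign -[1+ n ] = let c , eq = unpair-onto 1 n in c , cong signed eq

  rationalPoint : ∀ n → ℕ → Vec ℝ n
  rationalPoint zero    c = []
  rationalPoint (suc n) c = rational (proj₁ (unpair c)) ∷ rationalPoint n (proj₂ (unpair c))

  rationalPoint-onto : ∀ {n} {x : Vec ℝ n} → Allᵛ.All IsRational x → ∃[ c ] x ≡ rationalPoint n c
  rationalPoint-onto []       = 0 , refl
  rationalPoint-onto {suc n} (r ∷ rs) =
    let a , a-eq = rational-onto r
        b , b-eq = rationalPoint-onto rs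
        c , c-eq = unpair-onto a b
    in c , cong₂ _∷_ (trans a-eq (cong (rational ∘ proj₁) (sym c-eq)))
                     (trans b-eq (cong (rationalPoint n ∘ proj₂) (sym c-eq)))

-- Image measures.

module Pushforward (em : ExcludedMiddle (lsuc 0ℓ)) (R : CompleteOrderedField) (k : ℕ) where
  open CuttingSchemes em R k

  module _ {F F′ : EdgeSet} (Φ : SubsetOf F → SubsetOf F′)
           (Φ-Cuts : ∀ e → e ∈ member F′ → Measurable {F} (Φ ⊢ Cuts e)) where

    preimage-measurable : {A : Event F′} → Measurable A → Measurable {F} (Φ ⊢ A)
    preimage-measurable (generator {e} e∈F′)          = Φ-Cuts e e∈F′
    preimage-measurable whole                         = whole
    preimage-measurable (complement a)                = complement (preimage-measurable a)
    preimage-measurable (union a)                     = union λ n → preimage-measurable (a n)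
    preimage-measurable (extensional (A⊆B , B⊆A) a) =
      extensional ((λ {C} → A⊆B {Φ C}) , λ {C} → B⊆A {Φ C}) (preimage-measurable a)

    pushforward : ProbabilityMeasure F → ProbabilityMeasure F′
    pushforward P = record
      { Pr                 = λ A a → Pr (Φ ⊢ A) (preimage-measurable a)
      ; Pr-cong            = λ a b (A⊆B , B⊆A) → Pr-cong _ _ ((λ {C} → A⊆B {Φ C}) , λ {C} → B⊆A {Φ C})
      ; nonNegative        = λ a → nonNegative (preimage-measurable a)
      ; total              = total
      ; countably-additive = λ a disjoint → countably-additive (λ n → preimage-measurable (a n))
          (λ m n m≢n {C} → disjoint m n m≢n {Φ C})
      }
      where open ProbabilityMeasure P

-- The cut of all edges induced by a cut of the rational edges, and its density.

module Extension (em : ExcludedMiddle (lsuc 0ℓ)) (R : CompleteOrderedField) (k : ℕ) where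
  open CuttingSchemes em R k
  open Reals em R
  open Measures em R k
  open FiniteEvents em R k
  open RationalApproximation em R
  open Pushforward em R k

  -- `fixed` ensures that terminals are their own approximations, so that approximating a path
  -- between terminals does not move its ends.
  record Approximates (x : Vec ℝ k) (n : ℕ) (y : Vec ℝ k) : Set where
    field
      inΔ      : y ∈ Δ
      isRat    : RationalPoint y
      near     : dist x y ≤ δ n
      fixed    : RationalPoint x → y ≡ x
  open Approximates

  abstract
    approximates-exists : ∀ {x} n → x ∈ Δ → ∃ (Approximates x n)
    approximates-exists {x} n x∈Δ with em₀ {RationalPoint x}
    ... | yes r = x , record
      { inΔ = x∈Δ ; isRat = r ; near = ≤-trans (dist-refl x) (proj₁ (0<δ n)) ; fixed = λ _ → refl }
    ... | no ¬r with y , y∈Δ , r , d ← approximate x (proj₁ x∈Δ) (proj₂ x∈Δ) (δ n) (0<δ n) = y , record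
      { inΔ = y∈Δ ; isRat = r ; near = d ; fixed = λ r → contradiction r ¬r }

    -- A function of the point alone, not of a proof that it lies in `Δ`: edges with a common
    -- endpoint share its approximations, and their approximating walks can be concatenated.
    approx : Vec ℝ k → ℕ → Vec ℝ k
    approx x n with em₀ {∃ (Approximates x n)}
    ... | yes (y , _) = y
    -- A default for points outside `Δ`; within `Δ` this branch contradicts `approximates-exists`.
    ... | no  _       = x

    approx-spec : ∀ {x} n → x ∈ Δ → Approximates x n (approx x n)
    approx-spec {x} n x∈Δ with em₀ {∃ (Approximates x n)}
    ... | yes (_ , spec) = spec
    ... | no none        = contradiction (approximates-exists n x∈Δ) none

  flip : Edge → Edge
  flip e = record { end₁ = end₂ e ; end₂ = end₁ e ; end₁∈Δ = end₂∈Δ e ; end₂∈Δ = end₁∈Δ e ; distinct = distinct e ∘ sym }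

  -- Vacuous for `x ≡ y`, as it should be when two approximations coincide and no edge has to be
  -- crossed.
  Uncut : ∀ {F} → Vec ℝ k → Vec ℝ k → Event F
  Uncut x y C = ∀ e → end₁ e ≡ x → end₂ e ≡ y → e ∉ elements C

  uncut-sym : ∀ {F} x y C → Uncut {F} x y C → Uncut y x C
  uncut-sym x y C uncut e p q e∈C =
    uncut (flip e) q p (respects (SubsetOf.set C) {e} {flip e} (inj₂ (refl , refl)) e∈C)

  Tail : Vec ℝ k → ℕ → Event rationalEdges
  Tail x N C = ∀ i → Uncut (approx x (N ℕ.+ i)) (approx x (suc (N ℕ.+ i))) C

  Joined : Vec ℝ k → Vec ℝ k → ℕ → Event rationalEdges
  Joined x y N = Tail x N ∩ (Tail y N ∩ Uncut (approx x N) (approx y N))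

  joined-sym : ∀ {x y N} → Joined x y N ⊆ Joined y x N
  joined-sym {x} {y} {N} {C} (s , t , u) = t , s , uncut-sym (approx x N) (approx y N) C u

  -- The cut of all edges obtained from a cut C of the rational edges: e survives
  -- when its endpoints are joined through their rational approximations.

  Φ : SubsetOf rationalEdges → SubsetOf allEdges
  Φ C = record
    { set    = record
      { member   = λ e → ¬ (∃[ N ] Joined (end₁ e) (end₂ e) N C)
      ; respects = λ { {e} {f} (inj₁ (p , q)) ¬j (N , j) → ¬j (N , subst₂ (λ x y → Joined x y N C) (sym p) (sym q) j)
                     ; {e} {f} (inj₂ (p , q)) ¬j (N , j) →
                         ¬j (N , subst₂ (λ x y → Joined x y N C) (sym p) (sym q)
                             (joined-sym {end₁ f} {end₂ f} {N} {C} j)) }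
      }
    ; subset = λ _ → _
    }

  module _ {x y : Vec ℝ k} (x∈Δ : x ∈ Δ) (y∈Δ : y ∈ Δ) where
    edgeBetween : x ≢ y → Edge
    edgeBetween x≢y = record { end₁ = x ; end₂ = y ; end₁∈Δ = x∈Δ ; end₂∈Δ = y∈Δ ; distinct = x≢y }

    ∁Uncut⊆∅ : x ≡ y → ∁ (Uncut {rationalEdges} x y) ⊆ ∅
    ∁Uncut⊆∅ x≡y ¬u = ¬u λ e p q → contradiction (trans p (trans x≡y (sym q))) (distinct e)

    ∁Uncut⊆Cuts : (x≢y : x ≢ y) → ∁ (Uncut {rationalEdges} x y) ⊆ Cuts (edgeBetween x≢y)
    ∁Uncut⊆Cuts x≢y {C} ¬u = stable λ e₀∉C → ¬u λ e p q e∈C →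
      e₀∉C (respects (SubsetOf.set C) {e} {edgeBetween x≢y} (inj₁ (p , q)) e∈C)

    uncut-measurable : RationalPoint x → RationalPoint y → Measurable (Uncut x y)
    uncut-measurable rx ry with em₀ {x ≡ y}
    ... | yes x≡y = extensional ((λ {C} _ → stable λ ¬u → ∁Uncut⊆∅ x≡y {C} ¬u) , _) whole
    ... | no x≢y = extensional
      ((λ {C} e₀∉C → stable λ ¬u → e₀∉C (∁Uncut⊆Cuts x≢y {C} ¬u)) , λ u → u (edgeBetween x≢y) refl refl)
      (complement (generator {e = edgeBetween x≢y} (rx , ry)))

  tail-measurable : ∀ {x} → x ∈ Δ → ∀ N i → Measurable (Uncut (approx x (N ℕ.+ i)) (approx x (suc (N ℕ.+ i))))
  tail-measurable x∈Δ N i =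
    let p = approx-spec (N ℕ.+ i) x∈Δ
        q = approx-spec (suc (N ℕ.+ i)) x∈Δ
    in uncut-measurable (inΔ p) (inΔ q) (isRat p) (isRat q)

  Tail-measurable : ∀ {x} → x ∈ Δ → ∀ N → Measurable (Tail x N)
  Tail-measurable x∈Δ N = ⋂-measurable (tail-measurable x∈Δ N)

  pair-uncut-measurable : ∀ {x y} → x ∈ Δ → y ∈ Δ → ∀ N → Measurable (Uncut (approx x N) (approx y N))
  pair-uncut-measurable x∈Δ y∈Δ N =
    let p = approx-spec N x∈Δ
        q = approx-spec N y∈Δ
    in uncut-measurable (inΔ p) (inΔ q) (isRat p) (isRat q)

  Joined-measurable : ∀ {x y} → x ∈ Δ → y ∈ Δ → ∀ N → Measurable (Joined x y N)
  Joined-measurable x∈Δ y∈Δ N = ∩-measurable (Tail-measurable x∈Δ N)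
    (∩-measurable (Tail-measurable y∈Δ N) (pair-uncut-measurable x∈Δ y∈Δ N))

  Φ-Cuts-measurable : ∀ e → e ∈ member allEdges → Measurable (Φ ⊢ Cuts e)
  Φ-Cuts-measurable e _ = complement (union (Joined-measurable (end₁∈Δ e) (end₂∈Δ e)))

  δ-+ : ∀ m n → δ (m ℕ.+ n) ≡ δ m * δ n
  δ-+ zero    n = sym (ℛ.*-identityˡ (δ n))
  δ-+ (suc m) n = trans (cong (½ *_) (δ-+ m n)) (sym (ℛ.*-assoc ½ (δ m) (δ n)))

  module DensityBound (P : ProbabilityMeasure rationalEdges) {T : ℝ} (0≤T : 0# ≤ T)
    (bound : ∀ e (r : e ∈ member rationalEdges) → ProbabilityMeasure.Pr P (Cuts e)
        (generator {e = e} r) ≤ T * length e) where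
    open ProbabilityMeasure P
    open Probability P

    ∁Uncut-bound : ∀ {x y} → x ∈ Δ → y ∈ Δ → RationalPoint x → RationalPoint y →
      (u : Measurable (Uncut x y)) → Pr (∁ (Uncut x y)) (complement u) ≤ T * dist x y
    ∁Uncut-bound {x} {y} x∈Δ y∈Δ rx ry u = decide em₀
      where
      decide : Dec (x ≡ y) → Pr (∁ (Uncut x y)) (complement u) ≤ T * dist x y
      decide (yes x≡y) = ≤-trans (≤-reflexive (Pr-∅ (complement u) λ {C} → ∁Uncut⊆∅ x∈Δ y∈Δ x≡y {C}))
          (*-nonNegative 0≤T (0≤dist x y))
      decide (no x≢y)  = ≤-trans (Pr-mono (complement u)
          (generator {e = edgeBetween x∈Δ y∈Δ x≢y} (rx , ry)) λ {C} → ∁Uncut⊆Cuts x∈Δ y∈Δ x≢y {C})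
        (bound (edgeBetween x∈Δ y∈Δ x≢y) (rx , ry))

    -- Consecutive approximations are at most `2 * δ (N + i)` apart, which equals
    -- `4 * (δ N * δ (suc i))`, a form that `partialSum-δ` can sum.
    four : ℝ
    four = (1# + 1#) + (1# + 1#)

    step-bound : ∀ {x} → x ∈ Δ → ∀ N i → dist (approx x (N ℕ.+ i)) (approx x (suc (N ℕ.+ i))) ≤ four * (δ N * δ (suc i))
    step-bound {x} x∈Δ N i = ≤-trans (≤-trans (dist-triangle xₙ x xₙ₊₁)
      (+-mono-≤ (≤-trans (dist-sym-≤ xₙ x) (near (approx-spec (N ℕ.+ i) x∈Δ)))
                (≤-trans (near (approx-spec (suc (N ℕ.+ i)) x∈Δ)) (δ-suc-≤ (N ℕ.+ i)))))
      (≤-reflexive (trans (cong₂ _+_ eq eq)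
        (solve 2 (λ a b → a :* (b :+ b) :+ a :* (b :+ b) := ((:1 :+ :1) :+ (:1 :+ :1)) :* (a :* b)) refl (δ N)
            (δ (suc i)))))
      where
      xₙ = approx x (N ℕ.+ i)
      xₙ₊₁ = approx x (suc (N ℕ.+ i))
      eq : δ (N ℕ.+ i) ≡ δ N * (δ (suc i) + δ (suc i))
      eq = trans (δ-+ N i) (cong (δ N *_) (sym (δ-halves i)))

    ∁Tail-bound : ∀ {x} (x∈Δ : x ∈ Δ) N → Pr (∁ (Tail x N)) (complement (Tail-measurable x∈Δ N)) ≤ T * four * δ N
    ∁Tail-bound {x} x∈Δ N = ≤-trans
      (Pr-mono (complement (Tail-measurable x∈Δ N)) (union λ i → complement (tail-measurable x∈Δ N i))
        λ ¬t → stable λ none → ¬t λ i → stable λ ¬u → none (i , ¬u))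
      (Pr-⋃-≤ (λ i → complement (tail-measurable x∈Δ N i)) λ n → ≤-trans
        (partialSum-mono term n) (partialSum-δ (T * four * δ N)
            (*-nonNegative (*-nonNegative 0≤T 0≤four) (proj₁ (0<δ N))) n))
      where
      0≤four = proj₁ (+-pos (proj₁ 0<2) 0<2)
      term : ∀ i → Pr (∁ (Uncut (approx x (N ℕ.+ i)) (approx x (suc (N ℕ.+ i))))) (complement (tail-measurable x∈Δ N i))
                   ≤ T * four * δ N * δ (suc i)
      term i =
        let p = approx-spec (N ℕ.+ i) x∈Δ
            q = approx-spec (suc (N ℕ.+ i)) x∈Δ
        in ≤-trans (∁Uncut-bound (inΔ p) (inΔ q) (isRat p) (isRat q) (tail-measurable x∈Δ N i))
             (≤-trans (*-monoʳ-≤ 0≤T (step-bound x∈Δ N i))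
               (≤-reflexive (solve 4 (λ t f a b → t :* (f :* (a :* b)) := t :* f :* a :* b) refl T four (δ N)
                   (δ (suc i)))))

    ∁pair-bound : ∀ {x y} (x∈Δ : x ∈ Δ) (y∈Δ : y ∈ Δ) N →
      Pr (∁ (Uncut (approx x N) (approx y N))) (complement (pair-uncut-measurable x∈Δ y∈Δ N)) ≤ T *
          (δ N + (dist x y + δ N))
    ∁pair-bound {x} {y} x∈Δ y∈Δ N =
      let p = approx-spec N x∈Δ
          q = approx-spec N y∈Δ
      in ≤-trans (∁Uncut-bound (inΔ p) (inΔ q) (isRat p) (isRat q) (pair-uncut-measurable x∈Δ y∈Δ N))
           (*-monoʳ-≤ 0≤T (≤-trans (dist-triangle (approx x N) x (approx y N))
             (+-mono-≤ (≤-trans (dist-sym-≤ (approx x N) x) (near p))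
               (≤-trans (dist-triangle x y (approx y N)) (+-monoʳ-≤ (dist x y) (near q))))))

    Φ-Cuts-bound : ∀ e (a : Measurable (Φ ⊢ Cuts e)) → Pr (Φ ⊢ Cuts e) a ≤ T * length e
    -- A cut edge fails to be joined at every `N`, so each `N` yields a bound. Either tail costs at
    -- most `4 * T * δ N`, and the edge between the approximations is longer than `e` by at most
    -- `2 * δ N`, one `δ N` for each end.
    Φ-Cuts-bound e a = ≤+cδ⇒≤ (T * (four + four + (1# + 1#)))
      (*-nonNegative 0≤T (proj₁ (+-pos (proj₁ (+-pos (proj₁ 0<four) 0<four)) 0<2))) λ N →
      let tx = complement (Tail-measurable x∈Δ N)
          ty = complement (Tail-measurable y∈Δ N)
          u  = complement (pair-uncut-measurable x∈Δ y∈Δ N)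
      in ≤-trans (Pr-mono a (∪-measurable tx (∪-measurable ty u)) λ ¬j → stable λ ¬xyu →
             ¬j (N , stable (¬xyu ∘ inj₁) , stable (¬xyu ∘ inj₂ ∘ inj₁) , λ e p q → stable (¬xyu ∘ inj₂ ∘ inj₂) e p q))
           (≤-trans (Pr-∪-≤ tx (∪-measurable ty u)) (≤-trans
             (+-mono-≤ (∁Tail-bound x∈Δ N) (≤-trans (Pr-∪-≤ ty u)
                 (+-mono-≤ (∁Tail-bound y∈Δ N) (∁pair-bound x∈Δ y∈Δ N))))
             (≤-reflexive (solve 4 (λ t f d l → t :* f :* d :+ (t :* f :* d :+ t :* (d :+ (l :+ d))) :=
                t :* l :+ t :* (f :+ f :+ (:1 :+ :1)) :* d) refl T four (δ N) (length e)))))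
      where
      x∈Δ = end₁∈Δ e
      y∈Δ = end₂∈Δ e
      0<four = +-pos (proj₁ 0<2) 0<2

-- Almost surely the induced cut separates the terminals.

module ExtendedScheme (em : ExcludedMiddle (lsuc 0ℓ)) (R : CompleteOrderedField) (k : ℕ) where
  open CuttingSchemes em R k
  open Reals em R
  open Measures em R k
  open FiniteEvents em R k
  open RationalApproximation em R
  open Pushforward em R k
  open Extension em R k
  open Approximates

  sum-indicator : ∀ {n} (i : Fin n) → sum (λ j → if does (i Fin.≟ j) then 1# else 0#) ≡ 1#
  sum-indicator {suc n} Fin.zero    = trans (cong (1# +_) (Sum.sum-replicate-zero n)) (ℛ.+-identityʳ 1#)
    where module Sum = SumProperties ℛ.+-commutativeMonoid
  sum-indicator {suc n} (Fin.suc i) = trans (ℛ.+-identityˡ _) (sum-indicator i)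

  indicator : ∀ {ℓ} (Q : ℝ → Set ℓ) b → Q 0# → Q 1# → Q (if b then 1# else 0#)
  indicator Q Bool.false q₀ q₁ = q₀
  indicator Q Bool.true  q₀ q₁ = q₁

  terminal∈Δ : ∀ i → terminal i ∈ Δ
  terminal∈Δ i = Allᵛ.tabulate⁺ (λ j → indicator (0# ≤_) (does (i Fin.≟ j)) ≤-refl 0≤1) ,
    trans (Sum.sum-cong-≗ (lookup∘tabulate λ j → if does (i Fin.≟ j) then 1# else 0#)) (sum-indicator i)
    where module Sum = SumProperties ℛ.+-commutativeMonoid

  terminal-rational : ∀ i → RationalPoint (terminal i)
  terminal-rational i = Allᵛ.tabulate⁺ λ j → indicator IsRational (does (i Fin.≟ j)) 0-rational 1-rational

  approx-terminal : ∀ i n → approx (terminal i) n ≡ terminal i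
  approx-terminal i n = fixed (approx-spec n (terminal∈Δ i)) (terminal-rational i)

  completeRational : List (Vec ℝ k) → EdgeSet
  completeRational pts = record
    { member   = λ e → e ∈ member rationalEdges × end₁ e ∈ˡ pts × end₂ e ∈ˡ pts
    ; respects = λ { {e} {f} e≈f (r , p , q) → respects rationalEdges {e} {f} e≈f r , swap {e} {f} e≈f p q }
    }
    where
    swap : ∀ {e f} → e ≈ f → end₁ e ∈ˡ pts → end₂ e ∈ˡ pts → end₁ f ∈ˡ pts × end₂ f ∈ˡ pts
    swap (inj₁ (a , b)) p q = subst (_∈ˡ pts) a p , subst (_∈ˡ pts) b q
    swap (inj₂ (a , b)) p q = subst (_∈ˡ pts) b q , subst (_∈ˡ pts) a p

  -- Edges with the same endpoints may differ in the proofs they carry. One representative for each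
  -- ordered pair of points, chosen by excluded middle, covers them up to `≈`.
  completeRational-finite : ∀ pts → Finite (completeRational pts)
  completeRational-finite pts = concatMap (λ x → concatMap (between x) pts) pts , λ {e} → listed {e}
    where
    between : Vec ℝ k → Vec ℝ k → List Edge
    between x y with em₀ {Σ[ e ∈ Edge ] end₁ e ≡ x × end₂ e ≡ y}
    ... | yes (e , _) = e ∷ []
    ... | no _        = []
    between-complete : ∀ e → Σ[ f ∈ Edge ] f ∈ˡ between (end₁ e) (end₂ e) × e ≈ f
    between-complete e with em₀ {Σ[ f ∈ Edge ] end₁ f ≡ end₁ e × end₂ f ≡ end₂ e}
    ... | yes (f , p , q) = f , here refl , inj₁ (sym p , sym q)
    ... | no none         = contradiction (e , refl , refl) none
    listed : ∀ {e} → e ∈ member (completeRational pts) → Any (e ≈_) (concatMap (λ x → concatMap (between x) pts) pts)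
    listed {e} (_ , p , q) with f , f∈ , e≈f ← between-complete e =
      lose (∈-concatMap⁺ (λ x → concatMap (between x) pts) (lose p (∈-concatMap⁺ (between (end₁ e)) (lose q f∈)))) e≈f

  module _ (es : List Edge) where
    ends : List (Vec ℝ k)
    ends = concatMap (λ e → end₁ e ∷ end₂ e ∷ []) es

    points : ℕ → List (Vec ℝ k)
    -- `suc M`, so that the index `M` itself is included.
    points M = cartesianProductWith approx ends (upTo (suc M))

    K : ℕ → EdgeSet
    K M = completeRational (points M)

    Survives : ℕ → SubsetOf rationalEdges → Pred Edge 0ℓ
    Survives M C e = e ∈ member (K M) × e ∉ elements (restrictSet {K M} C)

    ends∈ : ∀ {e} → Any (e ≈_) es → end₁ e ∈ˡ ends × end₂ e ∈ˡ ends
    ends∈ {e} any with f , f∈es , e≈f ← find any = place e≈f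
      where
      first : end₁ f ∈ˡ ends
      first = ∈-concatMap⁺ (λ e → end₁ e ∷ end₂ e ∷ []) (lose f∈es (here refl))
      second : end₂ f ∈ˡ ends
      second = ∈-concatMap⁺ (λ e → end₁ e ∷ end₂ e ∷ []) (lose f∈es (there (here refl)))
      place : e ≈ f → end₁ e ∈ˡ ends × end₂ e ∈ˡ ends
      place (inj₁ (p , q)) = subst (_∈ˡ ends) (sym p) first , subst (_∈ˡ ends) (sym q) second
      place (inj₂ (p , q)) = subst (_∈ˡ ends) (sym p) second , subst (_∈ˡ ends) (sym q) first

    points∈ : ∀ {z n M} → z ∈ˡ ends → n ℕ.≤ M → approx z n ∈ˡ points M
    points∈ z∈ n≤M = ∈-cartesianProductWith⁺ approx z∈ (∈-upTo⁺ (s≤s n≤M))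

    module _ (C : SubsetOf rationalEdges) where

      Path-sym : ∀ {G x y} → Path G x y → Path G y x
      Path-sym = Star.reverse λ { (e , e∈G , inj₁ p) → e , e∈G , inj₂ p ; (e , e∈G , inj₂ p) → e , e∈G , inj₁ p }

      uncut⇒path : ∀ {M x y} → x ∈ Δ → y ∈ Δ → RationalPoint x → RationalPoint y → x ∈ˡ points M → y ∈ˡ points M →
                   Uncut x y C → Path (Survives M C) x y
      uncut⇒path {M} {x} {y} x∈Δ y∈Δ rx ry px py u = decide em₀
        where
        decide : Dec (x ≡ y) → Path (Survives M C) x y
        decide (yes refl) = Star.ε
        decide (no x≢y)   = (e , (((rx , ry) , px , py) , λ (e∈C , _) → u e refl refl e∈C) , inj₁
            (refl , refl)) ◅ Star.ε
          where e = edgeBetween x∈Δ y∈Δ x≢y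

      tail-path : ∀ {z M} → z ∈ Δ → z ∈ˡ ends → ∀ N → Tail z N C → ∀ j → N ℕ.+ j ℕ.≤ M →
                  Path (Survives M C) (approx z N) (approx z (N ℕ.+ j))
      tail-path {z} {M} z∈Δ z∈ N tail zero    le = subst (λ n → Path (Survives M C) (approx z N) (approx z n))
          (sym (ℕ.+-identityʳ N)) Star.ε
      tail-path {z} {M} z∈Δ z∈ N tail (suc j) le =
        subst (λ n → Path (Survives M C) (approx z N) (approx z n)) (sym (ℕ.+-suc N j))
          (tail-path z∈Δ z∈ N tail j (ℕ.<⇒≤ le′) ◅◅
            uncut⇒path (inΔ p) (inΔ q) (isRat p) (isRat q) (points∈ z∈ (ℕ.<⇒≤ le′)) (points∈ z∈ le′) (tail j))
        where
        le′ : suc (N ℕ.+ j) ℕ.≤ M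
        le′ = subst (ℕ._≤ M) (ℕ.+-suc N j) le
        p = approx-spec (N ℕ.+ j) z∈Δ
        q = approx-spec (suc (N ℕ.+ j)) z∈Δ

      -- Walk from `approx x n` back along the tail to level `N`, cross to the tail of `y`, and
      -- return to level `n`. Since `n` is free above `N`, edges with different thresholds can be
      -- brought to one level.
      joined⇒path : ∀ {x y} → x ∈ Δ → y ∈ Δ → x ∈ˡ ends → y ∈ˡ ends → ∀ N → Joined x y N C →
                    ∀ n → N ℕ.≤ n → Path (Survives n C) (approx x n) (approx y n)
      joined⇒path {x} {y} x∈Δ y∈Δ x∈ y∈ N (tx , ty , u) n N≤n with j , refl ← ℕ.m≤n⇒∃[o]m+o≡n N≤n =
        Path-sym (tail-path x∈Δ x∈ N tx j ℕ.≤-refl) ◅◅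
        (uncut⇒path (inΔ p) (inΔ q) (isRat p) (isRat q) (points∈ x∈ N≤n) (points∈ y∈ N≤n) u ◅◅
        tail-path y∈Δ y∈ N ty j ℕ.≤-refl)
        where
        p = approx-spec N x∈Δ
        q = approx-spec N y∈Δ

      -- Each edge of the path has its own threshold; their maximum serves all of them, and at a
      -- common level the walks for successive edges meet.
      descend : ∀ {G : Pred Edge 0ℓ} → (∀ {e} → e ∈ G → Any (e ≈_) es) →
                (∀ {e} → e ∈ G → ∃[ N ] Joined (end₁ e) (end₂ e) N C) → ∀ {x y} → Path G x y →
                ∃[ N ] ∀ n → N ℕ.≤ n → Path (Survives n C) (approx x n) (approx y n)
      descend inE joined Star.ε = 0 , λ _ _ → Star.ε
      descend {G} inE joined {x} {y} (_◅_ {j = z} (e , e∈G , xz) path) =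
        let N , next = descend {G} inE joined path
            M , j    = joined {e} e∈G
            p , q    = ends∈ {e} (inE {e} e∈G)
        in M ℕ.⊔ N , λ n le → orient xz (joined⇒path (end₁∈Δ e) (end₂∈Δ e) p q M j n (ℕ.m⊔n≤o⇒m≤o M N le))
                                ◅◅ next n (ℕ.m⊔n≤o⇒n≤o M N le)
        where
        orient : ∀ {n} → (end₁ e ≡ x × end₂ e ≡ z) ⊎ (end₁ e ≡ z × end₂ e ≡ x) →
                 Path (Survives n C) (approx (end₁ e) n) (approx (end₂ e) n) → Path (Survives n C) (approx x n)
                     (approx z n)
        orient (inj₁ (refl , refl)) path = path
        orient (inj₂ (refl , refl)) path = Path-sym path

  -- The level found by `descend` depends on the path and hence on `C`, so `K M` has to be cut for
  -- every `M`. There are countably many of these conditions, as `almost-sure` requires.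
  Φ-kWayCut : ∀ {E} (finE : Finite E) C → (∀ M → IsKWayCut (K (proj₁ finE) M) (restrictSet C)) → IsKWayCut E
      (restrictSet (Φ C))
  Φ-kWayCut {E} (es , cover) C cuts i j i≢j path =
    let G = λ e → e ∈ member E × e ∉ elements (restrictSet {E} (Φ C))
        N , paths = descend es C {G} (λ {e} (e∈E , _) → cover e∈E)
            (λ {e} (e∈E , e∉) → stable λ none → e∉ (none , e∈E)) path
    in cuts N i j i≢j (subst₂ (Path (Survives es N C)) (approx-terminal i N) (approx-terminal j N) (paths N ℕ.≤-refl))

  extend : CuttingScheme rationalEdges → CuttingScheme allEdges
  extend P = record
    { measure        = pushforward Φ Φ-Cuts-measurable measure
    ; finite-schemes = λ E E⊆ finE → kWayCut-measurable E finE , almost-surely E E⊆ finE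
    }
    where
    open CuttingScheme P
    open ProbabilityMeasure measure
    open Probability measure
    almost-surely : ∀ E (E⊆ : member E ⊆ member allEdges) (finE : Finite E) →
      ProbabilityMeasure.Pr (restrict E⊆ (pushforward Φ Φ-Cuts-measurable measure)) (IsKWayCut E)
          (kWayCut-measurable E finE) ≡ 1#
    almost-surely E E⊆ finE = almost-sure (λ M → proj₁ (scheme M)) (λ M → proj₂ (scheme M))
      (λ {C} → Φ-kWayCut {E} finE C) _
      where
      scheme : ∀ M → Σ[ a ∈ Measurable {rationalEdges} (restrictSet ⊢ IsKWayCut (K (proj₁ finE) M)) ] Pr _ a ≡ 1#
      scheme M with a , one ← finite-schemes (K (proj₁ finE) M) proj₁
          (completeRational-finite (points (proj₁ finE) M)) =
        restrict-measurable proj₁ a , one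

-- Maximum density, restriction of schemes, and a scheme that always exists.

module Densities (em : ExcludedMiddle (lsuc 0ℓ)) (R : CompleteOrderedField) (k : ℕ) where
  open CuttingSchemes em R k
  open Reals em R
  open Measures em R k
  open FiniteEvents em R k
  open RationalApproximation em R
  open ExtendedScheme em R k
  module E = Extrema _≤_
  module ≤± = IsTotalOrder (E.≤±-isTotalOrder-≡ isTotalOrder)

  [x]≰⊥ : ∀ {x} → ¬ [ x ] ≤± ⊥±
  [x]≰⊥ Supremum.[ () ]

  0<length : ∀ e → 0# < length e
  0<length e = dist-pos (distinct e)

  module _ {F : EdgeSet} (P : CuttingScheme F) where
    open CuttingScheme P
    open ProbabilityMeasure measure

    density-nonNegative : ∀ e e∈F → 0# ≤ density e e∈F
    density-nonNegative e e∈F = *-nonNegative (nonNegative (generator {e = e} e∈F)) (proj₁ (⁻¹-pos (0<length e)))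

    density≤⇒probability≤ : ∀ {T} e e∈F → density e e∈F ≤ T → cutProbability e e∈F ≤ T * length e
    density≤⇒probability≤ e e∈F p = ≤-respˡ (begin
        c * l ⁻¹ * l    ≡⟨ solve 3 (λ c i l → c :* i :* l := c :* (l :* i)) refl c (l ⁻¹) l ⟩
        c * (l * l ⁻¹)  ≡⟨ cong (c *_) (inverseʳ (0<length e)) ⟩
        c * 1#          ≡⟨ ℛ.*-identityʳ c ⟩
        c               ∎)
      (*-monoˡ-≤ (proj₁ (0<length e)) p)
      where
      open ≡-Reasoning
      c = cutProbability e e∈F
      l = length e

    probability≤⇒density≤ : ∀ {T} e e∈F → cutProbability e e∈F ≤ T * length e → density e e∈F ≤ T
    probability≤⇒density≤ {T} e e∈F p = ≤-respʳ (trans (ℛ.*-assoc T l (l ⁻¹))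
        (trans (cong (T *_) (inverseʳ (0<length e))) (ℛ.*-identityʳ T)))
      (*-monoˡ-≤ (proj₁ (⁻¹-pos (0<length e))) p)
      where l = length e

    private
      maxDensity-isSup = proj₂ (sup-exists (lower-em em) λ d → ∃[ e ] Σ[ e∈F ∈ e ∈ member F ] d ≡ [ density e e∈F ])

    density≤maxDensity : ∀ e e∈F → [ density e e∈F ] ≤± maxDensity P
    density≤maxDensity e e∈F = proj₁ maxDensity-isSup (e , e∈F , refl)

    maxDensity-least : ∀ {b} → (∀ e e∈F → [ density e e∈F ] ≤± b) → maxDensity P ≤± b
    maxDensity-least bound = proj₂ maxDensity-isSup λ { (e , e∈F , refl) → bound e e∈F }

    maxDensity≤⇒probability≤ : ∀ {T} → maxDensity P ≤± [ T ] → ∀ e e∈F → cutProbability e e∈F ≤ T * length e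
    maxDensity≤⇒probability≤ p e e∈F =
      density≤⇒probability≤ e e∈F (E.[≤]-injective (≤±.trans (density≤maxDensity e e∈F) p))

    probability≤⇒maxDensity≤ : ∀ {T} → (∀ e e∈F → cutProbability e e∈F ≤ T * length e) → maxDensity P ≤± [ T ]
    probability≤⇒maxDensity≤ p = maxDensity-least λ e e∈F → E.[ probability≤⇒density≤ e e∈F (p e e∈F) ]

  module _ {F : EdgeSet} where
    private
      τ-isInf = proj₂ (inf-exists em λ d → ∃[ P ] d ≡ maxDensity {F} P)

    τ≤maxDensity : (P : CuttingScheme F) → τ F ≤± maxDensity P
    τ≤maxDensity P = proj₁ τ-isInf (P , refl)

    τ-greatest : ∀ {b} → ((P : CuttingScheme F) → b ≤± maxDensity P) → b ≤± τ F
    τ-greatest bound = proj₂ τ-isInf λ { (P , refl) → bound P }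

  restrictScheme : ∀ {E F} → member E ⊆ member F → CuttingScheme F → CuttingScheme E
  restrictScheme {E} {F} E⊆F P = record
    { measure        = restrict E⊆F measure
    ; finite-schemes = λ D D⊆E finD → finite D D⊆E (finite-schemes D (λ {e} → E⊆F {e} ∘ D⊆E {e}) finD)
    }
    where
    open CuttingScheme P
    finite : ∀ D (D⊆E : member D ⊆ member E) → SupportedOnKWayCuts D (restrict (λ {e} → E⊆F {e} ∘ D⊆E {e}) measure) →
             SupportedOnKWayCuts D (restrict D⊆E (restrict E⊆F measure))
    -- Restricting a cut to `E` and then to `D` leaves the same edges of `D` uncut as restricting to
    -- `D` at once.
    finite D D⊆E (a , one) = a , trans (ProbabilityMeasure.Pr-cong measure _ _
      ( (λ cut i j i≢j → cut i j i≢j ∘ Path-map λ (e∈D , e∉) → e∈D , λ ((e∈C , _) , _) → e∉ (e∈C , e∈D))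
      , (λ cut i j i≢j → cut i j i≢j ∘ Path-map λ {e} (e∈D , e∉) → e∈D , λ (e∈C , _) → e∉
          ((e∈C , D⊆E {e} e∈D) , e∈D)))) one

  restrictScheme-maxDensity : ∀ {E F} (E⊆F : member E ⊆ member F) (P : CuttingScheme F) →
    maxDensity (restrictScheme {E} E⊆F P) ≤± maxDensity P
  restrictScheme-maxDensity {E} E⊆F P = maxDensity-least (restrictScheme {E} E⊆F P) λ e e∈E →
    ≤±.trans (≤±.reflexive (cong (λ p → [ p * length e ⁻¹ ])
      (ProbabilityMeasure.Pr-cong (CuttingScheme.measure P) _ (generator {e = e} (E⊆F {e} e∈E))
          (proj₁ , λ e∈C → e∈C , e∈E))))
      (density≤maxDensity P e (E⊆F {e} e∈E))

  terminal-injective : ∀ i j → terminal i ≡ terminal j → i ≡ j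
  terminal-injective i j eq with j Fin.≟ i | trans (sym (lookup∘tabulate _ i))
      (trans (cong (λ v → lookup v i) eq) (lookup∘tabulate _ i))
  ... | yes refl | _ = refl
  ... | no _ | bad with i Fin.≟ i
  ...   | yes _  = contradiction (sym bad) 0≢1
  ...   | no i≢i = contradiction refl i≢i

  module _ (F : EdgeSet) where
    everything : SubsetOf F
    everything = record { set = F ; subset = λ e∈F → e∈F }

    private
      mass : {A : Set} → Dec A → ℝ
      mass (yes _) = 1#
      mass (no  _) = 0#

      0≤mass : {A : Set} (d : Dec A) → 0# ≤ mass d
      0≤mass (yes _) = 0≤1
      0≤mass (no  _) = ≤-refl

      mass-mono : {A B : Set} (d : Dec A) (d′ : Dec B) → (A → B) → mass d ≤ mass d′
      mass-mono (yes a) (yes b) _ = ≤-refl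
      mass-mono (yes a) (no ¬b) f = contradiction (f a) ¬b
      mass-mono (no ¬a) d′      _ = 0≤mass d′

      mass-yes : {A : Set} (d : Dec A) → A → mass d ≡ 1#
      mass-yes (yes _) _ = refl
      mass-yes (no ¬a) a = contradiction a ¬a

      mass-no : {A : Set} (d : Dec A) → ¬ A → mass d ≡ 0#
      mass-no (yes a) ¬a = contradiction a ¬a
      mass-no (no _)  _  = refl

      -- The point mass at the full set `F`, set up as an outer measure so that countable additivity
      -- comes from Carathéodory's construction.
      ν : Event F → ℝ
      ν A = mass (em₀ {A everything})

      ν-⋃ : ∀ {A : ℕ → Event F} {s} → (∀ n → partialSum (ν ∘ A) n ≤ s) → Dec (⋃ ℕ A everything) → ν (⋃ ℕ A) ≤ s
      ν-⋃ {A} bound (yes (n , a)) = ≤-trans (mass-mono em₀ (em₀ {A n everything}) λ _ → a) (≤-trans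
        (≤-respʳ (sym (partialSum-last (ν ∘ A) n))
          (≤-respˡ (ℛ.+-identityˡ _) (+-mono-≤ (partialSum-incr {ν ∘ A} (λ _ → 0≤mass em₀) {0} {n} z≤n) ≤-refl)))
        (bound (suc n)))
      ν-⋃ bound (no ¬a) = ≤-trans (≤-reflexive (mass-no em₀ ¬a)) (bound 0)

      diracOuter : OuterMeasure F
      diracOuter = record
        { μ*          = ν
        ; nonNegative = λ _ → 0≤mass em₀
        ; empty       = ≤-reflexive (mass-no em₀ λ ())
        ; monotone    = λ A⊆B → mass-mono em₀ em₀ A⊆B
        ; subadditive = λ {A} bound → ν-⋃ {A} bound em₀
        }

      dirac-splits : ∀ A → OuterMeasure.Splits diracOuter A
      dirac-splits A T with em₀ {A everything}
      ... | yes a = ≤-trans (+-mono-≤ (mass-mono em₀ em₀ proj₁) (≤-reflexive (mass-no em₀ λ (_ , ¬a) → ¬a a)))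
          (≤-reflexive (ℛ.+-identityʳ _))
      ... | no ¬a = ≤-trans (+-mono-≤ (≤-reflexive (mass-no em₀ λ (_ , a) → ¬a a)) (mass-mono em₀ em₀ proj₁))
          (≤-reflexive (ℛ.+-identityˡ _))

    -- Supplies an optimal scheme when `τ` is `⊤±`, where the existence of some scheme is the whole
    -- question.
    cutEverything : CuttingScheme F
    cutEverything = record
      { measure        = OuterMeasure.toProbabilityMeasure diracOuter (λ {e} _ → dirac-splits (Cuts e)) (mass-yes em₀ _)
      ; finite-schemes = λ E E⊆F finE → kWayCut-measurable E finE , mass-yes em₀ (isolated E E⊆F)
      }
      where
      isolated : ∀ E → member E ⊆ member F → IsKWayCut E (restrictSet everything)
      isolated E E⊆F i j i≢j path = nonempty path (λ eq → i≢j (terminal-injective i j eq))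
        where
        nonempty : ∀ {x y} → Path (λ e → e ∈ member E × e ∉ elements (restrictSet {E} everything)) x y → ¬ x ≢ y
        nonempty Star.ε x≢y = x≢y refl
        nonempty ((e , (e∈E , e∉) , _) ◅ _) _ = e∉ (E⊆F {e} e∈E , e∈E)

-- An optimal scheme on the rational edges, and the comparison of the two values of `τ`.

module Optimum (em : ExcludedMiddle (lsuc 0ℓ)) (R : CompleteOrderedField) (k : ℕ) (i₀ i₁ : Fin k)
    (i₀≢i₁ : i₀ ≢ i₁) where
  open CuttingSchemes em R k
  open Reals em R
  open Measures em R k
  open FiniteEvents em R k
  open RationalApproximation em R
  open Enumerations
  open Extension em R k
  open ExtendedScheme em R k
  open Formulas em R k
  open LimitMeasures em R k
  open Densities em R k

  -- A concrete rational edge, used both to bound `τ` from below and as the default value of the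
  -- enumeration of rational edges.
  terminalEdge : Edge
  terminalEdge = edgeBetween (terminal∈Δ i₀) (terminal∈Δ i₁) (i₀≢i₁ ∘ terminal-injective i₀ i₁)

  terminalEdge-rational : terminalEdge ∈ member rationalEdges
  terminalEdge-rational = terminal-rational i₀ , terminal-rational i₁

  -- The supremum over an empty set of edges would be `⊥±`; one edge with its nonnegative density
  -- excludes this.
  0≤τ : [ 0# ] ≤± τ rationalEdges
  0≤τ = τ-greatest λ P → ≤±.trans E.[ density-nonNegative P terminalEdge terminalEdge-rational ]
    (density≤maxDensity P terminalEdge terminalEdge-rational)

  record Coded (n : ℕ) : Set where
    field
      edge         : Edge
      isRat        : edge ∈ member rationalEdges
      code₁        : end₁ edge ≡ rationalPoint k (proj₁ (unpair n))
      code₂        : end₂ edge ≡ rationalPoint k (proj₂ (unpair n))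

  private
    decode : ∀ {n} → Dec (Coded n) → Σ[ e ∈ Edge ] e ∈ member rationalEdges
    decode (yes c) = Coded.edge c , Coded.isRat c
    -- Codes of coinciding points or of points outside `Δ` get an arbitrary rational edge;
    -- repetitions do no harm to an enumeration.
    decode (no  _) = terminalEdge , terminalEdge-rational

    decode-onto : ∀ {n} (d : Dec (Coded n)) (c : Coded n) → Coded.edge c ≈ proj₁ (decode d)
    decode-onto (yes d) c = inj₁ (trans (Coded.code₁ c) (sym (Coded.code₁ d)) , trans (Coded.code₂ c)
        (sym (Coded.code₂ d)))
    decode-onto (no ¬c) c = contradiction c ¬c

  abstract
    rationalEdge : ℕ → Edge
    rationalEdge n = proj₁ (decode {n} em₀)

    rationalEdge-rational : ∀ n → rationalEdge n ∈ member rationalEdges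
    rationalEdge-rational n = proj₂ (decode {n} em₀)

    rationalEdge-onto : ∀ e → e ∈ member rationalEdges → ∃[ n ] e ≈ rationalEdge n
    rationalEdge-onto e (r₁ , r₂) =
      let a , a-eq = rationalPoint-onto r₁
          b , b-eq = rationalPoint-onto r₂
          n , n-eq = unpair-onto a b
      in n , decode-onto {n} em₀ record
        { edge = e ; isRat = r₁ , r₂
        ; code₁ = trans a-eq (cong (rationalPoint k ∘ proj₁) (sym n-eq))
        ; code₂ = trans b-eq (cong (rationalPoint k ∘ proj₂) (sym n-eq)) }

  module _ {T : ℝ} (P : ℕ → CuttingScheme rationalEdges) (P-density : ∀ n → maxDensity (P n) ≤± [ T + δ n ]) where
    private
      module L = LimitMeasure {rationalEdges} rationalEdge rationalEdge-rational rationalEdge-onto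
          (λ n → CuttingScheme.measure (P n))
      open Semantics {rationalEdges} rationalEdge rationalEdge-rational rationalEdge-onto

    Cuts-definable : ∀ {e} → e ∈ member rationalEdges → Definable (Cuts e)
    Cuts-definable {e} r = var (proj₁ (rationalEdge-onto e r)) , Cuts≐var {e} r

    limitScheme : CuttingScheme rationalEdges
    limitScheme = record
      { measure        = L.limitMeasure
      ; finite-schemes = λ E E⊆ finE → kWayCut-measurable E finE ,
          L.limit-≡1 (restrict-measurable E⊆ (kWayCut-measurable E finE))
            (restricted-kWayCut {E} definable-isBooleanAlgebra (λ {e} → Cuts-definable {e}) finE)
            λ n → let a , one = CuttingScheme.finite-schemes (P n) E E⊆ finE in
              trans (ProbabilityMeasure.Pr-cong (CuttingScheme.measure (P n)) _ _ ((λ x → x) , λ x → x)) one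
      }

    limitScheme-density : maxDensity limitScheme ≤± [ T ]
    limitScheme-density = probability≤⇒maxDensity≤ limitScheme λ e r →
      -- The slack `δ n` in the density becomes `length e * δ n` in the probability, so `length e`
      -- is the coefficient of the vanishing error.
      L.limit-≤ (generator {e = e} r) (Cuts-definable {e} r) {T * length e} {length e} (proj₁ (0<length e)) λ n →
        ≤-trans (maxDensity≤⇒probability≤ (P n) (P-density n) e r)
          (≤-reflexive (solve 3 (λ t d l → (t :+ d) :* l := t :* l :+ l :* d) refl T (δ n) (length e)))

  -- Otherwise `T + δ n` would be a lower bound for all maximum densities, above their infimum `T`.
  near-optimal : ∀ {T} → τ rationalEdges ≡ [ T ] → ∀ n → Σ[ P ∈ CuttingScheme rationalEdges ] maxDensity P ≤± [ T + δ n ]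
  near-optimal {T} τ≡T n = stable₁ λ none → <⇒≱ (0<δ n)
    (linear₁ (E.[≤]-injective (subst ([ T + δ n ] ≤±_) τ≡T
        (τ-greatest λ P → other P (≤±.total (maxDensity P) [ T + δ n ]) none)))
      (solve 2 (λ t d → :0 :+ (t :+ d) := d :+ t) refl T (δ n)))
    where
    other : ∀ P → maxDensity P ≤± [ T + δ n ] ⊎ [ T + δ n ] ≤± maxDensity P →
            ¬ (Σ[ P ∈ CuttingScheme rationalEdges ] maxDensity P ≤± [ T + δ n ]) → [ T + δ n ] ≤± maxDensity P
    other P (inj₁ p) none = contradiction (P , p) none
    other P (inj₂ p) _    = p

  -- Limits are needed only for a finite value of `τ`: `⊥±` contradicts `0≤τ`, and at `⊤±` the
  -- inequality `τ ≤ maxDensity` already makes any scheme optimal.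
  optimal : Σ[ P ∈ CuttingScheme rationalEdges ] maxDensity P ≡ τ rationalEdges
  optimal = by-value (τ rationalEdges) refl
    where
    by-value : ∀ t → τ rationalEdges ≡ t → Σ[ P ∈ CuttingScheme rationalEdges ] maxDensity P ≡ τ rationalEdges
    by-value ⊥± τ≡⊥ = contradiction (subst ([ 0# ] ≤±_) τ≡⊥ 0≤τ) [x]≰⊥
    by-value [ T ] τ≡T = limitScheme P P-density ,
      ≤±.antisym (subst (maxDensity (limitScheme P P-density) ≤±_) (sym τ≡T) (limitScheme-density P P-density))
        (τ≤maxDensity (limitScheme P P-density))
      where
      P         = λ n → proj₁ (near-optimal τ≡T n)
      P-density = λ n → proj₂ (near-optimal τ≡T n)
    by-value ⊤± τ≡⊤ = cutEverything rationalEdges ,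
      ≤±.antisym (subst (maxDensity (cutEverything rationalEdges) ≤±_) (sym τ≡⊤) (_ E.≤⊤±))
          (τ≤maxDensity (cutEverything rationalEdges))

  τ≤maxDensity-all : (Q : CuttingScheme allEdges) → τ rationalEdges ≤± maxDensity Q
  τ≤maxDensity-all Q = ≤±.trans (τ≤maxDensity (restrictScheme {rationalEdges} _ Q))
      (restrictScheme-maxDensity {rationalEdges} _ Q)

  extend-density : (P : CuttingScheme rationalEdges) → maxDensity P ≡ τ rationalEdges → maxDensity
      (extend P) ≡ τ rationalEdges
  extend-density P P-optimal = ≤±.antisym (by-value (τ rationalEdges) refl) (τ≤maxDensity-all (extend P))
    where
    by-value : ∀ t → τ rationalEdges ≡ t → maxDensity (extend P) ≤± τ rationalEdges
    by-value ⊥± τ≡⊥ = contradiction (subst ([ 0# ] ≤±_) τ≡⊥ 0≤τ) [x]≰⊥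
    by-value [ T ] τ≡T = subst (maxDensity (extend P) ≤±_) (sym τ≡T) (probability≤⇒maxDensity≤ (extend P) λ e _ →
      DensityBound.Φ-Cuts-bound (CuttingScheme.measure P) (E.[≤]-injective (subst ([ 0# ] ≤±_) τ≡T 0≤τ))
        (maxDensity≤⇒probability≤ P (≤±.reflexive (trans P-optimal τ≡T))) e (Φ-Cuts-measurable e _))
    by-value ⊤± τ≡⊤ = subst (maxDensity (extend P) ≤±_) (sym τ≡⊤) (_ E.≤⊤±)

  τ-all≡τ-rational : τ allEdges ≡ τ rationalEdges
  τ-all≡τ-rational = ≤±.antisym
    (subst (τ allEdges ≤±_) (extend-density (proj₁ optimal) (proj₂ optimal)) (τ≤maxDensity (extend (proj₁ optimal))))
    (τ-greatest τ≤maxDensity-all)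

open import Data.Nat.Base using (_≤_)

lemma7p7 : (em : ExcludedMiddle (lsuc 0ℓ)) (R : CompleteOrderedField) (k : ℕ) → 3 ≤ k →
    let open CuttingSchemes em R k in
    (Σ[ P ∈ CuttingScheme rationalEdges ] maxDensity P ≡ τ rationalEdges)
    × ((P : CuttingScheme rationalEdges) → maxDensity P ≡ τ rationalEdges →
    Σ[ P̄ ∈ CuttingScheme allEdges ] maxDensity P̄ ≡ τ rationalEdges)
    × τ allEdges ≡ τ rationalEdges
lemma7p7 em R k@(suc (suc _)) (s≤s (s≤s _)) = optimal ,
    (λ P P-optimal → extend P , extend-density P P-optimal) , τ-all≡τ-rational
  where
  open ExtendedScheme em R k
  open Optimum em R k Fin.zero (Fin.suc Fin.zero) (λ ())
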